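{- The factorial Grothendieck polynomials $G_\lambda(x|a)$, as $\lambda$ runs over all partitions with $\ell(\lambda)\le n$, form a basis of $\Lambda_n\otimes_{\mathbb{Z}}\mathbb{F}(\beta,a)$ over $\mathbb{F}(\beta,a)$.
   Context: Fix a positive integer $n$, a field $\mathbb{F}$, an indeterminate $\beta$ over $\mathbb{F}$, variables $x=(x_1,\dots,x_n)$ and a sequence of variables $a=(a_k)_{k\ge1}$; $\mathbb{F}(\beta,a)$ is the field of rational functions in $\beta$ and the $a_k$. $\Lambda_n$ is the ring of symmetric polynomials in $x_1,\dots,x_n$ over $\mathbb{Z}$. A partition is identified with its Young diagram (box $(i,j)$ in row $i$ from the top, column $j$); $\ell(\lambda)$ is its number of nonzero parts, $|\lambda|$ its number of boxes, $c(i,j)=j-i$ the content of a box. A set-valued $\lambda$-tableau $T$ assigns to each box $\alpha$ a non-empty set $T(\alpha)\subset\{1,\dots,n\}$ such that $\max T(\alpha)\le\min T(\alpha')$ if $\alpha$ is immediately left of $\alpha'$, and $\max T(\alpha)<\min T(\alpha')$ if $\alpha$ is immediately above $\alpha'$; $|T|=\sum_\alpha|T(\alpha)|$. With $x\oplus y=x+y+\beta xy$, $$G_\lambda(x|a)=\sum_T\beta^{|T|-|\lambda|}\prod_{\alpha\in\lambda,\ r\in T(\alpha)}\bigl(x_r\oplus a_{r+c(\alpha)}\bigr),$$ summed over all set-valued $\lambda$-tableaux (for the empty partition this is $1$). -}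

module Defs where

open import Algebra.Apartness.Bundles using (HeytingField)
open import Algebra.Bundles.Raw using (RawRing)
import Algebra.Definitions.RawMonoid as RawMonoidDefinitions
import Algebra.Definitions.RawSemiring as RawSemiringDefinitions
open import Algebra.Module.Bundles.Raw using (RawLeftModule)
open import Data.Bool.Base using (if_then_else_)
open import Data.Fin.Base as Fin using (Fin; zero; suc; toℕ)
import Data.Fin.Permutation as Perm
import Data.Fin.Properties as Fin
open import Data.Fin.Subset using (Subset; inside; outside; Nonempty; _∈_; ∣_∣)
open import Data.Fin.Subset.Properties using (_∈?_; nonempty?)
open import Data.Integer.Base as ℤ using (ℤ; +_; -[1+_])
open import Data.List.Base as List
  using (List; []; _∷_; _++_; length; filter; foldr; allFin; cartesianProductWith)
open import Data.List.Relation.Unary.All using (All; all?)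
open import Data.List.Relation.Unary.Linked using (Linked)
open import Data.Nat.Base as ℕ using (ℕ; zero; suc; _∸_)
import Data.Nat.ListAction as ListAction
import Data.Nat.Properties as ℕ
open import Data.Product.Base using (Σ; Σ-syntax; ∃-syntax; _×_; _,_; proj₁; proj₂)
open import Data.Vec.Base using ([]; _∷_)
open import Function.Base using (_∘_)
open import Function.Definitions using (Injective)
open import Level using (Level; _⊔_)
open import Relation.Binary.Definitions using (DecidableEquality)
open import Relation.Binary.PropositionalEquality.Core using (_≡_; refl; cong)
open import Relation.Nullary using (¬_; Dec; yes; no; does)
open import Relation.Nullary.Decidable using (_×-dec_; _→-dec_; map′)

private
  variable
    c ℓ m ℓm : Level
    A : Set c

fromℤ : (R : RawRing c ℓ) → ℤ → RawRing.Carrier R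
fromℤ R z = go z
  where
  open RawRing R
  open RawSemiringDefinitions rawSemiring using () renaming (_×_ to _·_)
  go : ℤ → Carrier
  go (+ k)    = k · 1#
  go -[1+ k ] = - (suc k · 1#)

-- R[V] for a possibly infinite set V of variables.
module Polynomial (R : RawRing c ℓ) {V : Set} (_≟_ : DecidableEquality V) where
  private module R = RawRing R

  -- A monomial is a word in the variables, considered up to reordering.
  Monomial : Set
  Monomial = List V

  exponent : V → Monomial → ℕ
  exponent v w = length (filter (v ≟_) w)

  -- All other variables have exponent 0 on both sides.
  _≈ₘ_ : Monomial → Monomial → Set
  w ≈ₘ w′ = All (λ v → exponent v w ≡ exponent v w′) (w ++ w′)

  _≈ₘ?_ : ∀ w w′ → Dec (w ≈ₘ w′)
  w ≈ₘ? w′ = all? (λ v → exponent v w ℕ.≟ exponent v w′) (w ++ w′)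

  -- A finite formal sum of terms; monomials may repeat and coefficients may
  -- vanish, so equality is equality of all coefficients.
  Poly : Set c
  Poly = List (R.Carrier × Monomial)

  coefficient : Poly → Monomial → R.Carrier
  coefficient p w =
    foldr (λ (a , w′) s → (if does (w ≈ₘ? w′) then a else R.0#) R.+ s) R.0# p

  constant : R.Carrier → Poly
  constant a = (a , []) ∷ []

  var : V → Poly
  var v = (R.1# , v ∷ []) ∷ []

  rename : (V → V) → Poly → Poly
  rename f = List.map (λ (a , w) → a , List.map f w)

  polyRing : RawRing c ℓ
  polyRing = record
    { Carrier = Poly
    ; _≈_     = λ p q → ∀ w → coefficient p w R.≈ coefficient q w
    ; _+_     = _++_
    ; _*_     = cartesianProductWith (λ (a , w) (b , w′) → a R.* b , w ++ w′)
    ; -_      = List.map (λ (a , w) → R.- a , w)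
    ; 0#      = []
    ; 1#      = constant R.1#
    }

-- The field of fractions of D, assumed to be an integral domain.
module FractionField (D : RawRing c ℓ) where
  open RawRing D

  NonZeroElement : Set (c ⊔ ℓ)
  NonZeroElement = Σ[ q ∈ Carrier ] ¬ (q ≈ 0#)

  -- The denominator is kept as a list of nonzero factors, so that denominators
  -- can be multiplied without appealing to the absence of zero divisors.
  record Fraction : Set (c ⊔ ℓ) where
    constructor _/_
    field
      num     : Carrier
      factors : List NonZeroElement

    den : Carrier
    den = foldr (λ q d → proj₁ q * d) 1# factors

  open Fraction

  embed : Carrier → Fraction
  embed p = p / []

  fractionField : RawRing (c ⊔ ℓ) ℓ
  fractionField = record
    { Carrier = Fraction
    ; _≈_     = λ s t → num s * den t ≈ num t * den s
    ; _+_     = λ s t → (num s * den t + num t * den s) / (factors s ++ factors t)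
    ; _*_     = λ s t → (num s * num t) / (factors s ++ factors t)
    ; -_      = λ s → (- num s) / factors s
    ; 0#      = embed 0#
    ; 1#      = embed 1#
    }

-- `a′ k` stands for the variable a_{k+1}.
data Parameter : Set where
  β′ : Parameter
  a′ : ℕ → Parameter

_≟ᴾ_ : DecidableEquality Parameter
β′   ≟ᴾ β′   = yes refl
β′   ≟ᴾ a′ _ = no λ ()
a′ _ ≟ᴾ β′   = no λ ()
a′ k ≟ᴾ a′ l = map′ (cong a′) (λ { refl → refl }) (k ℕ.≟ l)

-- The field 𝔽(β, a).
module RationalFunctions {ℓ₁ ℓ₂} (F : HeytingField c ℓ₁ ℓ₂) where
  private
    module F = HeytingField F

    coefficientField : RawRing c ℓ₁
    coefficientField = record
      { Carrier = F.Carrier ; _≈_ = F._≈_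
      ; _+_ = F._+_ ; _*_ = F._*_ ; -_ = F.-_ ; 0# = F.0# ; 1# = F.1# }

  open Polynomial coefficientField _≟ᴾ_ public using ()
    renaming (var to parameter; polyRing to 𝔽[β,a])
  open FractionField 𝔽[β,a] public using (embed)
    renaming (Fraction to RationalFunction; fractionField to 𝔽⟨β,a⟩)

  β : RationalFunction
  β = embed (parameter β′)

  -- a k is a_{k+1}.
  a : ℕ → RationalFunction
  a k = embed (parameter (a′ k))

-- Λₙ ⊗_ℤ K.
module SymmetricPolynomials (n : ℕ) (K : RawRing c ℓ) where
  private
    module K = RawRing K
    module ℤ[x] = Polynomial ℤ.+-*-rawRing (Fin._≟_ {n})

  open RawRing ℤ[x].polyRing using () renaming (_≈_ to _≈ℤ_; _+_ to _+ℤ_; 0# to 0ℤ)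

  module K[x] = Polynomial K (Fin._≟_ {n})
  open RawRing K[x].polyRing using (_+_; _*_; 0#)

  Symmetric : ℤ[x].Poly → Set
  Symmetric f = ∀ (σ : Perm.Permutation′ n) → ℤ[x].rename (σ Perm.⟨$⟩ʳ_) f ≈ℤ f

  Λ : Set
  Λ = Σ ℤ[x].Poly Symmetric

  -- Formal sums of pure tensors f ⊗ a, modulo additivity in each argument.
  Tensor : Set c
  Tensor = List (Λ × K.Carrier)

  infix 4 _≈⊗_
  data _≈⊗_ : Tensor → Tensor → Set (c ⊔ ℓ) where
    ≈⊗-refl  : ∀ {s} → s ≈⊗ s
    ≈⊗-sym   : ∀ {s t} → s ≈⊗ t → t ≈⊗ s
    ≈⊗-trans : ∀ {s t u} → s ≈⊗ t → t ≈⊗ u → s ≈⊗ u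
    ++-cong  : ∀ {s s′ t t′} → s ≈⊗ s′ → t ≈⊗ t′ → s ++ t ≈⊗ s′ ++ t′
    ++-comm  : ∀ s t → s ++ t ≈⊗ t ++ s
    ⊗-cong   : ∀ {f g : Λ} {a b} → proj₁ f ≈ℤ proj₁ g → a K.≈ b →
               (f , a) ∷ [] ≈⊗ (g , b) ∷ []
    ⊗-zeroˡ  : ∀ {f : Λ} {a} → proj₁ f ≈ℤ 0ℤ → (f , a) ∷ [] ≈⊗ []
    ⊗-zeroʳ  : ∀ {f : Λ} → (f , K.0#) ∷ [] ≈⊗ []
    -- Here h plays the role of f + g.
    ⊗-addˡ   : ∀ {f g h : Λ} {a} → proj₁ h ≈ℤ (proj₁ f +ℤ proj₁ g) →
               (h , a) ∷ [] ≈⊗ (f , a) ∷ (g , a) ∷ []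
    ⊗-addʳ   : ∀ {f : Λ} {a b} →
               (f , a K.+ b) ∷ [] ≈⊗ (f , a) ∷ (f , b) ∷ []

  Λ⊗K : RawLeftModule K.Carrier c (c ⊔ ℓ)
  Λ⊗K = record
    { Carrierᴹ = Tensor
    ; _≈ᴹ_     = _≈⊗_
    ; _+ᴹ_     = _++_
    ; _*ₗ_     = λ b → List.map (λ (f , a) → f , b K.* a)
    ; 0ᴹ       = []
    ; -ᴹ_      = List.map (λ (f , a) → f , K.- a)
    }

  -- The inclusion Λₙ ⊗ K → ℤ[x] ⊗ K = K[x], f ⊗ a ↦ a f, by which elements
  -- of Λₙ ⊗ K are regarded as polynomials over K.
  toPoly : Tensor → K[x].Poly
  toPoly = foldr (λ (f , a) s → K[x].constant a * extend (proj₁ f) + s) 0#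
    where
    extend : ℤ[x].Poly → K[x].Poly
    extend = List.map (λ (z , w) → fromℤ K z , w)

module _ (K : RawRing c ℓ) (M : RawLeftModule (RawRing.Carrier K) m ℓm) where
  private module K = RawRing K
  open RawLeftModule M
  open RawMonoidDefinitions +ᴹ-rawMonoid using (sum)

  combination : {I : Set} → (I → Carrierᴹ) →
                ∀ {k} → (Fin k → K.Carrier) → (Fin k → I) → Carrierᴹ
  combination v coeffs index = sum (λ j → coeffs j *ₗ v (index j))

  LinearlyIndependent : {I : Set} → (I → Carrierᴹ) → Set _
  LinearlyIndependent {I} v =
    ∀ {k} (index : Fin k → I) → Injective _≡_ _≡_ index →
    ∀ coeffs → combination v coeffs index ≈ᴹ 0ᴹ → ∀ j → coeffs j K.≈ K.0#

  Spanning : {I : Set} → (I → Carrierᴹ) → Set _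
  Spanning {I} v =
    ∀ u → ∃[ k ] Σ[ coeffs ∈ (Fin k → K.Carrier) ] Σ[ index ∈ (Fin k → I) ]
      u ≈ᴹ combination v coeffs index

  IsBasis : {I : Set} → (I → Carrierᴹ) → Set _
  IsBasis v = LinearlyIndependent v × Spanning v

record Partition : Set where
  field
    parts      : List ℕ
    decreasing : Linked ℕ._≥_ parts
    positive   : All (0 ℕ.<_) parts

  numParts : ℕ
  numParts = length parts

  size : ℕ
  size = ListAction.sum parts

  rowLength : Fin numParts → ℕ
  rowLength = List.lookup parts

open Partition

PartitionWithAtMost_Parts : ℕ → Set
PartitionWithAtMost n Parts = Σ[ μ ∈ Partition ] numParts μ ℕ.≤ n

-- Each family in the product exactly once, given each element of each factor
-- exactly once.
allFamilies : ∀ {k} {B : Fin k → Set} → (∀ i → List (B i)) → List (∀ i → B i)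
allFamilies {zero}  _ = (λ ()) ∷ []
allFamilies {suc k} L = cartesianProductWith cons (L zero) (allFamilies (L ∘ suc))
  where
  cons : ∀ {B : Fin (suc k) → Set} → B zero → (∀ i → B (suc i)) → ∀ i → B i
  cons b f zero    = b
  cons b f (suc i) = f i

allSubsets : ∀ n → List (Subset n)
allSubsets zero    = [] ∷ []
allSubsets (suc n) =
  List.map (inside ∷_) (allSubsets n) ++ List.map (outside ∷_) (allSubsets n)

-- Rows, columns and the entries 1, …, n are all numbered from 0.
module SetValuedTableaux (n : ℕ) (μ : Partition) where

  Filling : Set
  Filling = (i : Fin (numParts μ)) → Fin (rowLength μ i) → Subset n

  -- max S ≤ min S′ and max S < min S′, for nonempty S and S′.
  _≼_ _≺_ : Subset n → Subset n → Set
  S ≼ S′ = ∀ r s → r ∈ S → s ∈ S′ → r Fin.≤ s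
  S ≺ S′ = ∀ r s → r ∈ S → s ∈ S′ → r Fin.< s

  IsTableau : Filling → Set
  IsTableau T =
    (∀ i j → Nonempty (T i j)) ×
    (∀ i j j′ → toℕ j′ ≡ suc (toℕ j) → T i j ≼ T i j′) ×
    (∀ i i′ j j′ → toℕ i′ ≡ suc (toℕ i) → toℕ j ≡ toℕ j′ → T i j ≺ T i′ j′)

  isTableau? : ∀ T → Dec (IsTableau T)
  isTableau? T =
    Fin.all? (λ i → Fin.all? λ j → nonempty? (T i j)) ×-dec
    Fin.all? (λ i → Fin.all? λ j → Fin.all? λ j′ →
      (toℕ j′ ℕ.≟ suc (toℕ j)) →-dec (T i j ≼? T i j′)) ×-dec
    Fin.all? (λ i → Fin.all? λ i′ → Fin.all? λ j → Fin.all? λ j′ →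
      (toℕ i′ ℕ.≟ suc (toℕ i)) →-dec
      ((toℕ j ℕ.≟ toℕ j′) →-dec (T i j ≺? T i′ j′)))
    where
    _≼?_ : ∀ S S′ → Dec (S ≼ S′)
    S ≼? S′ = Fin.all? λ r → Fin.all? λ s →
      (r ∈? S) →-dec ((s ∈? S′) →-dec (r Fin.≤? s))
    _≺?_ : ∀ S S′ → Dec (S ≺ S′)
    S ≺? S′ = Fin.all? λ r → Fin.all? λ s →
      (r ∈? S) →-dec ((s ∈? S′) →-dec (r Fin.<? s))

  tableaux : List Filling
  tableaux = filter isTableau?
    (allFamilies λ i → allFamilies λ j → allSubsets n)

  weight : Filling → ℕ
  weight T = sum λ i → sum λ j → ∣ T i j ∣
    where open RawMonoidDefinitions ℕ.+-0-rawMonoid using (sum)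

module Grothendieck {ℓ₁ ℓ₂} (F : HeytingField c ℓ₁ ℓ₂) (n : ℕ) where
  open RationalFunctions F
  open SymmetricPolynomials n 𝔽⟨β,a⟩
  open RawRing K[x].polyRing
  open RawSemiringDefinitions rawSemiring using (product; _^_)

  private
    β̂ : K[x].Poly
    β̂ = K[x].constant β

  infixl 6 _⊕_
  _⊕_ : K[x].Poly → K[x].Poly → K[x].Poly
  p ⊕ q = p + q + β̂ * p * q

  module _ (μ : Partition) where
    open SetValuedTableaux n μ

    -- In one-based terms this is a_{r + c(α)} for α = (i , j): with the
    -- zero-based r, i, j used here its index r + j - i is shifted down by one,
    -- as is the argument of `a`.  Column-strictness gives i ≤ r in every
    -- tableau, so the subtraction is never truncated.
    shifted : Fin n → ℕ → ℕ → K[x].Poly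
    shifted r i j = K[x].constant (a (toℕ r ℕ.+ j ∸ i))

    term : Filling → K[x].Poly
    term T = β̂ ^ (weight T ∸ size μ) *
      product λ i → product λ j →
        foldr (λ r p → (K[x].var r ⊕ shifted r (toℕ i) (toℕ j)) * p) 1#
          (filter (_∈? T i j) (allFin n))

    G : K[x].Poly
    G = foldr (λ T p → term T + p) 0# tableaux

{-# OPTIONS --safe #-}
module Submission where

-- For the symmetry of G_λ, record for each letter r the shape of the boxes with an entry at most r.
-- This turns the set-valued tableaux into Gelfand–Tsetlin patterns with marks, so that G_λ(x|a)
-- becomes a sum over chains of shapes of products of one-letter weights.  In the sum over the
-- middle shape of two consecutive steps, with letters x and y, the row lengths can be chosen
-- independently; each row contributes a sum that telescopes after multiplication by x − y, times
-- factors that become symmetric in x and y when combined with those of the neighbouring rows.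
--
-- The least letter occurs only in the first row, so by symmetry G_λ has degree at
-- most λ₁ in every variable, and is a combination of the monomial symmetric polynomials m_ν
-- with ν in a box of width λ₁.  The coefficients are polynomials in β and a, and at β = a = 0
-- they form a matrix that is unitriangular for the statistic Σ (n + 1 − i) λᵢ: only the tableaux
-- with one entry in each box survive, and their entries in row i are at least i.  Hence the
-- transition matrix of a box is invertible over 𝔽(β, a).

open import Defs
open import Algebra.Apartness.Bundles using (HeytingField; HeytingCommutativeRing)
open import Algebra.Bundles using (CommutativeRing; CommutativeMonoid)
open import Algebra.Bundles.Raw using (RawRing)
import Algebra.Definitions.RawMonoid as RawMonoidDefinitions
import Algebra.Definitions.RawSemiring as RawSemiringDefinitions
open import Algebra.Module.Bundles.Raw using (RawLeftModule)
import Algebra.Properties.CommutativeMonoid.Sum as CommutativeMonoidSum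
import Algebra.Properties.Monoid.Mult as MonoidMult
import Algebra.Properties.Monoid.Mult.TCOptimised as TCOptimisedMult
import Algebra.Properties.Ring as RingProperties
import Algebra.Properties.Semiring.Mult as SemiringMult
import Algebra.Solver.Ring as RingSolver
open import Algebra.Solver.Ring.AlmostCommutativeRing
  using (AlmostCommutativeRing; fromCommutativeRing; _-Raw-AlmostCommutative⟶_)
open import Data.Bool.Base using (Bool; true; false; if_then_else_)
import Data.Bool.Properties as Bool
open import Data.Empty using (⊥)
open import Data.Fin.Base as Fin using (Fin; zero; suc; toℕ)
import Data.Fin.Permutation as Perm
import Data.Fin.Properties as Fin
open import Data.Fin.Subset using (Subset; inside; outside; Nonempty; ∣_∣; ⁅_⁆)
  renaming (_∈_ to _∈ₛ_)
open import Data.Fin.Subset.Properties using (x∈⁅x⁆; x∈⁅y⁆⇒x≡y; ⊆-antisym; ∣⁅x⁆∣≡1)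
  renaming (_∈?_ to _∈ₛ?_)
open import Data.Integer.Base as ℤ using (ℤ; +_; -[1+_])
import Data.Integer.Properties as ℤ
open import Data.List.Base as List
  using (List; []; _∷_; _++_; length; filter; foldr; allFin; cartesianProductWith; upTo)
open import Data.List.Membership.Propositional using (_∈_)
import Data.List.Membership.Propositional.Properties as ∈
open import Data.List.Membership.Propositional.Properties.WithK using (unique∧set⇒bag)
import Data.List.Properties as List
open import Data.List.Relation.Binary.BagAndSetEquality using (∼bag⇒↭)
open import Data.List.Relation.Binary.Permutation.Propositional as ↭
  using (_↭_; ↭⇒↭ₛ; ↭-trans; ↭-sym; ↭-reflexive)
import Data.List.Relation.Binary.Permutation.Propositional.Properties as ↭
open import Data.List.Relation.Binary.Pointwise using (Pointwise-≡⇒≡)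
open import Data.List.Relation.Unary.All as All using (All; []; _∷_)
import Data.List.Relation.Unary.All.Properties as All
open import Data.List.Relation.Unary.AllPairs using ([]; _∷_)
open import Data.List.Relation.Unary.Any as Any using (here; there)
import Data.List.Relation.Unary.Any.Properties as Any
open import Data.List.Relation.Unary.Linked as Linked using (Linked; []; [-]; _∷_)
import Data.List.Relation.Unary.Linked.Properties as Linked
open import Data.List.Relation.Unary.Sorted.TotalOrder.Properties using (↗↭↗⇒≋)
import Data.List.Relation.Unary.Unique.DecPropositional.Properties as UniqueDec
open import Data.List.Relation.Unary.Unique.Propositional using (Unique)
import Data.List.Relation.Unary.Unique.Propositional.Properties as Unique
import Data.List.Sort as Sort
open import Data.Maybe.Base using (Maybe; just; nothing)
open import Data.Nat.Base as ℕ using (ℕ; zero; suc; _∸_; z≤n; s≤s; NonZero)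
import Data.Nat.ListAction as ListAction
import Data.Nat.Properties as ℕ
open import Data.Product.Base using (Σ-syntax; ∃-syntax; _×_; _,_; proj₁; proj₂)
open import Data.Sum.Base using (_⊎_; inj₁; inj₂)
open import Data.Unit.Base using (⊤; tt)
import Data.Vec.Base as Vec
import Data.Vec.Properties as Vec
open import Function.Base using (_∘_; id)
open import Function.Bundles using (mk⇔)
open import Level using (Level; _⊔_)
open import Relation.Binary.Bundles using (DecTotalOrder; Setoid)
import Relation.Binary.Construct.Flip.EqAndOrd as Flip
open import Relation.Binary.Definitions using (DecidableEquality; Tri; tri<; tri≈; tri>)
open import Relation.Binary.PropositionalEquality.Core as ≡ using (_≡_; _≢_)
open import Relation.Binary.PropositionalEquality.Properties using (module ≡-Reasoning)
import Relation.Binary.Reasoning.Setoid as SetoidReasoning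
open import Relation.Nullary using (¬_; Dec; yes; no; does; contradiction)
open import Relation.Nullary.Decidable using (¬?; map′; _×-dec_; _⊎-dec_)

-- In the sum over a middle shape, a letter may join the last box of a row only if the row below is
-- short, so neighbouring rows seem coupled. With the outer shapes fixed, however, each of these
-- conditions involves the middle length of a single row. This is why the row sums are independent,
-- and why the coupling survives only in boundary factors.
--
-- G_λ is not homogeneous: marks raise the degree above |λ|, and elimination by degree would not
-- terminate. The bound by λ₁ replaces it, since it leaves finitely many partitions and a square
-- matrix.
--
-- Setting β = a = 0 makes no sense for fractions. Hence the matrix is formed over the polynomials
-- in the parameters, elimination stays there, and only pivots are inverted among the fractions. A
-- pivot is never searched for: its specialization is 1.
--
-- Equality in 𝔽 is not assumed decidable. That 𝔽[β, a] has no zero divisors is therefore proved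
-- under double negations, which tightness of the apartness removes at the end. Equality in Λₙ ⊗ K
-- is generated by relations, so comparing coefficients suffices only after a normal form is
-- established.

-- Integer coefficients and finite sums in a commutative ring

module IntegerCoefficients {c ℓ} (R : CommutativeRing c ℓ) where
  open CommutativeRing R
  open RingProperties ring
  open RawSemiringDefinitions (RawRing.rawSemiring rawRing) using () renaming (_×_ to _·_)
  open RawMonoidDefinitions +-rawMonoid using () renaming (_×′_ to _·′_)
  open TCOptimisedMult +-monoid using (×ᵤ≈×)
  open import Relation.Binary.Reasoning.Setoid setoid

  fromℤ-⊖ : ∀ m n → fromℤ rawRing (m ℤ.⊖ n) ≈ m · 1# - n · 1#
  fromℤ-⊖ zero zero = sym (-‿inverseʳ 0#)
  fromℤ-⊖ zero (suc n) = sym (+-identityˡ _)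
  fromℤ-⊖ (suc m) zero = sym (trans (+-congˡ -0#≈0#) (+-identityʳ _))
  fromℤ-⊖ (suc m) (suc n) = begin
    fromℤ rawRing (suc m ℤ.⊖ suc n) ≡⟨ ≡.cong (fromℤ rawRing) (ℤ.[1+m]⊖[1+n]≡m⊖n m n) ⟩
    fromℤ rawRing (m ℤ.⊖ n)         ≈⟨ fromℤ-⊖ m n ⟩
    x - y                           ≈⟨ +-congʳ (+-identityˡ x) ⟨
    0# + x - y                      ≈⟨ +-congʳ (+-congʳ (-‿inverseʳ 1#)) ⟨
    1# - 1# + x - y                 ≈⟨ +-congʳ (trans (+-assoc _ _ _) (trans (+-congˡ (+-comm _ _))
      (sym (+-assoc _ _ _)))) ⟩
    1# + x - 1# - y                 ≈⟨ +-assoc _ _ _ ⟩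
    1# + x + (- 1# - y)             ≈⟨ +-congˡ (-‿+-comm 1# y) ⟩
    1# + x - (1# + y)               ∎
    where
    x = m · 1#
    y = n · 1#

  fromℤ-neg : ∀ i → fromℤ rawRing (ℤ.- i) ≈ - fromℤ rawRing i
  fromℤ-neg (+ zero)  = sym -0#≈0#
  fromℤ-neg (+ suc n) = refl
  fromℤ-neg -[1+ n ]  = sym (-‿involutive _)

  fromℤ-+ : ∀ i j → fromℤ rawRing (i ℤ.+ j) ≈ fromℤ rawRing i + fromℤ rawRing j
  fromℤ-+ (+ m) (+ n) = MonoidMult.×-homo-+ +-monoid 1# m n
  fromℤ-+ (+ m) -[1+ n ] = fromℤ-⊖ m (suc n)
  fromℤ-+ -[1+ m ] (+ n) = trans (fromℤ-⊖ n (suc m)) (+-comm _ _)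
  fromℤ-+ -[1+ m ] -[1+ n ] = begin
    - (suc (suc (m ℕ.+ n)) · 1#)      ≡⟨ ≡.cong (λ k → - (suc k · 1#)) (ℕ.+-suc m n) ⟨
    - (suc (m ℕ.+ suc n) · 1#)        ≈⟨ -‿cong (MonoidMult.×-homo-+ +-monoid 1# (suc m) (suc n)) ⟩
    - (suc m · 1# + suc n · 1#)       ≈⟨ -‿+-comm _ _ ⟨
    - (suc m · 1#) - (suc n · 1#)     ∎

  fromℤ-* : ∀ i j → fromℤ rawRing (i ℤ.* j) ≈ fromℤ rawRing i * fromℤ rawRing j
  fromℤ-* (+ m) (+ n) = begin
    fromℤ rawRing (+ m ℤ.* + n) ≡⟨ ≡.cong (fromℤ rawRing) (ℤ.pos-* m n) ⟨
    (m ℕ.* n) · 1#              ≈⟨ SemiringMult.×1-homo-* semiring m n ⟩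
    (m · 1#) * (n · 1#)         ∎
  fromℤ-* i@(+ _) -[1+ n ] = begin
    fromℤ rawRing (i ℤ.* (ℤ.- (+ suc n))) ≡⟨ ≡.cong (fromℤ rawRing) (ℤ.neg-distribʳ-* i (+ suc n)) ⟨
    fromℤ rawRing (ℤ.- (i ℤ.* + suc n))   ≈⟨ fromℤ-neg (i ℤ.* + suc n) ⟩
    - fromℤ rawRing (i ℤ.* + suc n)       ≈⟨ -‿cong (fromℤ-* i (+ suc n)) ⟩
    - (fromℤ rawRing i * (suc n · 1#))    ≈⟨ -‿distribʳ-* _ _ ⟩
    fromℤ rawRing i * - (suc n · 1#)      ∎
  fromℤ-* -[1+ m ] (+ n) = begin
    fromℤ rawRing ((ℤ.- (+ suc m)) ℤ.* + n) ≡⟨ ≡.cong (fromℤ rawRing) (ℤ.neg-distribˡ-* (+ suc m) (+ n)) ⟨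
    fromℤ rawRing (ℤ.- (+ suc m ℤ.* + n))   ≈⟨ fromℤ-neg (+ suc m ℤ.* + n) ⟩
    - fromℤ rawRing (+ suc m ℤ.* + n)       ≈⟨ -‿cong (fromℤ-* (+ suc m) (+ n)) ⟩
    - ((suc m · 1#) * (n · 1#))             ≈⟨ -‿distribˡ-* _ _ ⟩
    - (suc m · 1#) * (n · 1#)               ∎
  fromℤ-* -[1+ m ] -[1+ n ] = begin
    (suc m ℕ.* suc n) · 1#                   ≈⟨ SemiringMult.×1-homo-* semiring (suc m) (suc n) ⟩
    (suc m · 1#) * (suc n · 1#)              ≈⟨ -‿involutive _ ⟨
    - - ((suc m · 1#) * (suc n · 1#))        ≈⟨ -‿cong (-‿distribˡ-* _ _) ⟩
    - (- (suc m · 1#) * (suc n · 1#))        ≈⟨ -‿distribʳ-* _ _ ⟩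
    - (suc m · 1#) * - (suc n · 1#)          ∎

  -- fromℤ (+ 1) is 1# + 0#; this variant computes to 1#, which lets the solver
  -- recognise the numeral.
  ⟦_⟧ℤ : ℤ → Carrier
  ⟦ + k ⟧ℤ      = k ·′ 1#
  ⟦ -[1+ k ] ⟧ℤ = - (suc k ·′ 1#)

  ⟦⟧ℤ≈fromℤ : ∀ i → ⟦ i ⟧ℤ ≈ fromℤ rawRing i
  ⟦⟧ℤ≈fromℤ (+ k)    = sym (×ᵤ≈× k 1#)
  ⟦⟧ℤ≈fromℤ -[1+ k ] = -‿cong (sym (×ᵤ≈× (suc k) 1#))

  almostCommutativeRing : AlmostCommutativeRing c ℓ
  almostCommutativeRing = fromCommutativeRing R

  ℤ⟶R : ℤ.+-*-rawRing -Raw-AlmostCommutative⟶ almostCommutativeRing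
  ℤ⟶R = record
    { ⟦_⟧    = ⟦_⟧ℤ
    ; +-homo = λ i j → hom (i ℤ.+ j) (trans (fromℤ-+ i j) (+-cong (sym (⟦⟧ℤ≈fromℤ i)) (sym (⟦⟧ℤ≈fromℤ j))))
    ; *-homo = λ i j → hom (i ℤ.* j) (trans (fromℤ-* i j) (*-cong (sym (⟦⟧ℤ≈fromℤ i)) (sym (⟦⟧ℤ≈fromℤ j))))
    ; -‿homo = λ i → hom (ℤ.- i) (trans (fromℤ-neg i) (-‿cong (sym (⟦⟧ℤ≈fromℤ i))))
    ; 0-homo = refl
    ; 1-homo = refl
    }
    where
    hom : ∀ i {x} → fromℤ rawRing i ≈ x → ⟦ i ⟧ℤ ≈ x
    hom i = trans (⟦⟧ℤ≈fromℤ i)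

  weaklyDec : ∀ i j → Maybe (⟦ i ⟧ℤ ≈ ⟦ j ⟧ℤ)
  weaklyDec i j with i ℤ.≟ j
  ... | yes ≡.refl = just refl
  ... | no _       = nothing

  open RingSolver ℤ.+-*-rawRing almostCommutativeRing ℤ⟶R weaklyDec public
    using (solve; _:=_; _:+_; _:*_; _:-_; :-_; con; Polynomial)

module ListSum {c ℓ} (R : CommutativeRing c ℓ) where
  open CommutativeRing R
  open RingProperties ring
  open IntegerCoefficients R
  open import Relation.Binary.Reasoning.Setoid setoid

  private
    variable
      a b p : Level
      A : Set a
      B : Set b

  if-yes : {P : Set p} (d : Dec P) → P → ∀ {x y} → (if does d then x else y) ≈ x
  if-yes (yes _) _ = refl
  if-yes (no ¬p) p = contradiction p ¬p

  if-no : {P : Set p} (d : Dec P) → ¬ P → ∀ {x y} → (if does d then x else y) ≈ y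
  if-no (yes p) ¬p = contradiction p ¬p
  if-no (no _)  _  = refl

  infixr 8 [_]·_
  -- The Iverson bracket. Conditions are kept as zero values instead of being filtered out, so that
  -- sums over different lists can be exchanged before their conditions are compared.
  [_]·_ : {P : Set p} → Dec P → Carrier → Carrier
  [ d ]· x = if does d then x else 0#

  []·-yes : {P : Set p} (d : Dec P) → P → ∀ {x} → [ d ]· x ≈ x
  []·-yes d p = if-yes d p

  []·-no : {P : Set p} (d : Dec P) → ¬ P → ∀ {x} → [ d ]· x ≈ 0#
  []·-no d ¬p = if-no d ¬p

  []·-cong : ∀ {q} {P : Set p} {Q : Set q} (d : Dec P) (e : Dec Q) {x y : Carrier} →
             (P → Q) → (Q → P) → (P → x ≈ y) → [ d ]· x ≈ [ e ]· y
  []·-cong (yes p) e to from eq = trans (eq p) (sym ([]·-yes e (to p)))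
  []·-cong (no ¬p) e to from eq = sym ([]·-no e (¬p ∘ from))

  sumL : List A → (A → Carrier) → Carrier
  sumL xs f = foldr (λ x s → f x + s) 0# xs

  sumL-cong : ∀ (xs : List A) {f g} → (∀ x → f x ≈ g x) → sumL xs f ≈ sumL xs g
  sumL-cong []       eq = refl
  sumL-cong (x ∷ xs) eq = +-cong (eq x) (sumL-cong xs eq)

  sumL-0 : ∀ (xs : List A) {f} → (∀ x → f x ≈ 0#) → sumL xs f ≈ 0#
  sumL-0 []       eq = refl
  sumL-0 (x ∷ xs) eq = trans (+-cong (eq x) (sumL-0 xs eq)) (+-identityˡ 0#)

  sumL-++ : ∀ (xs ys : List A) f → sumL (xs ++ ys) f ≈ sumL xs f + sumL ys f
  sumL-++ []       ys f = sym (+-identityˡ _)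
  sumL-++ (x ∷ xs) ys f = trans (+-congˡ (sumL-++ xs ys f)) (sym (+-assoc _ _ _))

  sumL-map : ∀ (g : A → B) xs f → sumL (List.map g xs) f ≈ sumL xs (f ∘ g)
  sumL-map g []       f = refl
  sumL-map g (x ∷ xs) f = +-congˡ (sumL-map g xs f)

  sumL-product : ∀ {a′} {A′ : Set a′} (h : A → B → A′) xs ys f →
    sumL (cartesianProductWith h xs ys) f ≈ sumL xs (λ x → sumL ys (λ y → f (h x y)))
  sumL-product h []       ys f = refl
  sumL-product h (x ∷ xs) ys f = trans (sumL-++ (List.map (h x) ys) _ f)
    (+-cong (sumL-map (h x) ys f) (sumL-product h xs ys f))

  sumL-filter : ∀ {P : A → Set p} (P? : ∀ x → Dec (P x)) xs f →
    sumL (filter P? xs) f ≈ sumL xs (λ x → [ P? x ]· f x)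
  sumL-filter P? []       f = refl
  sumL-filter P? (x ∷ xs) f with does (P? x)
  ... | true  = +-congˡ (sumL-filter P? xs f)
  ... | false = trans (sumL-filter P? xs f) (sym (+-identityˡ _))

  sumL-+ : ∀ (xs : List A) f g → sumL xs (λ x → f x + g x) ≈ sumL xs f + sumL xs g
  sumL-+ []       f g = sym (+-identityˡ _)
  sumL-+ (x ∷ xs) f g = trans (+-congˡ (sumL-+ xs f g))
    (solve 4 (λ a b c d → a :+ b :+ (c :+ d) := a :+ c :+ (b :+ d)) refl _ _ _ _)

  *-sumL : ∀ y (xs : List A) f → y * sumL xs f ≈ sumL xs (λ x → y * f x)
  *-sumL y []       f = zeroʳ y
  *-sumL y (x ∷ xs) f = trans (distribˡ y _ _) (+-congˡ (*-sumL y xs f))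

  sumL-* : ∀ (xs : List A) f y → sumL xs f * y ≈ sumL xs (λ x → f x * y)
  sumL-* xs f y = trans (*-comm _ _) (trans (*-sumL y xs f) (sumL-cong xs (λ x → *-comm _ _)))

  sumL-neg : ∀ (xs : List A) f → sumL xs (λ x → - f x) ≈ - sumL xs f
  sumL-neg []       f = sym -0#≈0#
  sumL-neg (x ∷ xs) f = trans (+-congˡ (sumL-neg xs f))
    (solve 2 (λ a b → :- a :+ :- b := :- (a :+ b)) refl _ _)

  sumL-swap : ∀ (xs : List A) (ys : List B) (f : A → B → Carrier) →
    sumL xs (λ x → sumL ys (f x)) ≈ sumL ys (λ y → sumL xs (λ x → f x y))
  sumL-swap []       ys f = sym (sumL-0 ys (λ _ → refl))
  sumL-swap (x ∷ xs) ys f = trans (+-congˡ (sumL-swap xs ys f)) (sym (sumL-+ ys (f x) _))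

record Homomorphism {c₁ ℓ₁ c₂ ℓ₂} (R : CommutativeRing c₁ ℓ₁) (S : CommutativeRing c₂ ℓ₂) :
    Set (c₁ ⊔ ℓ₁ ⊔ c₂ ⊔ ℓ₂) where
  private
    module R = CommutativeRing R
    module S = CommutativeRing S
  field
    ⟦_⟧    : R.Carrier → S.Carrier
    ⟦⟧-cong : ∀ {x y} → x R.≈ y → ⟦ x ⟧ S.≈ ⟦ y ⟧
    +-homo : ∀ x y → ⟦ x R.+ y ⟧ S.≈ ⟦ x ⟧ S.+ ⟦ y ⟧
    *-homo : ∀ x y → ⟦ x R.* y ⟧ S.≈ ⟦ x ⟧ S.* ⟦ y ⟧
    0-homo : ⟦ R.0# ⟧ S.≈ S.0#
    1-homo : ⟦ R.1# ⟧ S.≈ S.1#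

-- Monomials and polynomial rings

module Monomials {V : Set} (_≟_ : DecidableEquality V) where
  open Polynomial ℤ.+-*-rawRing _≟_ public using (exponent)
  open Polynomial ℤ.+-*-rawRing _≟_ using (Monomial; _≈ₘ_; _≈ₘ?_)

  exponent-++ : ∀ v u w → exponent v (u ++ w) ≡ exponent v u ℕ.+ exponent v w
  exponent-++ v u w = ≡.trans (≡.cong length (List.filter-++ (v ≟_) u w)) (List.length-++ (filter (v ≟_) u))

  exponent-here : ∀ v w → exponent v (v ∷ w) ≡ suc (exponent v w)
  exponent-here v w with v ≟ v
  ... | yes _  = ≡.refl
  ... | no v≢v = contradiction ≡.refl v≢v

  exponent-there : ∀ {v u} w → v ≢ u → exponent v (u ∷ w) ≡ exponent v w
  exponent-there {v} {u} w v≢u with v ≟ u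
  ... | yes v≡u = contradiction v≡u v≢u
  ... | no _    = ≡.refl

  ∈-or-exponent≡0 : ∀ v w → v ∈ w ⊎ exponent v w ≡ 0
  ∈-or-exponent≡0 v []      = inj₂ ≡.refl
  ∈-or-exponent≡0 v (u ∷ w) with v ≟ u | ∈-or-exponent≡0 v w
  ... | yes v≡u | _         = inj₁ (here v≡u)
  ... | no _    | inj₁ v∈w  = inj₁ (there v∈w)
  ... | no _    | inj₂ e≡0  = inj₂ e≡0

  infix 4 _∼_
  -- A record, so that the two words can be inferred from a proof. Unlike in `_≈ₘ_`, all variables
  -- are compared and not just those that occur, which makes transitivity immediate.
  record _∼_ (w w′ : Monomial) : Set where
    constructor same-exponents
    field
      exponents : ∀ v → exponent v w ≡ exponent v w′
  open _∼_ public

  ≈ₘ⇒∼ : ∀ w w′ → w ≈ₘ w′ → w ∼ w′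
  ≈ₘ⇒∼ w w′ eq .exponents v with ∈-or-exponent≡0 v w | ∈-or-exponent≡0 v w′
  ... | inj₁ v∈w | _         = All.lookup eq (∈.∈-++⁺ˡ v∈w)
  ... | inj₂ _   | inj₁ v∈w′ = All.lookup eq (∈.∈-++⁺ʳ w v∈w′)
  ... | inj₂ e≡0 | inj₂ e′≡0 = ≡.trans e≡0 (≡.sym e′≡0)

  ∼⇒≈ₘ : ∀ w w′ → w ∼ w′ → w ≈ₘ w′
  ∼⇒≈ₘ w w′ eq = All.universal (exponents eq) _

  -- Abstract, so that case distinctions do not unfold the comparison of exponents.
  abstract
    _∼?_ : ∀ w w′ → Dec (w ∼ w′)
    w ∼? w′ = map′ (≈ₘ⇒∼ w w′) (∼⇒≈ₘ w w′) (w ≈ₘ? w′)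

  ∼-refl : ∀ {w} → w ∼ w
  ∼-refl .exponents _ = ≡.refl

  ∼-sym : ∀ {w w′} → w ∼ w′ → w′ ∼ w
  ∼-sym eq .exponents v = ≡.sym (exponents eq v)

  ∼-trans : ∀ {u v w} → u ∼ v → v ∼ w → u ∼ w
  ∼-trans eq eq′ .exponents v = ≡.trans (exponents eq v) (exponents eq′ v)

  ++-cong : ∀ {u u′ w w′} → u ∼ u′ → w ∼ w′ → u ++ w ∼ u′ ++ w′
  ++-cong {u} {u′} {w} {w′} eq eq′ .exponents v = ≡.trans (exponent-++ v u w)
    (≡.trans (≡.cong₂ ℕ._+_ (exponents eq v) (exponents eq′ v)) (≡.sym (exponent-++ v u′ w′)))

  ++-cancel : ∀ u {w w′} → u ++ w ∼ u ++ w′ → w ∼ w′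
  ++-cancel u {w} {w′} eq .exponents v = ℕ.+-cancelˡ-≡ (exponent v u) _ _
    (≡.trans (≡.sym (exponent-++ v u w)) (≡.trans (exponents eq v) (exponent-++ v u w′)))

  ++-comm : ∀ u w → u ++ w ∼ w ++ u
  ++-comm u w .exponents v = ≡.trans (exponent-++ v u w)
    (≡.trans (ℕ.+-comm (exponent v u) _) (≡.sym (exponent-++ v w u)))

  module _ {f g : V → V} (g∘f : ∀ v → g (f v) ≡ v) (f∘g : ∀ v → f (g v) ≡ v) where
    exponent-map : ∀ v w → exponent v (List.map f w) ≡ exponent (g v) w
    exponent-map v []      = ≡.refl
    exponent-map v (u ∷ w) with v ≟ f u | g v ≟ u
    ... | yes _  | yes _  = ≡.cong suc (exponent-map v w)
    ... | no  _  | no  _  = exponent-map v w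
    ... | yes ≡.refl | no ≢ = contradiction (g∘f u) ≢
    ... | no ≢ | yes ≡.refl = contradiction (≡.sym (f∘g v)) ≢

module PolynomialRing {c ℓ} (R : CommutativeRing c ℓ) {V : Set} (_≟_ : DecidableEquality V) where
  private module R = CommutativeRing R
  open Polynomial R.rawRing _≟_ public hiding (exponent; _≈ₘ_)
  open Monomials _≟_ public
  open ListSum R
  open IntegerCoefficients R using (solve; _:=_; _:+_; _:*_; _:-_; :-_; con)
  open RingProperties R.ring using (-‿distribˡ-*; -0#≈0#)
  open import Relation.Binary.Reasoning.Setoid R.setoid
  open RawRing polyRing using (_≈_; _+_; _*_; -_; 0#; 1#)

  Invariant : (Monomial → R.Carrier) → Set ℓ
  Invariant χ = ∀ {w w′} → w ∼ w′ → χ w R.≈ χ w′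

  -- The linear functional with the values `χ` on monomials. The laws of multiplication are checked
  -- on all such functionals with `χ` invariant, where by `linear-*` a product becomes a double sum
  -- and no monomials have to be compared.
  linear : (Monomial → R.Carrier) → Poly → R.Carrier
  linear χ p = sumL p (λ (a , w) → a R.* χ w)

  δ : Monomial → Monomial → R.Carrier
  δ w w′ = [ w ∼? w′ ]· R.1#

  δ-invariant : ∀ w → Invariant (δ w)
  δ-invariant w {u} {u′} eq = []·-cong (w ∼? u) (w ∼? u′) (λ e → ∼-trans e eq) (λ e → ∼-trans e (∼-sym eq))
    (λ _ → R.refl)

  coefficient-sum : ∀ p w → coefficient p w R.≈ sumL p (λ (a , w′) → [ w ∼? w′ ]· a)
  coefficient-sum p w = sumL-cong p λ (a , w′) →
    []·-cong (w ≈ₘ? w′) (w ∼? w′) (≈ₘ⇒∼ w w′) (∼⇒≈ₘ w w′) (λ _ → R.refl)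

  coefficient≈linear : ∀ p w → coefficient p w R.≈ linear (δ w) p
  coefficient≈linear p w = R.trans (coefficient-sum p w) (sumL-cong p λ (a , w′) → helper a (w ∼? w′))
    where
    helper : ∀ a {P : Set} (d : Dec P) → [ d ]· a R.≈ a R.* [ d ]· R.1#
    helper a (yes _) = R.sym (R.*-identityʳ a)
    helper a (no _)  = R.sym (R.zeroʳ a)

  coefficient-++ : ∀ p q w → coefficient (p ++ q) w R.≈ coefficient p w R.+ coefficient q w
  coefficient-++ p q w = sumL-++ p q _

  coefficient-neg : ∀ p w → coefficient (- p) w R.≈ R.- coefficient p w
  coefficient-neg p w = R.trans (sumL-map _ p _) (R.trans (sumL-cong p λ (a , w′) → helper a (w ≈ₘ? w′))
    (sumL-neg p _))
    where
    helper : ∀ a {P : Set} (d : Dec P) → [ d ]· (R.- a) R.≈ R.- [ d ]· a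
    helper a (yes _) = R.refl
    helper a (no _)  = R.sym -0#≈0#

  coefficient-invariant : ∀ p → Invariant (coefficient p)
  coefficient-invariant p {w} {w′} eq = R.trans (coefficient-sum p w) (R.trans (sumL-cong p λ (a , u) →
    []·-cong (w ∼? u) (w′ ∼? u) (∼-trans (∼-sym eq)) (∼-trans eq) (λ _ → R.refl)) (R.sym (coefficient-sum p w′)))

  -- Only the product of coefficient and value has to vanish. In `linear-cong` the coefficient is
  -- zero; for the leading coefficient of a product it is one factor or the other, and which one
  -- cannot be decided.
  linear-zero : ∀ p {χ} → Invariant χ → (∀ u → coefficient p u R.* χ u R.≈ R.0#) → linear χ p R.≈ R.0#
  linear-zero p {χ} inv = go (length p) p ℕ.≤-refl
    where
    -- The terms with the monomial of the first term are removed together: they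
    -- contribute a multiple of one coefficient of p.
    go : ∀ k p → length p ℕ.≤ k → (∀ u → coefficient p u R.* χ u R.≈ R.0#) → linear χ p R.≈ R.0#
    go k [] _ _ = R.refl
    go (suc k) p@((a , w) ∷ p′) (s≤s p′≤k) zero′ = begin
      linear χ p                                              ≈⟨ sumL-cong p split ⟩
      sumL p (λ t → same t R.+ other t)                       ≈⟨ sumL-+ p same other ⟩
      sumL p same R.+ sumL p other                            ≈⟨ R.+-cong same-zero other-zero ⟩
      R.0# R.+ R.0#                                           ≈⟨ R.+-identityˡ _ ⟩
      R.0#                                                    ∎
      where
      other? : ∀ t → Dec (¬ (w ∼ proj₂ t))
      other? t = ¬? (w ∼? proj₂ t)

      same other : R.Carrier × Monomial → R.Carrier
      same  (b , v) = [ w ∼? v ]· (b R.* χ v)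
      other t@(b , v) = [ other? t ]· (b R.* χ v)

      rest = filter other? p

      split : ∀ t → proj₁ t R.* χ (proj₂ t) R.≈ same t R.+ other t
      split (b , v) with w ∼? v
      ... | yes _ = R.sym (R.+-identityʳ _)
      ... | no _  = R.sym (R.+-identityˡ _)

      same-zero : sumL p same R.≈ R.0#
      same-zero = begin
        sumL p same                                     ≈⟨ sumL-cong p (λ (b , v) → helper b v) ⟩
        sumL p (λ (b , v) → [ w ∼? v ]· b R.* χ w)     ≈⟨ R.trans (R.*-congʳ (coefficient-sum p w))
          (sumL-* p _ (χ w)) ⟨
        coefficient p w R.* χ w                         ≈⟨ zero′ w ⟩
        R.0#                                            ∎
        where
        helper : ∀ b v → [ w ∼? v ]· (b R.* χ v) R.≈ ([ w ∼? v ]· b) R.* χ w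
        helper b v with w ∼? v
        ... | yes eq = R.*-congˡ (inv (∼-sym eq))
        ... | no _   = R.sym (R.zeroˡ _)

      coefficient-rest : ∀ u → coefficient rest u R.≈ [ ¬? (w ∼? u) ]· coefficient p u
      coefficient-rest u = R.trans (coefficient-sum rest u) (R.trans (sumL-filter other? p _)
        (helper (w ∼? u)))
        where
        helper : (d : Dec (w ∼ u)) →
          sumL p (λ t → [ other? t ]· ([ u ∼? proj₂ t ]· proj₁ t)) R.≈ [ ¬? d ]· coefficient p u
        helper (yes eq) = sumL-0 p λ (b , v) → each b v
          where
          each : ∀ b v → [ other? (b , v) ]· ([ u ∼? v ]· b) R.≈ R.0#
          each b v with w ∼? v
          ... | yes _ = R.refl
          ... | no ≉  = []·-no (u ∼? v) (λ e → ≉ (∼-trans eq e))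
        helper (no ≉) = R.trans (sumL-cong p λ (b , v) → each b v) (R.sym (coefficient-sum p u))
          where
          each : ∀ b v → [ other? (b , v) ]· ([ u ∼? v ]· b) R.≈ [ u ∼? v ]· b
          each b v with w ∼? v
          ... | yes e = R.sym ([]·-no (u ∼? v) (λ e′ → ≉ (∼-trans e (∼-sym e′))))
          ... | no _  = R.refl

      rest≤k : length rest ℕ.≤ k
      rest≤k with w ∼? w
      ... | yes _ = ℕ.≤-trans (List.length-filter other? p′) p′≤k
      ... | no ≉  = contradiction ∼-refl ≉

      rest-zero : ∀ u → coefficient rest u R.* χ u R.≈ R.0#
      rest-zero u = R.trans (R.*-congʳ (coefficient-rest u)) (helper (w ∼? u))
        where
        helper : (d : Dec (w ∼ u)) → ([ ¬? d ]· coefficient p u) R.* χ u R.≈ R.0#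
        helper (yes _) = R.zeroˡ _
        helper (no _)  = zero′ u

      other-zero : sumL p other R.≈ R.0#
      other-zero = R.trans (R.sym (sumL-filter other? p _)) (go k rest rest≤k rest-zero)

  linear-cong : ∀ {χ} → Invariant χ → ∀ p q → p ≈ q → linear χ p R.≈ linear χ q
  linear-cong {χ} inv p q p≈q = begin
    linear χ p                                    ≈⟨ solve 2 (λ x y → x := x :- y :+ y) R.refl _ _ ⟩
    linear χ p R.- linear χ q R.+ linear χ q      ≈⟨ R.+-congʳ difference ⟩
    R.0# R.+ linear χ q                           ≈⟨ R.+-identityˡ _ ⟩
    linear χ q                                    ∎
    where
    linear-neg : linear χ (- q) R.≈ R.- linear χ q
    linear-neg = R.trans (sumL-map _ q _)
      (R.trans (sumL-cong q (λ _ → R.sym (-‿distribˡ-* _ _))) (sumL-neg q _))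

    coefficients : ∀ u → coefficient (p ++ - q) u R.* χ u R.≈ R.0#
    coefficients u = begin
      coefficient (p ++ - q) u R.* χ u                           ≈⟨ R.*-congʳ (coefficient-++ p (- q) u) ⟩
      (coefficient p u R.+ coefficient (- q) u) R.* χ u          ≈⟨ R.*-congʳ (R.+-cong (p≈q u)
        (coefficient-neg q u)) ⟩
      (coefficient q u R.- coefficient q u) R.* χ u              ≈⟨ solve 2 (λ x y → (x :- x) :* y := con
        (+ 0)) R.refl _ _ ⟩
      R.0#                                                       ∎

    difference : linear χ p R.- linear χ q R.≈ R.0#
    difference = begin
      linear χ p R.- linear χ q         ≈⟨ R.+-congˡ linear-neg ⟨
      linear χ p R.+ linear χ (- q)     ≈⟨ sumL-++ p (- q) _ ⟨
      linear χ (p ++ - q)               ≈⟨ linear-zero (p ++ - q) inv coefficients ⟩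
      R.0#                              ∎

  -- Each coefficient is itself a functional of this kind, the one given by `δ w`.
  linear-extensional : ∀ {p q} → (∀ {χ} → Invariant χ → linear χ p R.≈ linear χ q) → p ≈ q
  linear-extensional {p} {q} eq w = begin
    coefficient p w  ≈⟨ coefficient≈linear p w ⟩
    linear (δ w) p   ≈⟨ eq (δ-invariant w) ⟩
    linear (δ w) q   ≈⟨ coefficient≈linear q w ⟨
    coefficient q w  ∎

  linear-* : ∀ χ p q → linear χ (p * q) R.≈ linear (λ u → linear (λ v → χ (u ++ v)) q) p
  linear-* χ p q = R.trans (sumL-product _ p q _) (sumL-cong p λ (a , u) →
    R.trans (sumL-cong q (λ (b , v) → R.*-assoc a b _)) (R.sym (*-sumL a q _)))

  linear-cong-χ : ∀ p {χ χ′} → (∀ w → χ w R.≈ χ′ w) → linear χ p R.≈ linear χ′ p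
  linear-cong-χ p eq = sumL-cong p λ (a , w) → R.*-congˡ (eq w)

  private
    shift-invariant : ∀ {χ} → Invariant χ → ∀ q → Invariant (λ u → linear (λ v → χ (u ++ v)) q)
    shift-invariant inv q eq = linear-cong-χ q λ v → inv (++-cong eq ∼-refl)

    *-cong : ∀ {p p′ q q′} → p ≈ p′ → q ≈ q′ → (p * q) ≈ (p′ * q′)
    *-cong {p} {p′} {q} {q′} p≈ q≈ = linear-extensional {p * q} {p′ * q′} λ {χ} inv → begin
      linear χ (p * q)                                    ≈⟨ linear-* χ p q ⟩
      linear (λ u → linear (λ v → χ (u ++ v)) q) p        ≈⟨ linear-cong-χ p (λ u → linear-cong
        (λ e → inv (++-cong (∼-refl {u}) e)) q q′ q≈) ⟩
      linear (λ u → linear (λ v → χ (u ++ v)) q′) p       ≈⟨ linear-cong (shift-invariant inv q′) p p′ p≈ ⟩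
      linear (λ u → linear (λ v → χ (u ++ v)) q′) p′      ≈⟨ linear-* χ p′ q′ ⟨
      linear χ (p′ * q′)                                  ∎

    *-assoc : ∀ p q r → ((p * q) * r) ≈ (p * (q * r))
    *-assoc p q r = linear-extensional {(p * q) * r} {p * (q * r)} λ {χ} inv → begin
      linear χ ((p * q) * r)
        ≈⟨ linear-* χ (p * q) r ⟩
      linear (λ u → linear (λ v → χ (u ++ v)) r) (p * q)
        ≈⟨ linear-* _ p q ⟩
      linear (λ s → linear (λ t → linear (λ v → χ ((s ++ t) ++ v)) r) q) p
        ≈⟨ linear-cong-χ p (λ s → linear-cong-χ q λ t → linear-cong-χ r λ v → R.reflexive
          (≡.cong χ (List.++-assoc s t v))) ⟩
      linear (λ s → linear (λ t → linear (λ v → χ (s ++ (t ++ v))) r) q) p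
        ≈⟨ linear-cong-χ p (λ s → linear-* (λ x → χ (s ++ x)) q r) ⟨
      linear (λ s → linear (λ x → χ (s ++ x)) (q * r)) p
        ≈⟨ linear-* χ p (q * r) ⟨
      linear χ (p * (q * r)) ∎

    *-comm : ∀ p q → (p * q) ≈ (q * p)
    *-comm p q = linear-extensional {p * q} {q * p} λ {χ} inv → begin
      linear χ (p * q)
        ≈⟨ sumL-product _ p q _ ⟩
      sumL p (λ (a , u) → sumL q (λ (b , v) → a R.* b R.* χ (u ++ v)))
        ≈⟨ sumL-swap p q _ ⟩
      sumL q (λ (b , v) → sumL p (λ (a , u) → a R.* b R.* χ (u ++ v)))
        ≈⟨ sumL-cong q (λ (b , v) → sumL-cong p (λ (a , u) → R.*-cong (R.*-comm a b) (inv (++-comm u v)))) ⟩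
      sumL q (λ (b , v) → sumL p (λ (a , u) → b R.* a R.* χ (v ++ u)))
        ≈⟨ sumL-product _ q p _ ⟨
      linear χ (q * p) ∎

    *-identityˡ : ∀ p → (1# * p) ≈ p
    *-identityˡ p = linear-extensional {1# * p} {p} λ {χ} inv → begin
      linear χ (1# * p)                                ≈⟨ linear-* χ 1# p ⟩
      R.1# R.* linear χ p R.+ R.0#                     ≈⟨ solve 1 (λ x → con (+ 1) :* x :+ con (+ 0) := x)
        R.refl _ ⟩
      linear χ p                                       ∎

    distribʳ : ∀ p q r → ((q + r) * p) ≈ (q * p + r * p)
    distribʳ p q r = linear-extensional {(q + r) * p} {q * p + r * p} λ {χ} inv → begin
      linear χ ((q + r) * p)                ≈⟨ linear-* χ (q + r) p ⟩
      linear _ (q + r)                      ≈⟨ sumL-++ q r _ ⟩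
      linear _ q R.+ linear _ r             ≈⟨ R.+-cong (linear-* χ q p) (linear-* χ r p) ⟨
      linear χ (q * p) R.+ linear χ (r * p) ≈⟨ sumL-++ (q * p) (r * p) _ ⟨
      linear χ (q * p + r * p)              ∎

    ≈-trans : ∀ {p q r} → p ≈ q → q ≈ r → p ≈ r
    ≈-trans e e′ w = R.trans (e w) (e′ w)

  polynomialRing : CommutativeRing c ℓ
  polynomialRing = record
    { Carrier = Poly ; _≈_ = _≈_ ; _+_ = _+_ ; _*_ = _*_ ; -_ = -_ ; 0# = 0# ; 1# = 1#
    ; isCommutativeRing = record
      { isRing = record
        { +-isAbelianGroup = record
          { isGroup = record
            { isMonoid = record
              { isSemigroup = record
                { isMagma = record
                  { isEquivalence = record
                    { refl = λ w → R.refl ; sym = λ e w → R.sym (e w)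
                    ; trans = λ {p} {q} {r} → ≈-trans {p} {q} {r} }
                  ; ∙-cong = λ {p} {p′} {q} {q′} e e′ w → R.trans (coefficient-++ p q w)
                      (R.trans (R.+-cong (e w) (e′ w)) (R.sym (coefficient-++ p′ q′ w)))
                  }
                ; assoc = λ p q r w → R.reflexive (≡.cong (λ s → coefficient s w) (List.++-assoc p q r))
                }
              ; identity = (λ p w → R.refl) , (λ p w → R.reflexive (≡.cong (λ s → coefficient s w)
                (List.++-identityʳ p)))
              }
            ; inverse = (λ p → inverseˡ p) , (λ p w → R.trans (coefficient-++ p (- p) w)
                (R.trans (R.+-congˡ (coefficient-neg p w)) (R.-‿inverseʳ _)))
            ; ⁻¹-cong = λ {p} {q} e w → R.trans (coefficient-neg p w)
                (R.trans (R.-‿cong (e w)) (R.sym (coefficient-neg q w)))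
            }
          ; comm = λ p q w → R.trans (coefficient-++ p q w)
              (R.trans (R.+-comm _ _) (R.sym (coefficient-++ q p w)))
          }
        ; *-cong = λ {p} {p′} {q} {q′} → *-cong {p} {p′} {q} {q′}
        ; *-assoc = *-assoc
        ; *-identity = *-identityˡ , λ p → ≈-trans {p * 1#} {1# * p} {p} (*-comm p 1#) (*-identityˡ p)
        ; distrib = (λ p q r → ≈-trans {p * (q + r)} {(q + r) * p} {p * q + p * r} (*-comm p (q + r))
              (≈-trans {(q + r) * p} {q * p + r * p} {p * q + p * r} (distribʳ p q r)
                (λ w → R.trans (coefficient-++ (q * p) (r * p) w)
                  (R.trans (R.+-cong (*-comm q p w) (*-comm r p w)) (R.sym (coefficient-++ (p * q) (p * r) w))))))
            , distribʳ
        }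
      ; *-comm = *-comm
      }
    }
    where
    inverseˡ : ∀ p → (- p + p) ≈ 0#
    inverseˡ p w = R.trans (coefficient-++ (- p) p w)
      (R.trans (R.+-congʳ (coefficient-neg p w)) (R.-‿inverseˡ _))

  constant-hom : Homomorphism R polynomialRing
  constant-hom = record
    { ⟦_⟧ = constant
    ; ⟦⟧-cong = λ eq w → R.+-congʳ ([]·-cong (w ≈ₘ? []) (w ≈ₘ? []) id id (λ _ → eq))
    ; +-homo = λ a b w → +-helper a b (w ≈ₘ? [])
    ; *-homo = λ a b w → R.refl
    ; 0-homo = λ w → 0-helper (w ≈ₘ? [])
    ; 1-homo = λ w → R.refl
    }
    where
    +-helper : ∀ a b {P : Set} (d : Dec P) →
      [ d ]· (a R.+ b) R.+ R.0# R.≈ [ d ]· a R.+ ([ d ]· b R.+ R.0#)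
    +-helper a b (yes _) = R.+-assoc _ _ _
    +-helper a b (no _)  = R.sym (R.+-identityˡ _)

    0-helper : ∀ {P : Set} (d : Dec P) → [ d ]· R.0# R.+ R.0# R.≈ R.0#
    0-helper (yes _) = R.+-identityˡ _
    0-helper (no _)  = R.+-identityˡ _

  coefficient-constant-* : ∀ a p w → coefficient (constant a * p) w R.≈ a R.* coefficient p w
  coefficient-constant-* a p w = begin
    coefficient (constant a * p) w              ≈⟨ coefficient≈linear (constant a * p) w ⟩
    linear (δ w) (constant a * p)               ≈⟨ linear-* (δ w) (constant a) p ⟩
    a R.* linear (δ w) p R.+ R.0#               ≈⟨ R.+-identityʳ _ ⟩
    a R.* linear (δ w) p                        ≈⟨ R.*-congˡ (coefficient≈linear p w) ⟨
    a R.* coefficient p w                       ∎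

  module _ {f g : V → V} (g∘f : ∀ v → g (f v) ≡ v) (f∘g : ∀ v → f (g v) ≡ v) where
    map-∼ : ∀ {u w} → u ∼ List.map g w → List.map f u ∼ w
    map-∼ {u} {w} eq = same-exponents λ v → ≡.trans (exponent-map g∘f f∘g v u)
      (≡.trans (exponents eq (g v)) (≡.trans (exponent-map f∘g g∘f (g v) w) (≡.cong (λ v → exponent v w) (f∘g v))))

    map-∼⁻ : ∀ {u w} → List.map f u ∼ w → u ∼ List.map g w
    map-∼⁻ {u} {w} eq = same-exponents λ v → ≡.trans (≡.cong (λ v → exponent v u) (≡.sym (g∘f v)))
      (≡.trans (≡.sym (exponent-map g∘f f∘g (f v) u)) (≡.trans (exponents eq (f v))
        (≡.sym (exponent-map f∘g g∘f v w))))

    coefficient-rename : ∀ p w → coefficient (rename f p) w R.≈ coefficient p (List.map g w)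
    coefficient-rename p w = R.trans (coefficient-sum (rename f p) w) (R.trans (sumL-map _ p _)
      (R.trans (sumL-cong p λ (a , u) → []·-cong (w ∼? List.map f u) (List.map g w ∼? u)
        (∼-sym ∘ map-∼⁻ ∘ ∼-sym) (∼-sym ∘ map-∼ ∘ ∼-sym) (λ _ → R.refl))
      (R.sym (coefficient-sum p (List.map g w)))))

    rename-hom : Homomorphism polynomialRing polynomialRing
    rename-hom = record
      { ⟦_⟧ = rename f
      ; ⟦⟧-cong = λ {p} {q} eq w → R.trans (coefficient-rename p w)
          (R.trans (eq (List.map g w)) (R.sym (coefficient-rename q w)))
      ; +-homo = λ p q w → R.reflexive (≡.cong (λ s → coefficient s w) (List.map-++ _ p q))
      ; *-homo = λ p q → linear-extensional {rename f (p * q)} {rename f p * rename f q} λ {χ} inv → begin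
          linear χ (rename f (p * q))
            ≈⟨ sumL-map _ (p * q) _ ⟩
          linear (χ ∘ List.map f) (p * q)
            ≈⟨ linear-* _ p q ⟩
          linear (λ u → linear (λ v → χ (List.map f (u ++ v))) q) p
            ≈⟨ linear-cong-χ p (λ u → R.trans
                 (linear-cong-χ q (λ v → R.reflexive (≡.cong χ (List.map-++ f u v)))) (R.sym (sumL-map _ q _))) ⟩
          linear (λ u → linear (λ v → χ (List.map f u ++ v)) (rename f q)) p
            ≈⟨ sumL-map _ p _ ⟨
          linear (λ u → linear (λ v → χ (u ++ v)) (rename f q)) (rename f p)
            ≈⟨ linear-* χ (rename f p) (rename f q) ⟨
          linear χ (rename f p * rename f q) ∎
      ; 0-homo = λ w → R.refl
      ; 1-homo = λ w → R.refl
      }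

module MapCoefficients {c₁ ℓ₁ c₂ ℓ₂} {R : CommutativeRing c₁ ℓ₁} {S : CommutativeRing c₂ ℓ₂}
    (h : Homomorphism R S) {V : Set} (_≟_ : DecidableEquality V) where
  open Homomorphism h
  private
    module R = CommutativeRing R
    module S = CommutativeRing S
    module R[V] = PolynomialRing R _≟_
    module S[V] = PolynomialRing S _≟_
    module RP = CommutativeRing R[V].polynomialRing
    module SP = CommutativeRing S[V].polynomialRing
  open ListSum S

  mapCoefficients : R[V].Poly → S[V].Poly
  mapCoefficients = List.map λ (a , w) → ⟦ a ⟧ , w

  coefficient-map : ∀ p w → S[V].coefficient (mapCoefficients p) w S.≈ ⟦ R[V].coefficient p w ⟧
  coefficient-map []            w = S.sym 0-homo
  coefficient-map ((a , u) ∷ p) w =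
    S.trans (S.+-cong (helper (w R[V].≈ₘ? u)) (coefficient-map p w)) (S.sym (+-homo _ _))
    where
    helper : ∀ {P : Set} (d : Dec P) → [ d ]· ⟦ a ⟧ S.≈ ⟦ ListSum.[_]·_ R d a ⟧
    helper (yes _) = S.refl
    helper (no _)  = S.sym 0-homo

  map-hom : Homomorphism R[V].polynomialRing S[V].polynomialRing
  map-hom = record
    { ⟦_⟧ = mapCoefficients
    ; ⟦⟧-cong = λ {p} {q} eq w → S.trans (coefficient-map p w)
        (S.trans (⟦⟧-cong (eq w)) (S.sym (coefficient-map q w)))
    ; +-homo = λ p q w → S.reflexive (≡.cong (λ s → S[V].coefficient s w) (List.map-++ _ p q))
    ; *-homo = λ p q → S[V].linear-extensional {mapCoefficients (p RP.* q)} {mapCoefficients p SP.*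
      mapCoefficients q}
        λ {χ} inv → S.trans (sumL-map _ (p RP.* q) _) (S.trans (sumL-product _ p q _)
          (S.trans (sumL-cong p λ (a , u) → S.trans (sumL-cong q λ (b , v) → S.*-congʳ (*-homo a b))
            (S.sym (sumL-map _ q _)))
          (S.trans (S.sym (sumL-map _ p _)) (S.sym (sumL-product _ (mapCoefficients p) (mapCoefficients q) _)))))
    ; 0-homo = λ w → S.refl
    ; 1-homo = λ w → S.+-congʳ ([]·-cong (w S[V].≈ₘ? []) (w R[V].≈ₘ? []) id id (λ _ → 1-homo))
    }

-- Polynomials over a field: no zero divisors, and fractions

module HeytingFieldPolynomials {c ℓ₁ ℓ₂} (F : HeytingField c ℓ₁ ℓ₂) {V : Set} (_≟_ : DecidableEquality V) where
  private module F = HeytingField F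

  fieldRing : CommutativeRing c ℓ₁
  fieldRing = HeytingCommutativeRing.commutativeRing F.heytingCommutativeRing

  private module R = CommutativeRing fieldRing
  open PolynomialRing fieldRing _≟_
  open ListSum fieldRing
  open IntegerCoefficients fieldRing using (solve; _:=_; _:+_; _:*_; _:-_; :-_; con)
  private
    module D = CommutativeRing polynomialRing
    module DS = IntegerCoefficients polynomialRing
  open import Relation.Binary.Reasoning.Setoid R.setoid

  -- By tightness, equality is the negation of apartness, and negations are stable. Arguments by
  -- contradiction can therefore end in an equality of field elements.
  stable : ∀ {x y} → ¬ ¬ (x R.≈ y) → x R.≈ y
  stable {x} {y} ¬¬eq = proj₁ (F.tight x y) λ x#y → ¬¬eq λ x≈y → proj₂ (F.tight x y) x≈y x#y

  1≉0 : ¬ (R.1# R.≈ R.0#)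
  1≉0 1≈0 = proj₂ (F.tight R.1# R.0#) 1≈0 (F.invertible⇒# (R.1# , inverse , R.trans (R.*-comm _ _) inverse))
    where
    inverse : R.1# R.* (R.1# R.- R.0#) R.≈ R.1#
    inverse = solve 0 (con (+ 1) :* (con (+ 1) :- con (+ 0)) := con (+ 1)) R.refl

  -- From `x` being unequal to zero one gets only that it is not not apart from zero. That is enough
  -- for an inverse here, because the conclusion is stable.
  field-no-zero-divisors : ∀ {x y} → x R.* y R.≈ R.0# → ¬ (x R.≈ R.0#) → y R.≈ R.0#
  field-no-zero-divisors {x} {y} xy≈0 x≉0 = stable λ y≉0 → x≉0 (proj₁ (F.tight x R.0#) λ x#0 →
    let (z , zx≈1 , _) = F.#⇒invertible x#0 in y≉0 (begin
      y                              ≈⟨ R.*-identityˡ y ⟨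
      R.1# R.* y                     ≈⟨ R.*-congʳ zx≈1 ⟨
      z R.* (x R.- R.0#) R.* y       ≈⟨ solve 3 (λ x y z → z :* (x :- con (+ 0)) :* y := z :* (x :* y))
        R.refl x y z ⟩
      z R.* (x R.* y)                ≈⟨ R.*-congˡ xy≈0 ⟩
      z R.* R.0#                     ≈⟨ R.zeroʳ z ⟩
      R.0#                           ∎))

  monomials : Poly → List Monomial
  monomials = List.map proj₂

  -- Decides only whether `w` agrees with a listed monomial. Whether a listed coefficient vanishes
  -- cannot be decided.
  support : ∀ p w → (∃[ u ] u ∈ monomials p × u ∼ w) ⊎ coefficient p w R.≈ R.0#
  support p w with go p
    where
    go : ∀ p → (∃[ u ] u ∈ monomials p × u ∼ w) ⊎ sumL p (λ (a , w′) → [ w ∼? w′ ]· a) R.≈ R.0#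
    go []            = inj₂ R.refl
    go ((a , u) ∷ p) with w ∼? u | go p
    ... | yes w∼u | _                    = inj₁ (u , here ≡.refl , ∼-sym w∼u)
    ... | no _    | inj₁ (u′ , u′∈ , eq) = inj₁ (u′ , there u′∈ , eq)
    ... | no _    | inj₂ ≈0              = inj₂ (R.trans (R.+-identityˡ _) ≈0)
  ... | inj₁ u  = inj₁ u
  ... | inj₂ ≈0 = inj₂ (R.trans (coefficient-sum p w) ≈0)

  -- Lexicographic order with respect to a finite list of variables, as there may be infinitely
  -- many. It will be the list of the variables of one factor `p`: monomials of the other factor can
  -- tie without being equal, but once the leading monomial of `p` is determined, cancelling it
  -- determines the other one.
  Lex : List V → Monomial → Monomial → Set
  Lex []       u w = ⊤
  Lex (v ∷ vs) u w = exponent v u ℕ.< exponent v w ⊎ (exponent v u ≡ exponent v w × Lex vs u w)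

  Lex-total : ∀ vs u w → Lex vs u w ⊎ Lex vs w u
  Lex-total []       u w = inj₁ tt
  Lex-total (v ∷ vs) u w with ℕ.<-cmp (exponent v u) (exponent v w) | Lex-total vs u w
  ... | tri< u<w _ _ | _       = inj₁ (inj₁ u<w)
  ... | tri> _ _ w<u | _       = inj₂ (inj₁ w<u)
  ... | tri≈ _ eq _  | inj₁ le = inj₁ (inj₂ (eq , le))
  ... | tri≈ _ eq _  | inj₂ le = inj₂ (inj₂ (≡.sym eq , le))

  Lex-refl : ∀ vs u → Lex vs u u
  Lex-refl []       u = tt
  Lex-refl (v ∷ vs) u = inj₂ (≡.refl , Lex-refl vs u)

  Lex-trans : ∀ vs {u v w} → Lex vs u v → Lex vs v w → Lex vs u w
  Lex-trans []       _ _ = tt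
  Lex-trans (x ∷ vs) (inj₁ u<v) (inj₁ v<w) = inj₁ (ℕ.<-trans u<v v<w)
  Lex-trans (x ∷ vs) (inj₁ u<v) (inj₂ (v≡w , _)) = inj₁ (≡.subst (_ ℕ.<_) v≡w u<v)
  Lex-trans (x ∷ vs) (inj₂ (u≡v , _)) (inj₁ v<w) = inj₁ (≡.subst (ℕ._< _) (≡.sym u≡v) v<w)
  Lex-trans (x ∷ vs) (inj₂ (u≡v , u≤v)) (inj₂ (v≡w , v≤w)) = inj₂ (≡.trans u≡v v≡w , Lex-trans vs u≤v v≤w)

  -- A product of monomials that are at most u₀ and v₀ equals u₀ v₀ only if it
  -- is the product of u₀ and v₀.
  Lex-extremal : ∀ vs {u u₀ v v₀} → Lex vs u u₀ → Lex vs v v₀ → u ++ v ∼ u₀ ++ v₀ →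
                 ∀ x → x ∈ vs → exponent x u ≡ exponent x u₀
  Lex-extremal (x ∷ vs) {u} {u₀} {v} {v₀} u≤ v≤ eq = go u≤ v≤
    where
    sums : exponent x u ℕ.+ exponent x v ≡ exponent x u₀ ℕ.+ exponent x v₀
    sums = ≡.trans (≡.sym (exponent-++ x u v)) (≡.trans (exponents eq x) (exponent-++ x u₀ v₀))

    go : Lex (x ∷ vs) u u₀ → Lex (x ∷ vs) v v₀ → ∀ y → y ∈ x ∷ vs → exponent y u ≡ exponent y u₀
    go (inj₁ u<) (inj₁ v<) = contradiction sums (ℕ.<⇒≢ (ℕ.+-mono-< u< v<))
    go (inj₁ u<) (inj₂ (v≡ , _)) = contradiction sums (ℕ.<⇒≢ (ℕ.+-mono-<-≤ u< (ℕ.≤-reflexive v≡)))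
    go (inj₂ (u≡ , _)) (inj₁ v<) = contradiction sums (ℕ.<⇒≢ (ℕ.+-mono-≤-< (ℕ.≤-reflexive u≡) v<))
    go (inj₂ (u≡ , u≤)) (inj₂ (_ , v≤)) y (here ≡.refl) = u≡
    go (inj₂ (u≡ , u≤)) (inj₂ (_ , v≤)) y (there y∈)    = Lex-extremal vs u≤ v≤ eq y y∈

  Leading : List V → (Monomial → Set ℓ₁) → List Monomial → Set ℓ₁
  Leading vs Q ws = ∃[ u ] u ∈ ws × Q u × (∀ w → w ∈ ws → Q w → Lex vs w u)

  leading : ∀ vs {Q : Monomial → Set ℓ₁} ws → ¬ ¬ ((∀ w → w ∈ ws → ¬ Q w) ⊎ Leading vs Q ws)
  leading vs []           k = k (inj₁ λ _ ())
  leading vs {Q} (w ∷ ws) k = leading vs {Q} ws λ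
    { (inj₁ none) → k (inj₁ λ
        { _ (here ≡.refl) Qw → k (inj₂ (w , here ≡.refl , Qw , λ
            { _ (here ≡.refl) _ → Lex-refl vs w
            ; x (there x∈) Qx → contradiction Qx (none x x∈) }))
        ; x (there x∈) → none x x∈ })
    ; (inj₂ (u , u∈ , Qu , max)) → k (inj₂ (u , there u∈ , Qu , λ
        { _ (here ≡.refl) Qw → case-≤ u∈ Qu max Qw (Lex-total vs w u)
        ; x (there x∈) Qx → max x x∈ Qx })) }
    where
    case-≤ : ∀ {u} → u ∈ ws → Q u → (∀ w → w ∈ ws → Q w → Lex vs w u) → Q w →
             Lex vs w u ⊎ Lex vs u w → Lex vs w u
    case-≤ _  _  _   _  (inj₁ w≤u) = w≤u
    -- If `w` is above the maximum of the tail, then `w` is the maximum of the whole list, which `k`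
    -- refutes.
    case-≤ {u} u∈ Qu max Qw (inj₂ u≤w) = contradiction
      (inj₂ (w , here ≡.refl , Qw , λ
        { _ (here ≡.refl) _ → Lex-refl vs w
        ; x (there x∈) Qx → Lex-trans vs (max x x∈ Qx) u≤w })) k

  NonVanishing : Poly → Monomial → Set ℓ₁
  NonVanishing p w = ¬ (coefficient p w R.≈ R.0#)

  vanishing : ∀ p → (∀ w → w ∈ monomials p → ¬ NonVanishing p w) → p D.≈ D.0#
  vanishing p none w with support p w
  ... | inj₂ ≈0             = ≈0
  ... | inj₁ (u , u∈ , u∼w) = R.trans (coefficient-invariant p (∼-sym u∼w)) (stable (none u u∈))

  module _ (p q : Poly) (vs : List V)
           (p⊆vs : ∀ {u x} → u ∈ monomials p → x ∈ u → x ∈ vs)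
           (P : Leading vs (NonVanishing p) (monomials p))
           (Q : Leading vs (NonVanishing q) (monomials q)) where
    private
      u₀ = proj₁ P
      v₀ = proj₁ Q

      -- `X u` is the coefficient of `u₀ ++ v₀` in the product of the monomial `u` with `q`. If `u₀`
      -- and `v₀` are leading, only `u₀` should contribute, with the leading coefficient of `q`; `χ`
      -- is the deviation from this, and `p` annihilates it.
      X χ : Monomial → R.Carrier
      X u = linear (λ v → δ (u₀ ++ v₀) (u ++ v)) q
      χ u = X u R.- δ u₀ u R.* coefficient q v₀

      X-invariant : Invariant X
      X-invariant {w} {w′} eq = linear-cong-χ q λ v → δ-invariant (u₀ ++ v₀) (++-cong eq ∼-refl)

      χ-invariant : Invariant χ
      χ-invariant eq = R.+-cong (X-invariant eq) (R.-‿cong (R.*-congʳ (δ-invariant u₀ eq)))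

      χ-same : ∀ {u} → u₀ ∼ u → χ u R.≈ R.0#
      χ-same {u} u₀∼u = begin
        X u R.- δ u₀ u R.* coefficient q v₀
          ≈⟨ R.+-cong (linear-cong-χ q same) (R.-‿cong (R.*-congʳ ([]·-yes (u₀ ∼? u) u₀∼u))) ⟩
        linear (δ v₀) q R.- R.1# R.* coefficient q v₀
          ≈⟨ R.+-congʳ (R.sym (coefficient≈linear q v₀)) ⟩
        coefficient q v₀ R.- R.1# R.* coefficient q v₀
          ≈⟨ solve 1 (λ x → x :- con (+ 1) :* x := con (+ 0)) R.refl _ ⟩
        R.0# ∎
        where
        same : ∀ v → δ (u₀ ++ v₀) (u ++ v) R.≈ δ v₀ v
        same v = []·-cong ((u₀ ++ v₀) ∼? (u ++ v)) (v₀ ∼? v)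
          (λ eq → ++-cancel u₀ (∼-trans eq (++-cong (∼-sym u₀∼u) ∼-refl))) (++-cong u₀∼u) (λ _ → R.refl)

      χ-other : ∀ {u} → ¬ (u₀ ∼ u) → NonVanishing p u → χ u R.≈ R.0#
      χ-other {u} u₀≁u p[u]≉0 = begin
        X u R.- δ u₀ u R.* coefficient q v₀
          ≈⟨ R.+-cong (linear-zero q (λ eq → δ-invariant (u₀ ++ v₀) (++-cong ∼-refl eq)) zero′)
            (R.-‿cong (R.*-congʳ ([]·-no (u₀ ∼? u) u₀≁u))) ⟩
        R.0# R.- R.0# R.* coefficient q v₀
          ≈⟨ solve 1 (λ x → con (+ 0) :- con (+ 0) :* x := con (+ 0)) R.refl _ ⟩
        R.0# ∎
        where
        zero′ : ∀ v → coefficient q v R.* δ (u₀ ++ v₀) (u ++ v) R.≈ R.0#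
        zero′ v with (u₀ ++ v₀) ∼? (u ++ v)
        ... | no _   = R.zeroʳ _
        ... | yes eq = R.trans (R.*-congʳ q[v]≈0) (R.zeroˡ _)
          where
          q[v]≈0 : coefficient q v R.≈ R.0#
          q[v]≈0 = stable λ q[v]≉0 → absurd q[v]≉0 (support p u) (support q v)
            where
            absurd : NonVanishing q v → (∃[ u′ ] u′ ∈ monomials p × u′ ∼ u) ⊎ coefficient p u R.≈ R.0# →
                     (∃[ v′ ] v′ ∈ monomials q × v′ ∼ v) ⊎ coefficient q v R.≈ R.0# → ⊥
            absurd _ (inj₂ ≈0) _ = p[u]≉0 ≈0
            absurd ≉0 (inj₁ _) (inj₂ ≈0) = ≉0 ≈0
            absurd ≉0 (inj₁ (u′ , u′∈ , u′∼u)) (inj₁ (v′ , v′∈ , v′∼v)) =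
              u₀≁u (∼-trans (∼-sym u′∼u₀) u′∼u)
              where
              u′≤u₀ = proj₂ (proj₂ (proj₂ P)) u′ u′∈ λ ≈0 → p[u]≉0 (R.trans (coefficient-invariant p
                (∼-sym u′∼u)) ≈0)
              v′≤v₀ = proj₂ (proj₂ (proj₂ Q)) v′ v′∈ λ ≈0 → ≉0 (R.trans (coefficient-invariant q (∼-sym v′∼v)) ≈0)
              on-vs = Lex-extremal vs u′≤u₀ v′≤v₀ (∼-trans (++-cong u′∼u v′∼v) (∼-sym eq))

              -- `Lex-extremal` compares exponents in `vs` only. For any other variable both are 0,
              -- because `vs` contains every variable of every monomial of `p`.
              u′∼u₀ : u′ ∼ u₀
              u′∼u₀ .exponents x with ∈-or-exponent≡0 x u′ | ∈-or-exponent≡0 x u₀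
              ... | inj₁ x∈ | _       = on-vs x (p⊆vs u′∈ x∈)
              ... | inj₂ _  | inj₁ x∈ = on-vs x (p⊆vs (proj₁ (proj₂ P)) x∈)
              ... | inj₂ e  | inj₂ e′ = ≡.trans e (≡.sym e′)

      χ-zero : ∀ u → coefficient p u R.* χ u R.≈ R.0#
      χ-zero u = stable λ ≉0 → ≉0 (R.trans (R.*-congˡ (χ≈0 ≉0 (u₀ ∼? u))) (R.zeroʳ _))
        where
        χ≈0 : ¬ (coefficient p u R.* χ u R.≈ R.0#) → Dec (u₀ ∼ u) → χ u R.≈ R.0#
        χ≈0 ≉0 (yes u₀∼u) = χ-same u₀∼u
        χ≈0 ≉0 (no u₀≁u)  = χ-other u₀≁u λ p[u]≈0 → ≉0 (R.trans (R.*-congʳ p[u]≈0) (R.zeroˡ _))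

    leading-coefficient : coefficient (p D.* q) (u₀ ++ v₀) R.≈ coefficient p u₀ R.* coefficient q v₀
    leading-coefficient = begin
      coefficient (p D.* q) (u₀ ++ v₀)
        ≈⟨ coefficient≈linear (p D.* q) (u₀ ++ v₀) ⟩
      linear (δ (u₀ ++ v₀)) (p D.* q)
        ≈⟨ linear-* _ p q ⟩
      linear X p
        ≈⟨ sumL-cong p (λ (a , u) → solve 4 (λ a x d y → a :* x := a :* (x :- d :* y) :+ a :* d :* y) R.refl
          a (X u) (δ u₀ u) (coefficient q v₀)) ⟩
      sumL p (λ (a , u) → a R.* χ u R.+ a R.* δ u₀ u R.* coefficient q v₀)
        ≈⟨ sumL-+ p _ _ ⟩
      linear χ p R.+ sumL p (λ (a , u) → a R.* δ u₀ u R.* coefficient q v₀)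
        ≈⟨ R.+-cong (linear-zero p χ-invariant χ-zero) (R.sym (sumL-* p _ _)) ⟩
      R.0# R.+ linear (δ u₀) p R.* coefficient q v₀
        ≈⟨ R.+-identityˡ _ ⟩
      linear (δ u₀) p R.* coefficient q v₀
        ≈⟨ R.*-congʳ (coefficient≈linear p u₀) ⟨
      coefficient p u₀ R.* coefficient q v₀ ∎

  no-zero-divisors : ∀ p q → p D.* q D.≈ D.0# → ¬ (p D.≈ D.0#) → ¬ ¬ (q D.≈ D.0#)
  no-zero-divisors p q pq≈0 p≉0 q≉0 = leading vs (monomials p) λ
    { (inj₁ none) → p≉0 (vanishing p none)
    ; (inj₂ P) → leading vs (monomials q) λ
      { (inj₁ none) → q≉0 (vanishing q none)
      ; (inj₂ Q) → proj₁ (proj₂ (proj₂ Q)) (field-no-zero-divisors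
          (R.trans (R.sym (leading-coefficient p q vs p⊆vs P Q)) (pq≈0 (proj₁ P ++ proj₁ Q)))
            (proj₁ (proj₂ (proj₂ P))))
      } }
    where
    vs = List.concat (monomials p)

    p⊆vs : ∀ {u x} → u ∈ monomials p → x ∈ u → x ∈ vs
    p⊆vs u∈ x∈ = ∈.∈-concat⁺′ x∈ u∈

  -- The double negation in `no-zero-divisors` is removed here, one coefficient at a time, by
  -- `stable`.
  *-cancelˡ : ∀ q x y → ¬ (q D.≈ D.0#) → q D.* x D.≈ q D.* y → x D.≈ y
  *-cancelˡ q x y q≉0 eq w = stable λ x≉y → no-zero-divisors q (x D.- y)
    (D.trans {q D.* (x D.- y)} {q D.* x D.- q D.* y} {D.0#}
      (DS.solve 3 (λ q x y → q DS.:* (x DS.:- y) DS.:= q DS.:* x DS.:- q DS.:* y) (λ _ → R.refl) q x y)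
      (λ w → R.trans (coefficient-++ (q D.* x) (D.- (q D.* y)) w)
        (R.trans (R.+-cong (eq w) (coefficient-neg (q D.* y) w)) (R.-‿inverseʳ _))))
    q≉0 λ x-y≈0 → x≉y (begin
      coefficient x w                                               ≈⟨ solve 2 (λ x y → x := (x :- y) :+ y)
        R.refl _ _ ⟩
      coefficient x w R.- coefficient y w R.+ coefficient y w       ≈⟨ R.+-congʳ (R.+-congˡ (coefficient-neg y w)) ⟨
      coefficient x w R.+ coefficient (D.- y) w R.+ coefficient y w ≈⟨ R.+-congʳ (coefficient-++ x (D.- y) w) ⟨
      coefficient (x D.- y) w R.+ coefficient y w                   ≈⟨ R.+-congʳ (x-y≈0 w) ⟩
      R.0# R.+ coefficient y w                                      ≈⟨ R.+-identityˡ _ ⟩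
      coefficient y w                                               ∎)

Cancellative : ∀ {c ℓ} → CommutativeRing c ℓ → Set (c ⊔ ℓ)
Cancellative D = ∀ q x y → ¬ (q ≈ 0#) → q * x ≈ q * y → x ≈ y
  where open CommutativeRing D

module FractionFieldRing {c ℓ} (D : CommutativeRing c ℓ) (*-cancelˡ : Cancellative D) where
  open CommutativeRing D
  open FractionField rawRing
  open Fraction
  open IntegerCoefficients D using (solve; _:=_; _:+_; _:*_; _:-_; :-_; con)
  open import Relation.Binary.Reasoning.Setoid setoid
  private module K = RawRing fractionField

  product : List NonZeroElement → Carrier
  product = foldr (λ q d → proj₁ q * d) 1#

  product-++ : ∀ ps qs → product (ps ++ qs) ≈ product ps * product qs
  product-++ []       qs = sym (*-identityˡ _)
  product-++ (p ∷ ps) qs = trans (*-congˡ (product-++ ps qs)) (sym (*-assoc _ _ _))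

  -- Denominators are lists of nonzero factors, so they are cancelled factor by factor, and no
  -- product has to be shown nonzero. This gives transitivity of the equality of fractions.
  product-cancelˡ : ∀ qs x y → product qs * x ≈ product qs * y → x ≈ y
  product-cancelˡ []             x y eq = trans (sym (*-identityˡ x)) (trans eq (*-identityˡ y))
  product-cancelˡ ((q , q≉0) ∷ qs) x y eq = product-cancelˡ qs x y
    (*-cancelˡ q _ _ q≉0 (trans (sym (*-assoc _ _ _)) (trans eq (*-assoc _ _ _))))

  ≈-pointwise : ∀ {s t} → num s ≈ num t → den s ≈ den t → s K.≈ t
  ≈-pointwise n d = *-cong n (sym d)

  private
    ≈-trans : ∀ {s t u} → s K.≈ t → t K.≈ u → s K.≈ u
    ≈-trans {s} {t} {u} s≈t t≈u = product-cancelˡ (factors t) _ _ (begin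
      den t * (num s * den u)  ≈⟨ solve 3 (λ x y z → x :* (y :* z) := y :* x :* z) refl _ _ _ ⟩
      num s * den t * den u    ≈⟨ *-congʳ s≈t ⟩
      num t * den s * den u    ≈⟨ solve 3 (λ x y z → x :* y :* z := x :* z :* y) refl _ _ _ ⟩
      num t * den u * den s    ≈⟨ *-congʳ t≈u ⟩
      num u * den t * den s    ≈⟨ solve 3 (λ x y z → x :* y :* z := y :* (x :* z)) refl _ _ _ ⟩
      den t * (num u * den s)  ∎)

    +-cong′ : ∀ {s s′ t t′} → s K.≈ s′ → t K.≈ t′ → s K.+ t K.≈ s′ K.+ t′
    +-cong′ {s} {s′} {t} {t′} s≈ t≈ = begin
      (num s * den t + num t * den s) * product (factors s′ ++ factors t′)
        ≈⟨ *-congˡ (product-++ (factors s′) (factors t′)) ⟩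
      (num s * den t + num t * den s) * (den s′ * den t′)
        ≈⟨ solve 6 (λ n d m e d′ e′ → (n :* e :+ m :* d) :* (d′ :* e′) := n :* d′ :* (e :* e′) :+ m :* e′ :*
          (d :* d′)) refl _ _ _ _ _ _ ⟩
      num s * den s′ * (den t * den t′) + num t * den t′ * (den s * den s′)
        ≈⟨ +-cong (*-congʳ s≈) (*-congʳ t≈) ⟩
      num s′ * den s * (den t * den t′) + num t′ * den t * (den s * den s′)
        ≈⟨ solve 6 (λ n d m e d′ e′ → n :* d :* (e :* e′) :+ m :* e :* (d :* d′) := (n :* e′ :+ m :* d′) :*
          (d :* e)) refl _ _ _ _ _ _ ⟩
      (num s′ * den t′ + num t′ * den s′) * (den s * den t)
        ≈⟨ *-congˡ (product-++ (factors s) (factors t)) ⟨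
      (num s′ * den t′ + num t′ * den s′) * product (factors s ++ factors t) ∎

    *-cong′ : ∀ {s s′ t t′} → s K.≈ s′ → t K.≈ t′ → s K.* t K.≈ s′ K.* t′
    *-cong′ {s} {s′} {t} {t′} s≈ t≈ = begin
      num s * num t * product (factors s′ ++ factors t′)
        ≈⟨ *-congˡ (product-++ (factors s′) (factors t′)) ⟩
      num s * num t * (den s′ * den t′)
        ≈⟨ solve 4 (λ n m d e → n :* m :* (d :* e) := n :* d :* (m :* e)) refl _ _ _ _ ⟩
      num s * den s′ * (num t * den t′)
        ≈⟨ *-cong s≈ t≈ ⟩
      num s′ * den s * (num t′ * den t)
        ≈⟨ solve 4 (λ n m d e → n :* d :* (m :* e) := n :* m :* (d :* e)) refl _ _ _ _ ⟩
      num s′ * num t′ * (den s * den t)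
        ≈⟨ *-congˡ (product-++ (factors s) (factors t)) ⟨
      num s′ * num t′ * product (factors s ++ factors t) ∎

    factors-comm : ∀ s t → product (factors s ++ factors t) ≈ product (factors t ++ factors s)
    factors-comm s t = trans (product-++ (factors s) (factors t))
      (trans (*-comm _ _) (sym (product-++ (factors t) (factors s))))

    +-assoc′ : ∀ s t u → (s K.+ t) K.+ u K.≈ s K.+ (t K.+ u)
    +-assoc′ s t u = ≈-pointwise {(s K.+ t) K.+ u} {s K.+ (t K.+ u)}
      (begin
        (num s * den t + num t * den s) * den u + num u * product (factors s ++ factors t)
          ≈⟨ +-congˡ (*-congˡ (product-++ (factors s) (factors t))) ⟩
        (num s * den t + num t * den s) * den u + num u * (den s * den t)
          ≈⟨ solve 6 (λ n d m e k f → (n :* e :+ m :* d) :* f :+ k :* (d :* e) := n :* (e :* f) :+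
            (m :* f :+ k :* e) :* d) refl _ _ _ _ _ _ ⟩
        num s * (den t * den u) + (num t * den u + num u * den t) * den s
          ≈⟨ +-congʳ (*-congˡ (product-++ (factors t) (factors u))) ⟨
        num s * product (factors t ++ factors u) + (num t * den u + num u * den t) * den s ∎)
      (reflexive (≡.cong product (List.++-assoc (factors s) (factors t) (factors u))))

    +-comm′ : ∀ s t → s K.+ t K.≈ t K.+ s
    +-comm′ s t = ≈-pointwise {s K.+ t} {t K.+ s} (+-comm _ _) (factors-comm s t)

    +-identityˡ′ : ∀ s → K.0# K.+ s K.≈ s
    +-identityˡ′ s = ≈-pointwise {K.0# K.+ s} {s}
      (solve 2 (λ n d → con (+ 0) :* d :+ n :* con (+ 1) := n) refl _ _) refl

    -‿inverseˡ′ : ∀ s → (K.- s) K.+ s K.≈ K.0#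
    -‿inverseˡ′ s = solve 3 (λ n d p → (:- n :* d :+ n :* d) :* con (+ 1) := con (+ 0) :* p) refl _ _ _

    -‿cong′ : ∀ {s t} → s K.≈ t → K.- s K.≈ K.- t
    -‿cong′ {s} {t} eq = begin
      - num s * den t    ≈⟨ solve 2 (λ x y → :- x :* y := :- (x :* y)) refl _ _ ⟩
      - (num s * den t)  ≈⟨ -‿cong eq ⟩
      - (num t * den s)  ≈⟨ solve 2 (λ x y → :- x :* y := :- (x :* y)) refl _ _ ⟨
      - num t * den s    ∎

    *-assoc′ : ∀ s t u → (s K.* t) K.* u K.≈ s K.* (t K.* u)
    *-assoc′ s t u = ≈-pointwise {(s K.* t) K.* u} {s K.* (t K.* u)} (*-assoc _ _ _)
      (reflexive (≡.cong product (List.++-assoc (factors s) (factors t) (factors u))))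

    *-comm′ : ∀ s t → s K.* t K.≈ t K.* s
    *-comm′ s t = ≈-pointwise {s K.* t} {t K.* s} (*-comm _ _) (factors-comm s t)

    *-identityˡ′ : ∀ s → K.1# K.* s K.≈ s
    *-identityˡ′ s = ≈-pointwise {K.1# K.* s} {s} (*-identityˡ _) refl

    distribˡ′ : ∀ s t u → s K.* (t K.+ u) K.≈ s K.* t K.+ s K.* u
    distribˡ′ s t u = begin
      num s * (num t * den u + num u * den t) * product ((fs ++ ft) ++ (fs ++ fu))
        ≈⟨ *-congˡ (trans (product-++ (fs ++ ft) (fs ++ fu)) (*-cong (product-++ fs ft) (product-++ fs fu))) ⟩
      num s * (num t * den u + num u * den t) * (den s * den t * (den s * den u))
        ≈⟨ solve 6 (λ n d m e k f → n :* (m :* f :+ k :* e) :* (d :* e :* (d :* f)) := (n :* m :* (d :* f)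
          :+ n :* k :* (d :* e)) :* (d :* (e :* f))) refl _ _ _ _ _ _ ⟩
      (num s * num t * (den s * den u) + num s * num u * (den s * den t)) * (den s * (den t * den u))
        ≈⟨ *-cong (+-cong (*-congˡ (product-++ fs fu)) (*-congˡ (product-++ fs ft)))
          (trans (product-++ fs (ft ++ fu)) (*-congˡ (product-++ ft fu))) ⟨
      (num s * num t * product (fs ++ fu) + num s * num u * product (fs ++ ft)) * product (fs ++ (ft ++ fu)) ∎
      where
      fs = factors s
      ft = factors t
      fu = factors u

  fractionRing : CommutativeRing (c ⊔ ℓ) ℓ
  fractionRing = record
    { Carrier = Fraction ; _≈_ = K._≈_ ; _+_ = K._+_ ; _*_ = K._*_ ; -_ = K.-_ ; 0# = K.0# ; 1# = K.1#
    ; isCommutativeRing = record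
      { isRing = record
        { +-isAbelianGroup = record
          { isGroup = record
            { isMonoid = record
              { isSemigroup = record
                { isMagma = record
                  { isEquivalence = record
                    { refl = refl ; sym = sym ; trans = λ {s} {t} {u} → ≈-trans {s} {t} {u} }
                  ; ∙-cong = λ {s} {s′} {t} {t′} → +-cong′ {s} {s′} {t} {t′}
                  }
                ; assoc = +-assoc′
                }
              ; identity = +-identityˡ′ , λ s → ≈-trans {s K.+ K.0#} {K.0# K.+ s} {s} (+-comm′ s K.0#)
                (+-identityˡ′ s)
              }
            ; inverse = -‿inverseˡ′ , λ s → ≈-trans {s K.+ (K.- s)} {(K.- s) K.+ s} {K.0#}
              (+-comm′ s (K.- s)) (-‿inverseˡ′ s)
            ; ⁻¹-cong = λ {s} {t} → -‿cong′ {s} {t}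
            }
          ; comm = +-comm′
          }
        ; *-cong = λ {s} {s′} {t} {t′} → *-cong′ {s} {s′} {t} {t′}
        ; *-assoc = *-assoc′
        ; *-identity = *-identityˡ′ , λ s → ≈-trans {s K.* K.1#} {K.1# K.* s} {s} (*-comm′ s K.1#) (*-identityˡ′ s)
        ; distrib = distribˡ′ , λ s t u → ≈-trans {(t K.+ u) K.* s} {s K.* (t K.+ u)} {t K.* s K.+ u K.* s}
            (*-comm′ (t K.+ u) s) (≈-trans {s K.* (t K.+ u)} {s K.* t K.+ s K.* u} {t K.* s K.+ u K.* s}
              (distribˡ′ s t u) (+-cong′ {s K.* t} {t K.* s} {s K.* u} {u K.* s} (*-comm′ s t) (*-comm′ s u)))
        }
      ; *-comm = *-comm′
      }
    }

  embed-hom : Homomorphism D fractionRing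
  embed-hom = record
    { ⟦_⟧ = embed
    ; ⟦⟧-cong = *-congʳ
    ; +-homo = λ x y → *-congʳ (+-cong (sym (*-identityʳ x)) (sym (*-identityʳ y)))
    ; *-homo = λ x y → refl
    ; 0-homo = refl
    ; 1-homo = refl
    }

  embed-invertible : ∀ d → ¬ (d ≈ 0#) → ∃[ s ] s K.* embed d K.≈ K.1#
  embed-invertible d d≉0 = (1# / ((d , d≉0) ∷ [])) ,
    solve 1 (λ d → con (+ 1) :* d :* con (+ 1) := con (+ 1) :* (d :* con (+ 1))) refl d

-- Splitting one row between two consecutive letters

module TwoLetterSums {c ℓ} (R : CommutativeRing c ℓ) (β : CommutativeRing.Carrier R) where
  open CommutativeRing R hiding (zero)
  open IntegerCoefficients R using (solve; _:=_; _:+_; _:*_; _:-_; :-_; con)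
  open ListSum R
  open import Relation.Binary.Reasoning.Setoid setoid

  infixl 6 _⊕_
  _⊕_ : Carrier → Carrier → Carrier
  x ⊕ y = x + y + β * x * y

  -- The map that makes ⊕ multiplicative: 1 + β (x ⊕ y) = ⟨ x ⟩ ⟨ y ⟩. The left side is the combined
  -- weight of not adding and of adding a letter x to a box that is already filled, with y the
  -- parameter of the box.
  ⟨_⟩ : Carrier → Carrier
  ⟨ x ⟩ = 1# + β * x

  Sequence : Set c
  Sequence = ℕ → Carrier

  infixl 9 _↓_
  _↓_ : Sequence → ℕ → Sequence
  (c ↓ n) j = c (n ℕ.+ j)

  -- The factorial power of `x`: the weight of `n` consecutive boxes of a row whose least entry is
  -- the letter `x`.
  run : Carrier → Sequence → ℕ → Carrier
  run x c zero    = 1#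
  run x c (suc n) = (x ⊕ c 0) * run x (c ↓ 1) n

  run-cong : ∀ x {c c′} n → (∀ j → c j ≡ c′ j) → run x c n ≈ run x c′ n
  run-cong x zero    eq = refl
  run-cong x (suc n) eq = *-cong (reflexive (≡.cong (x ⊕_) (eq 0))) (run-cong x n (eq ∘ suc))

  run-+ : ∀ x c m n → run x c (m ℕ.+ n) ≈ run x c m * run x (c ↓ m) n
  run-+ x c zero    n = sym (*-identityˡ _)
  run-+ x c (suc m) n = trans (*-congˡ (run-+ x (c ↓ 1) m n)) (sym (*-assoc _ _ _))

  run-snoc : ∀ x c n → run x c (suc n) ≈ run x c n * (x ⊕ c n)
  run-snoc x c n = begin
    run x c (suc n)                     ≡⟨ ≡.cong (run x c) (ℕ.+-comm n 1) ⟨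
    run x c (n ℕ.+ 1)                   ≈⟨ run-+ x c n 1 ⟩
    run x c n * ((x ⊕ c (n ℕ.+ 0)) * 1#) ≈⟨ *-congˡ (*-identityʳ _) ⟩
    run x c n * (x ⊕ c (n ℕ.+ 0))        ≡⟨ ≡.cong (λ k → run x c n * (x ⊕ c k)) (ℕ.+-identityʳ n) ⟩
    run x c n * (x ⊕ c n)               ∎

  sumTo : ℕ → (ℕ → Carrier) → Carrier
  sumTo zero    f = f 0
  sumTo (suc n) f = f 0 + sumTo n (f ∘ suc)

  sumTo-cong : ∀ n {f g} → (∀ t → t ℕ.≤ n → f t ≈ g t) → sumTo n f ≈ sumTo n g
  sumTo-cong zero    eq = eq 0 z≤n
  sumTo-cong (suc n) eq = +-cong (eq 0 z≤n) (sumTo-cong n λ t t≤n → eq (suc t) (s≤s t≤n))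

  *-sumTo : ∀ y n f → y * sumTo n f ≈ sumTo n (λ t → y * f t)
  *-sumTo y zero    f = refl
  *-sumTo y (suc n) f = trans (distribˡ _ _ _) (+-congˡ (*-sumTo y n (f ∘ suc)))

  sumTo-0 : ∀ n {f} → (∀ t → f t ≈ 0#) → sumTo n f ≈ 0#
  sumTo-0 zero    eq = eq 0
  sumTo-0 (suc n) eq = trans (+-cong (eq 0) (sumTo-0 n (eq ∘ suc))) (+-identityˡ _)

  -- Meant for `low true`, whose value at 0 breaks the pattern of the others. By `⊕-⟨⟩` the boundary
  -- term becomes -β times a run that is one box longer. `sumTo-last` does the same at the other
  -- end.
  sumTo-first : ∀ n (f w : ℕ → Carrier) {low : ℕ → Carrier} → low 0 ≈ 1# → (∀ t → low (suc t) ≈ w (suc t)) →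
    sumTo n (λ t → f t * low t) ≈ sumTo n (λ t → f t * w t) + f 0 * (1# - w 0)
  sumTo-first zero f w eq _ = trans (*-congˡ eq)
    (solve 2 (λ f w → f :* con (+ 1) := f :* w :+ f :* (con (+ 1) :- w)) refl _ _)
  sumTo-first (suc n) f w eq eqs = trans
    (+-cong (*-congˡ eq) (sumTo-cong n λ t _ → *-congˡ (eqs t)))
    (solve 3 (λ f w s → f :* con (+ 1) :+ s := f :* w :+ s :+ f :* (con (+ 1) :- w)) refl _ _ _)

  sumTo-last : ∀ n (f : ℕ → Carrier) w {up : ℕ → Carrier} → up n ≈ 1# → (∀ t → t ℕ.< n → up t ≈ w) →
    sumTo n (λ t → f t * up t) ≈ w * sumTo n f + f n * (1# - w)
  sumTo-last zero f w eq _ = trans (*-congˡ eq)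
    (solve 2 (λ f w → f :* con (+ 1) := w :* f :+ f :* (con (+ 1) :- w)) refl _ _)
  sumTo-last (suc n) f w {up} eq eqs = trans
    (+-cong (*-congˡ (eqs 0 (s≤s z≤n))) (sumTo-last n (f ∘ suc) w {up ∘ suc} eq (λ t t<n → eqs (suc t) (s≤s t<n))))
    (solve 4 (λ f w s g → f :* w :+ (w :* s :+ g) := w :* (f :+ s) :+ g) refl _ _ _ _)

  sumTo-window : ∀ lo len N {f} → lo ℕ.+ len ℕ.≤ N → (∀ q → q ℕ.< lo → f q ≈ 0#) → (∀ q → lo ℕ.+ len ℕ.< q →
    f q ≈ 0#) →
    sumTo N f ≈ sumTo len (λ t → f (lo ℕ.+ t))
  sumTo-window (suc lo) len (suc N) (s≤s le) below above =
    trans (+-congʳ (below 0 (s≤s z≤n))) (trans (+-identityˡ _)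
      (sumTo-window lo len N le (λ q q<lo → below (suc q) (s≤s q<lo)) (λ q hi<q → above (suc q) (s≤s hi<q))))
  sumTo-window zero (suc len) (suc N) (s≤s le) below above =
    +-congˡ (sumTo-window zero len N le (λ _ ()) (λ q hi<q → above (suc q) (s≤s hi<q)))
  sumTo-window zero zero zero    le below above = refl
  sumTo-window zero zero (suc N) le below above =
    trans (+-congˡ (sumTo-0 N λ t → above (suc t) (s≤s z≤n))) (+-identityʳ _)

  sumL-upTo : ∀ N f → sumL (upTo (suc N)) f ≈ sumTo N f
  sumL-upTo N f = go N id
    where
    go : ∀ N (g : ℕ → ℕ) → sumL (List.applyUpTo g (suc N)) f ≈ sumTo N (f ∘ g)
    go zero    g = +-identityʳ _
    go (suc N) g = +-congˡ (go N (g ∘ suc))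

  ⊕-⟨⟩ : ∀ x y → 1# - ⟨ x ⟩ * ⟨ y ⟩ ≈ - (β * (x ⊕ y))
  ⊕-⟨⟩ = solve 3 (λ β x y → con (+ 1) :- (con (+ 1) :+ β :* x) :* (con (+ 1) :+ β :* y) :=
    :- (β :* (x :+ y :+ β :* x :* y))) refl β

  -- The sum over the ways to split a run of boxes between two consecutive letters.
  term : Carrier → Carrier → Sequence → ℕ → ℕ → Carrier
  term x y c n t = run x c t * run y (c ↓ suc t) (n ∸ t)

  split : Carrier → Carrier → Sequence → ℕ → Carrier
  split x y c n = sumTo n (λ t → term x y c n t * ⟨ c t ⟩)

  split-suc : ∀ x y c n → split x y c (suc n) ≈
    run y (c ↓ 1) (suc n) * ⟨ c 0 ⟩ + (x ⊕ c 0) * split x y (c ↓ 1) n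
  split-suc x y c n = +-cong (*-congʳ (*-identityˡ _))
    (trans (sumTo-cong n λ t _ → solve 4 (λ a b c d → a :* b :* c :* d := a :* (b :* c :* d)) refl _ _ _ _)
      (sym (*-sumTo _ n _)))

  ⊕-difference : ∀ x y b → (x - y) * ⟨ b ⟩ ≈ (x ⊕ b) - (y ⊕ b)
  ⊕-difference = solve 4 (λ β x y b → (x :- y) :* (con (+ 1) :+ β :* b) :=
    (x :+ b :+ β :* x :* b) :- (y :+ b :+ β :* y :* b)) refl β

  -- (x - y) ⟨ c t ⟩ = (x ⊕ c t) - (y ⊕ c t) makes the sum telescope.
  split-telescopes : ∀ x y c n → (x - y) * split x y c n ≈ run x c (suc n) - run y c (suc n)
  split-telescopes x y c zero = begin
    (x - y) * (1# * 1# * ⟨ c 0 ⟩)         ≈⟨ solve 3 (λ x y b → (x :- y) :* (con (+ 1) :* con (+ 1) :* b) :=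
      (x :- y) :* b) refl _ _ _ ⟩
    (x - y) * ⟨ c 0 ⟩                     ≈⟨ ⊕-difference x y (c 0) ⟩
    (x ⊕ c 0) - (y ⊕ c 0)                 ≈⟨ solve 2 (λ x y → x :- y := x :* con (+ 1) :- y :* con (+ 1)) refl _ _ ⟩
    (x ⊕ c 0) * 1# - (y ⊕ c 0) * 1#       ∎
  split-telescopes x y c (suc n) = begin
    (x - y) * split x y c (suc n)
      ≈⟨ *-congˡ (split-suc x y c n) ⟩
    (x - y) * (PY * ⟨ c 0 ⟩ + X * S)
      ≈⟨ solve 5 (λ d P a X S → d :* (P :* a :+ X :* S) := P :* (d :* a) :+ X :* (d :* S)) refl _ _ _ _ _ ⟩
    PY * ((x - y) * ⟨ c 0 ⟩) + X * ((x - y) * S)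
      ≈⟨ +-cong (*-congˡ (⊕-difference x y (c 0))) (*-congˡ (split-telescopes x y (c ↓ 1) n)) ⟩
    PY * (X - Y) + X * (PX - PY)
      ≈⟨ solve 4 (λ P X Y Q → P :* (X :- Y) :+ X :* (Q :- P) := X :* Q :- Y :* P) refl _ _ _ _ ⟩
    X * PX - Y * PY ∎
    where
    PX = run x (c ↓ 1) (suc n)
    PY = run y (c ↓ 1) (suc n)
    X = x ⊕ c 0
    Y = y ⊕ c 0
    S = split x y (c ↓ 1) n

  -- Telescoping shows that both sides agree after multiplication by x - y, but x - y need not be
  -- cancellable. Instead the symmetry is proved by induction, and the telescoped form is applied to
  -- the shorter sum only.
  split-comm : ∀ x y c n → split x y c n ≈ split y x c n
  split-comm x y c zero    = refl
  split-comm x y c (suc n) = begin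
    split x y c (suc n)
      ≈⟨ split-suc x y c n ⟩
    PY * ⟨ c 0 ⟩ + X * S
      ≈⟨ solve 6 (λ P Q a X Y S → P :* a :+ X :* S := Q :* a :+ Y :* S :- (Q :- P) :* a :+ (X :- Y) :* S)
        refl _ PX _ _ Y _ ⟩
    PX * ⟨ c 0 ⟩ + Y * S - (PX - PY) * ⟨ c 0 ⟩ + (X - Y) * S
      ≈⟨ +-cong (+-congˡ (-‿cong (*-congʳ (split-telescopes x y (c ↓ 1) n)))) (*-congʳ (⊕-difference x y (c 0))) ⟨
    PX * ⟨ c 0 ⟩ + Y * S - (x - y) * S * ⟨ c 0 ⟩ + (x - y) * ⟨ c 0 ⟩ * S
      ≈⟨ solve 4 (λ z d S a → z :- d :* S :* a :+ d :* a :* S := z) refl _ _ _ _ ⟩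
    PX * ⟨ c 0 ⟩ + Y * S
      ≈⟨ +-congˡ (*-congˡ (split-comm x y (c ↓ 1) n)) ⟩
    PX * ⟨ c 0 ⟩ + Y * split y x (c ↓ 1) n
      ≈⟨ split-suc y x c n ⟨
    split y x c (suc n) ∎
    where
    PX = run x (c ↓ 1) (suc n)
    PY = run y (c ↓ 1) (suc n)
    X = x ⊕ c 0
    Y = y ⊕ c 0
    S = split x y (c ↓ 1) n

  -- `low` and `up` are the factors for joining a last box, as functions of the splitting point. The
  -- flag `true` says that a neighbouring row forces this end of the range: at the end itself no
  -- letter may join, and the factor is 1. For `false` one formula holds throughout, and what does
  -- not depend on `t` has been taken out.
  low : Bool → Carrier → Sequence → ℕ → Carrier
  low false y c t       = ⟨ c t ⟩
  low true  y c zero    = 1#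
  low true  y c (suc t) = ⟨ y ⟩ * ⟨ c (suc t) ⟩

  up : Bool → Carrier → Sequence → ℕ → ℕ → Carrier
  up false x c n t = 1#
  up true  x c n t = if does (t ℕ.≟ n) then 1# else ⟨ x ⟩ * ⟨ c n ⟩

  core : Bool → Bool → Carrier → Carrier → Sequence → ℕ → Carrier
  core l u x y c n = sumTo n (λ t → term x y c n t * low l y c t * up u x c n t)

  private
    up-end : ∀ x c n → up true x c n n ≈ 1#
    up-end x c n = if-yes (n ℕ.≟ n) ≡.refl

    up-before : ∀ x c n t → t ℕ.< n → up true x c n t ≈ ⟨ x ⟩ * ⟨ c n ⟩
    up-before x c n t t<n = if-no (t ℕ.≟ n) (ℕ.<⇒≢ t<n)

    term-end : ∀ x y c n → term x y c n n ≈ run x c n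
    term-end x y c n = trans (*-congˡ (reflexive (≡.cong (run y (c ↓ suc n)) (ℕ.n∸n≡0 n)))) (*-identityʳ _)

    core-ff : ∀ x y c n → core false false x y c n ≈ split x y c n
    core-ff x y c n = sumTo-cong n λ t _ → *-identityʳ _

    low-sum : ∀ x y c n → sumTo n (λ t → term x y c n t * low true y c t) ≈
      ⟨ y ⟩ * split x y c n - β * run y c (suc n)
    low-sum x y c n = begin
      sumTo n (λ t → term x y c n t * low true y c t)
        ≈⟨ sumTo-first n (term x y c n) (λ t → ⟨ y ⟩ * ⟨ c t ⟩) {low true y c} refl (λ t → refl) ⟩
      sumTo n (λ t → term x y c n t * (⟨ y ⟩ * ⟨ c t ⟩)) + 1# * run y (c ↓ 1) n * (1# - ⟨ y ⟩ * ⟨ c 0 ⟩)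
        ≈⟨ +-cong (trans (sumTo-cong n λ t _ → solve 3 (λ a b c → a :* (b :* c) := b :* (a :* c)) refl
          (term x y c n t) ⟨ y ⟩ ⟨ c t ⟩) (sym (*-sumTo ⟨ y ⟩ n (λ t → term x y c n t * ⟨ c t ⟩))))
          (*-congˡ (⊕-⟨⟩ y (c 0))) ⟩
      ⟨ y ⟩ * split x y c n + 1# * run y (c ↓ 1) n * - (β * (y ⊕ c 0))
        ≈⟨ solve 4 (λ s r b z → s :+ con (+ 1) :* r :* :- (b :* z) := s :- b :* (z :* r)) refl _ _ _ _ ⟩
      ⟨ y ⟩ * split x y c n - β * run y c (suc n) ∎

    up-sum : ∀ x c n f → sumTo n (λ t → f t * up true x c n t) ≈
      ⟨ x ⟩ * ⟨ c n ⟩ * sumTo n f - f n * (β * (x ⊕ c n))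
    up-sum x c n f = trans (sumTo-last n f (⟨ x ⟩ * ⟨ c n ⟩) {up true x c n} (up-end x c n) (up-before x c n))
      (+-congˡ (trans (*-congˡ (⊕-⟨⟩ x (c n))) (solve 2 (λ f z → f :* :- z := :- (f :* z)) refl _ _)))

    core-tf : ∀ x y c n → core true false x y c n ≈ ⟨ y ⟩ * split x y c n - β * run y c (suc n)
    core-tf x y c n = trans (sumTo-cong n λ t _ → *-identityʳ _) (low-sum x y c n)

    core-ft : ∀ x y c n → core false true x y c n ≈ ⟨ c n ⟩ * (⟨ x ⟩ * split x y c n - β * run x c (suc n))
    core-ft x y c n = begin
      core false true x y c n
        ≈⟨ up-sum x c n (λ t → term x y c n t * ⟨ c t ⟩) ⟩
      ⟨ x ⟩ * ⟨ c n ⟩ * split x y c n - term x y c n n * ⟨ c n ⟩ * (β * (x ⊕ c n))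
        ≈⟨ +-congˡ (-‿cong (*-congʳ (*-congʳ (term-end x y c n)))) ⟩
      ⟨ x ⟩ * ⟨ c n ⟩ * split x y c n - run x c n * ⟨ c n ⟩ * (β * (x ⊕ c n))
        ≈⟨ solve 6 (λ b a s r β z → b :* a :* s :- r :* a :* (β :* z) := a :* (b :* s :- β :* (r :* z)))
          refl _ _ _ _ _ _ ⟩
      ⟨ c n ⟩ * (⟨ x ⟩ * split x y c n - β * (run x c n * (x ⊕ c n)))
        ≈⟨ *-congˡ (+-congˡ (-‿cong (*-congˡ (run-snoc x c n)))) ⟨
      ⟨ c n ⟩ * (⟨ x ⟩ * split x y c n - β * run x c (suc n)) ∎

    core-tt : ∀ x y c n → core true true x y c (suc n) ≈ ⟨ c (suc n) ⟩ *
      (⟨ x ⟩ * ⟨ y ⟩ * split x y c (suc n) - ⟨ x ⟩ * β * run y c (suc (suc n)) - ⟨ y ⟩ * β * run x c (suc (suc n)))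
    core-tt x y c n = begin
      core true true x y c m
        ≈⟨ up-sum x c m (λ t → term x y c m t * low true y c t) ⟩
      ⟨ x ⟩ * ⟨ c m ⟩ * sumTo m (λ t → term x y c m t * low true y c t) - term x y c m m * (⟨ y ⟩ * ⟨ c m ⟩)
        * (β * (x ⊕ c m))
        ≈⟨ +-cong (*-congˡ (low-sum x y c m)) (-‿cong (*-congʳ (*-congʳ (term-end x y c m)))) ⟩
      ⟨ x ⟩ * ⟨ c m ⟩ * (⟨ y ⟩ * split x y c m - β * run y c (suc m)) - run x c m * (⟨ y ⟩ * ⟨ c m ⟩) *
        (β * (x ⊕ c m))
        ≈⟨ solve 8 (λ b a d s β p r z → b :* a :* (d :* s :- β :* p) :- r :* (d :* a) :* (β :* z) :=
             a :* (b :* d :* s :- b :* β :* p :- d :* β :* (r :* z))) refl _ _ _ _ _ _ _ _ ⟩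
      ⟨ c m ⟩ * (⟨ x ⟩ * ⟨ y ⟩ * split x y c m - ⟨ x ⟩ * β * run y c (suc m) - ⟨ y ⟩ * β * (run x c m * (x ⊕ c m)))
        ≈⟨ *-congˡ (+-congˡ (-‿cong (*-congˡ (run-snoc x c m)))) ⟨
      ⟨ c m ⟩ * (⟨ x ⟩ * ⟨ y ⟩ * split x y c m - ⟨ x ⟩ * β * run y c (suc m) - ⟨ y ⟩ * β * run x c (suc m)) ∎
      where m = suc n

    -- ⟨ y ⟩ - ⟨ x ⟩ = - β (x - y), so this follows from the telescoping of split.
    balance : ∀ x y c n → ⟨ y ⟩ * split x y c n - β * run y c (suc n) ≈ ⟨ x ⟩ * split x y c n - β * run x c (suc n)
    balance x y c n = begin
      ⟨ y ⟩ * S - β * PY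
        ≈⟨ solve 6 (λ β x y S P Q → (con (+ 1) :+ β :* y) :* S :- β :* P :=
             (con (+ 1) :+ β :* x) :* S :- β :* Q :+ β :* (Q :- P :- (x :- y) :* S)) refl β x y S PY PX ⟩
      ⟨ x ⟩ * S - β * PX + β * (PX - PY - (x - y) * S)
        ≈⟨ +-congˡ (*-congˡ (+-congˡ (-‿cong (split-telescopes x y c n)))) ⟩
      ⟨ x ⟩ * S - β * PX + β * (PX - PY - (PX - PY))
        ≈⟨ solve 3 (λ z β d → z :+ β :* (d :- d) := z) refl _ _ _ ⟩
      ⟨ x ⟩ * S - β * PX ∎
      where
      S = split x y c n
      PX = run x c (suc n)
      PY = run y c (suc n)

  core-comm : ∀ l u x y c n → core l u x y c n ≈ core l u y x c n
  core-comm false false x y c n = trans (core-ff x y c n) (trans (split-comm x y c n) (sym (core-ff y x c n)))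
  core-comm true false x y c n = begin
    core true false x y c n                            ≈⟨ core-tf x y c n ⟩
    ⟨ y ⟩ * split x y c n - β * run y c (suc n)        ≈⟨ balance x y c n ⟩
    ⟨ x ⟩ * split x y c n - β * run x c (suc n)        ≈⟨ +-congʳ (*-congˡ (split-comm x y c n)) ⟩
    ⟨ x ⟩ * split y x c n - β * run x c (suc n)        ≈⟨ core-tf y x c n ⟨
    core true false y x c n                            ∎
  core-comm false true x y c n = begin
    core false true x y c n                                      ≈⟨ core-ft x y c n ⟩
    ⟨ c n ⟩ * (⟨ x ⟩ * split x y c n - β * run x c (suc n))      ≈⟨ *-congˡ (balance x y c n) ⟨
    ⟨ c n ⟩ * (⟨ y ⟩ * split x y c n - β * run y c (suc n))      ≈⟨ *-congˡ
      (+-congʳ (*-congˡ (split-comm x y c n))) ⟩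
    ⟨ c n ⟩ * (⟨ y ⟩ * split y x c n - β * run y c (suc n))      ≈⟨ core-ft y x c n ⟨
    core false true y x c n                                      ∎
  -- With a single splitting point the two exceptional ends coincide. The formula of `core-tt` takes
  -- the regular value of `low` at the upper end and fails here.
  core-comm true true x y c zero = *-congʳ (*-congʳ (trans (*-identityʳ _) (sym (*-identityʳ _))))
  core-comm true true x y c (suc n) = begin
    core true true x y c (suc n)
      ≈⟨ core-tt x y c n ⟩
    ⟨ c (suc n) ⟩ * (⟨ x ⟩ * ⟨ y ⟩ * split x y c (suc n) - ⟨ x ⟩ * β * run y c (suc (suc n)) - ⟨ y ⟩ * β *
      run x c (suc (suc n)))
      ≈⟨ *-congˡ (+-congʳ (+-congʳ (*-congˡ (split-comm x y c (suc n))))) ⟩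
    ⟨ c (suc n) ⟩ * (⟨ x ⟩ * ⟨ y ⟩ * split y x c (suc n) - ⟨ x ⟩ * β * run y c (suc (suc n)) - ⟨ y ⟩ * β *
      run x c (suc (suc n)))
      ≈⟨ solve 7 (λ a b d s β p q → a :* (b :* d :* s :- b :* β :* p :- d :* β :* q) :=
           a :* (d :* b :* s :- d :* β :* q :- b :* β :* p)) refl _ _ _ _ _ _ _ ⟩
    ⟨ c (suc n) ⟩ * (⟨ y ⟩ * ⟨ x ⟩ * split y x c (suc n) - ⟨ y ⟩ * β * run x c (suc (suc n)) - ⟨ x ⟩ * β *
      run y c (suc (suc n)))
      ≈⟨ core-tt y x c n ⟨
    core true true y x c (suc n) ∎

-- Chains of shapes and the exchange of two letters

allFamilies-all : ∀ {k} {B : Fin k → Set} {P : ∀ i → B i → Set} {L : ∀ i → List (B i)} →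
  (∀ i → All (P i) (L i)) → All (λ f → ∀ i → P i (f i)) (allFamilies L)
allFamilies-all {zero}  _   = (λ ()) ∷ []
allFamilies-all {suc k} {P = P} {L} all = All.tabulate λ f∈ → helper (∈.∈-cartesianProductWith⁻ _ (L zero)
  (allFamilies (L ∘ suc)) f∈)
  where
  tails = allFamilies-all {P = λ i → P (suc i)} (all ∘ suc)
  helper : ∀ {f} → ∃[ b ] ∃[ g ] b ∈ L zero × g ∈ allFamilies (L ∘ suc) × f ≡ _ → ∀ i → P i (f i)
  helper (b , g , b∈ , g∈ , ≡.refl) zero    = All.lookup (all zero) b∈
  helper (b , g , b∈ , g∈ , ≡.refl) (suc i) = All.lookup tails g∈ i

upTo-≤ : ∀ N → All (ℕ._≤ N) (upTo (suc N))
upTo-≤ N = All.tabulate λ k∈ → ℕ.≤-pred (∈.∈-upTo⁻ k∈)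

-- Comparison together with the excess. As `gap`, `α` and `γ` all branch on the same datum,
-- identities between them need one case distinction.
data Position (u v : ℕ) : Set where
  below : v ℕ.< u → Position u v
  above : ∀ d → v ≡ u ℕ.+ d → Position u v

position : ∀ u v → Position u v
position u v with u ℕ.≤? v
... | yes u≤v = above (v ∸ u) (≡.sym (ℕ.m+[n∸m]≡n u≤v))
... | no u≰v  = below (ℕ.≰⇒> u≰v)

-- The default 0 is the length of the empty row below the last one.
next : ∀ {h} → (Fin h → ℕ) → ℕ
next {zero}  f = 0
next {suc h} f = f zero

-- Shapes with h rows and columns of length at most N; row i of the h rows and the
-- letter r give the index κ = h - 1 - i + r, and the box in column j then carries b (κ + j).
module ChainSums {c ℓ} (R : CommutativeRing c ℓ) (β : CommutativeRing.Carrier R)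
    (b : ℕ → CommutativeRing.Carrier R) (N : ℕ) where
  open CommutativeRing R hiding (zero)
  open IntegerCoefficients R using (solve; _:=_; _:+_; _:*_; _:-_; :-_; con)
  open ListSum R
  open TwoLetterSums R β
  open import Relation.Binary.Reasoning.Setoid setoid

  sumL-cong-All : ∀ {a p} {A : Set a} {P : A → Set p} {xs : List A} {f g} → All P xs →
    (∀ x → P x → f x ≈ g x) → sumL xs f ≈ sumL xs g
  sumL-cong-All []         eq = refl
  sumL-cong-All (px ∷ pxs) eq = +-cong (eq _ px) (sumL-cong-All pxs eq)

  -- A letter x extends a row from length p to length q.
  row : ℕ → Carrier → ℕ → ℕ → Carrier
  row κ x p q = [ p ℕ.≤? q ]· run x (b ↓ (κ ℕ.+ p)) (q ∸ p)

  -- The row has length u before the letter x is inserted, and the row below it has length v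
  -- afterwards; x may join the last box if no box is below it.
  gapAt : ℕ → Carrier → ∀ u {v} → Position u v → Carrier
  gapAt κ x u (below _)         = ⟨ x ⟩ * ⟨ b (κ ℕ.+ (u ∸ 1)) ⟩
  gapAt κ x u (above zero _)    = 1#
  gapAt κ x u (above (suc _) _) = 0#

  gap : ℕ → Carrier → ℕ → ℕ → Carrier
  gap κ x u v = gapAt κ x u (position u v)

  gap-below : ∀ κ x {u v} → v ℕ.< u → gap κ x u v ≈ ⟨ x ⟩ * ⟨ b (κ ℕ.+ (u ∸ 1)) ⟩
  gap-below κ x {u} {v} v<u with position u v
  ... | below _       = refl
  ... | above d ≡.refl = contradiction (ℕ.m≤m+n u d) (ℕ.<⇒≱ v<u)

  gap-at : ∀ κ x {u v} → v ≡ u → gap κ x u v ≈ 1#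
  gap-at κ x {u} {v} ≡.refl with position u u
  ... | below u<u        = contradiction u<u (ℕ.<-irrefl ≡.refl)
  ... | above zero _     = refl
  ... | above (suc d) eq = contradiction eq (ℕ.m≢1+m+n u ∘ λ e → ≡.trans e (ℕ.+-suc u d))

  gap-above : ∀ κ x {u v} → u ℕ.< v → gap κ x u v ≈ 0#
  gap-above κ x {u} {v} u<v with position u v
  ... | below v<u        = contradiction u<v (ℕ.<-asym v<u)
  ... | above zero eq    = contradiction (≡.trans (≡.sym (ℕ.+-identityʳ u)) (≡.sym eq)) (ℕ.<⇒≢ u<v)
  ... | above (suc _) _  = refl

  αAt γAt : ℕ → Carrier → Carrier → ∀ u {v} → Position u v → Carrier
  αAt κ x y u (below _)   = ⟨ x ⟩ * ⟨ b (κ ℕ.+ u) ⟩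
  αAt κ x y u (above d _) = run y (b ↓ (suc κ ℕ.+ u)) d
  γAt κ x y u (below _)   = ⟨ y ⟩
  γAt κ x y u (above d _) = run x (b ↓ (κ ℕ.+ u)) d

  -- The factors of the sum over one row that are not symmetric in the letters x and y: α comes
  -- from the row above, γ from the row below.
  α γ : ℕ → Carrier → Carrier → ℕ → ℕ → Carrier
  α κ x y u v = αAt κ x y u (position u v)
  γ κ x y u v = γAt κ x y u (position u v)

  -- The cancellation between neighbours: the α of a row and the γ of the row above refer to the
  -- same pair of lengths. The index of the upper row is larger by one, so the two runs use the same
  -- parameters and merely exchange their letters.
  αγ-comm : ∀ κ x y u v → α κ x y u v * γ (suc κ) x y u v ≈ α κ y x u v * γ (suc κ) y x u v
  αγ-comm κ x y u v with position u v
  ... | below _   = solve 3 (λ x a y → x :* a :* y := y :* a :* x) refl _ _ _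
  ... | above d _ = *-comm _ _

  -- Below the last row no α is available to balance γ; the gap of the first letter over the empty
  -- row takes its place.
  γ-gap-comm : ∀ κ x y u v → γ κ x y u v * gap κ x u v ≈ γ κ y x u v * gap κ y u v
  γ-gap-comm κ x y u v with position u v
  ... | below _         = solve 3 (λ x a y → y :* (x :* a) := x :* (y :* a)) refl _ _ _
  ... | above zero _    = refl
  ... | above (suc d) _ = trans (zeroʳ _) (sym (zeroʳ _))

  -- With p = p_i, v = s_{i+1}: the summand for q_i vanishes below p + d.
  record Lower (κ p v : ℕ) : Set (c ⊔ ℓ) where
    field
      d      : ℕ
      kind   : Bool
      factor : Carrier → Carrier
      vanish : ∀ y q → q ℕ.< p ℕ.+ d → p ℕ.≤ q → gap (suc κ) y q v ≈ 0#
      value  : ∀ y t → gap (suc κ) y (p ℕ.+ d ℕ.+ t) v ≈ factor y * low kind y (b ↓ (κ ℕ.+ (p ℕ.+ d))) t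
      total  : ∀ x y → run x (b ↓ (κ ℕ.+ p)) d * factor y ≈ γ κ x y p v

  -- With s = s_i: the summand for q_i vanishes above hi.
  record Upper (κ s : ℕ) (φ : Carrier → ℕ → Carrier) (A : Carrier → Carrier → Carrier) : Set (c ⊔ ℓ) where
    field
      hi e   : ℕ
      s≡hi+e : s ≡ hi ℕ.+ e
      kind   : Bool
      factor : Carrier → Carrier
      vanish : ∀ x q → hi ℕ.< q → q ℕ.≤ s → φ x q ≈ 0#
      value  : ∀ x lo len t → lo ℕ.+ len ≡ hi → t ℕ.≤ len →
               φ x (lo ℕ.+ t) ≈ factor x * up kind x (b ↓ (κ ℕ.+ lo)) len t
      total  : ∀ x y → factor x * run y (b ↓ (suc κ ℕ.+ hi)) e ≈ A x y

  private
    index : ∀ κ {q m} → 0 ℕ.< q → q ≡ m → b (suc κ ℕ.+ (q ∸ 1)) ≡ b (κ ℕ.+ m)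
    index κ {suc q} _ ≡.refl = ≡.cong b (≡.sym (ℕ.+-suc κ q))

  -- If `v` is at least `p`, the row below forces `q` to be at least `v`, so the first `d` new boxes
  -- carry `x`; their run goes into γ. If `v` is less than `p`, there is no constraint from below
  -- and the factor ⟨ y ⟩ is common to all summands.
  lower : ∀ κ p v → Lower κ p v
  lower κ p v with position p v in eq
  ... | below v<p = record
    { d = 0 ; kind = false ; factor = ⟨_⟩
    ; vanish = λ y q q<p p≤q → contradiction (≡.subst (q ℕ.<_) (ℕ.+-identityʳ p) q<p) (ℕ.≤⇒≯ p≤q)
    ; value = λ y t → trans (gap-below (suc κ) y (ℕ.<-≤-trans v<p (p≤ t)))
        (*-congˡ (reflexive (≡.cong ⟨_⟩ (≡.trans (index κ (ℕ.≤-<-trans z≤n (ℕ.<-≤-trans v<p (p≤ t))) ≡.refl)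
          (≡.cong b (≡.sym (ℕ.+-assoc κ (p ℕ.+ 0) t)))))))
    ; total = λ x y → trans (*-identityˡ _) (reflexive (≡.sym (≡.cong (γAt κ x y p) eq)))
    }
    where
    p≤ : ∀ t → p ℕ.≤ p ℕ.+ 0 ℕ.+ t
    p≤ t = ℕ.≤-trans (ℕ.m≤m+n p 0) (ℕ.m≤m+n _ t)
  ... | above d v≡p+d = record
    { d = d ; kind = true ; factor = λ _ → 1#
    ; vanish = λ y q q<v p≤q → gap-above (suc κ) y (≡.subst (q ℕ.<_) (≡.sym v≡p+d) q<v)
    ; value = λ
      { y zero → trans (gap-at (suc κ) y (≡.trans v≡p+d (≡.sym (ℕ.+-identityʳ _)))) (sym (*-identityʳ _))
      ; y (suc t) → trans (gap-below (suc κ) y (≡.subst (ℕ._< p ℕ.+ d ℕ.+ suc t) (≡.sym v≡p+d)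
        (ℕ.m<m+n (p ℕ.+ d) (s≤s z≤n))))
          (trans (*-congˡ (reflexive (≡.cong ⟨_⟩ (≡.trans
            (index κ (ℕ.≤-<-trans z≤n (ℕ.m<m+n (p ℕ.+ d) {suc t} (s≤s z≤n))) ≡.refl)
            (≡.cong b (≡.sym (ℕ.+-assoc κ (p ℕ.+ d) (suc t)))))))) (sym (*-identityˡ _)))
      }
    ; total = λ x y → trans (*-identityʳ _) (reflexive (≡.sym (≡.cong (γAt κ x y p) eq)))
    }

  -- If `s` is at least the old length `u` of the row above, then `q` stops at `u` and the last `e`
  -- boxes carry `y`; their run goes into α. Otherwise `q` stays below `u`, and the gap of the row
  -- above is constant.
  upper-gap : ∀ κ u s → Upper κ s (λ x → gap (suc κ) x u) (λ x y → α κ x y u s)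
  upper-gap κ u s with position u s
  ... | below s<u = record
    { hi = s ; e = 0 ; s≡hi+e = ≡.sym (ℕ.+-identityʳ s) ; kind = false
    ; factor = λ x → ⟨ x ⟩ * ⟨ b (κ ℕ.+ u) ⟩
    ; vanish = λ x q s<q q≤s → contradiction s<q (ℕ.≤⇒≯ q≤s)
    ; value = λ x lo len t lo+len≡s t≤len → trans
        (gap-below (suc κ) x (ℕ.≤-<-trans (ℕ.≤-trans (ℕ.+-monoʳ-≤ lo t≤len) (ℕ.≤-reflexive lo+len≡s)) s<u))
        (trans (*-congˡ (reflexive (≡.cong ⟨_⟩ (index κ (ℕ.≤-<-trans z≤n s<u) ≡.refl)))) (sym (*-identityʳ _)))
    ; total = λ x y → *-identityʳ _
    }
  ... | above e s≡u+e = record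
    { hi = u ; e = e ; s≡hi+e = s≡u+e ; kind = true
    ; factor = λ x → 1#
    ; vanish = λ x q u<q q≤s → gap-above (suc κ) x u<q
    ; value = λ x lo len t lo+len≡u t≤len → trans (value x lo len t lo+len≡u (ℕ.m≤n⇒m<n∨m≡n t≤len))
      (sym (*-identityˡ _))
    ; total = λ x y → *-identityˡ _
    }
    where
    value : ∀ x lo len t → lo ℕ.+ len ≡ u → t ℕ.< len ⊎ t ≡ len →
      gap (suc κ) x u (lo ℕ.+ t) ≈ up true x (b ↓ (κ ℕ.+ lo)) len t
    value x lo len t lo+len≡u (inj₂ t≡len) = trans
      (gap-at (suc κ) x (≡.trans (≡.cong (lo ℕ.+_) t≡len) lo+len≡u)) (sym (if-yes (t ℕ.≟ len) t≡len))
    value x lo len t lo+len≡u (inj₁ t<len) = trans (gap-below (suc κ) x lo+t<u)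
      (trans (*-congˡ (reflexive (≡.cong ⟨_⟩ (≡.trans (index κ (ℕ.≤-<-trans z≤n lo+t<u) (≡.sym lo+len≡u))
        (≡.cong b (≡.sym (ℕ.+-assoc κ lo len))))))) (sym (if-no (t ℕ.≟ len) (ℕ.<⇒≢ t<len))))
      where
      lo+t<u : lo ℕ.+ t ℕ.< u
      lo+t<u = ≡.subst (lo ℕ.+ t ℕ.<_) lo+len≡u (ℕ.+-monoʳ-< lo t<len)

  upper-top : ∀ κ s → Upper κ s (λ _ _ → 1#) (λ _ _ → 1#)
  upper-top κ s = record
    { hi = s ; e = 0 ; s≡hi+e = ≡.sym (ℕ.+-identityʳ s) ; kind = false
    ; factor = λ x → 1#
    ; vanish = λ x q s<q q≤s → contradiction s<q (ℕ.≤⇒≯ q≤s)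
    ; value = λ _ _ _ _ _ _ → sym (*-identityʳ _)
    ; total = λ x y → *-identityʳ _
    }

  summand : ℕ → (Carrier → ℕ → Carrier) → Carrier → Carrier → ℕ → ℕ → ℕ → ℕ → Carrier
  summand κ φ x y p s v q = φ x q * row κ x p q * row (suc κ) y q s * gap (suc κ) y q v

  rowSum : ℕ → (Carrier → ℕ → Carrier) → Carrier → Carrier → ℕ → ℕ → ℕ → Carrier
  rowSum κ φ x y p s v = sumL (upTo (suc N)) (summand κ φ x y p s v)

  -- Cutting off the vanishing summands leaves a `core` on the window from `lo` to `hi`, and
  -- `core-comm` provides one `C` for both orders of the letters.
  rowSum-factors : ∀ κ φ A p s v x y → s ℕ.≤ N → Lower κ p v → Upper κ s φ A →
    ∃[ C ] rowSum κ φ x y p s v ≈ A x y * C * γ κ x y p v × rowSum κ φ y x p s v ≈ A y x * C * γ κ y x p v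
  rowSum-factors κ φ A p s v x y s≤N L U = helper (lo ℕ.≤? hi)
    where
    open Lower L using (d) renaming (kind to kindL; factor to g; vanish to vanishL; value to valueL; total
      to totalL)
    open Upper U using (hi; e; s≡hi+e) renaming (kind to kindU; factor to f; vanish to vanishU; value to
      valueU; total to totalU)
    lo = p ℕ.+ d
    cs = b ↓ (κ ℕ.+ lo)

    summand-below : ∀ x y q → q ℕ.< lo → summand κ φ x y p s v q ≈ 0#
    summand-below x y q q<lo with p ℕ.≤? q
    ... | no p≰q  = trans (*-congʳ (*-congʳ (*-congˡ ([]·-no (p ℕ.≤? q) p≰q))))
      (solve 3 (λ a b c → a :* con (+ 0) :* b :* c := con (+ 0)) refl _ _ _)
    ... | yes p≤q = trans (*-congˡ (vanishL y q q<lo p≤q)) (zeroʳ _)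

    summand-above : ∀ x y q → hi ℕ.< q → summand κ φ x y p s v q ≈ 0#
    summand-above x y q hi<q with q ℕ.≤? s
    ... | no q≰s  = trans (*-congʳ (*-congˡ ([]·-no (q ℕ.≤? s) q≰s))) (trans (*-congʳ (zeroʳ _)) (zeroˡ _))
    ... | yes q≤s = trans (*-congʳ (*-congʳ (*-congʳ (vanishU x q hi<q q≤s))))
      (solve 3 (λ a b c → con (+ 0) :* a :* b :* c := con (+ 0)) refl _ _ _)

    helper : Dec (lo ℕ.≤ hi) → ∃[ C ] rowSum κ φ x y p s v ≈ A x y * C * γ κ x y p v × rowSum κ φ y x p s v
      ≈ A y x * C * γ κ y x p v
    -- The window is empty: every `q` is below `lo` or above `hi`, so both sums vanish.
    helper (no lo≰hi) = 0# , zero′ x y , zero′ y x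
      where
      zero′ : ∀ x y → rowSum κ φ x y p s v ≈ A x y * 0# * γ κ x y p v
      zero′ x y = trans (sumL-0 (upTo (suc N)) λ q → vanish x y q (q ℕ.<? lo))
        (solve 2 (λ a b → con (+ 0) := a :* con (+ 0) :* b) refl _ _)
        where
        vanish : ∀ x y q → Dec (q ℕ.< lo) → summand κ φ x y p s v q ≈ 0#
        vanish x y q (yes q<lo) = summand-below x y q q<lo
        vanish x y q (no q≮lo)  = summand-above x y q (ℕ.<-≤-trans (ℕ.≰⇒> lo≰hi) (ℕ.≮⇒≥ q≮lo))
    helper (yes lo≤hi) = core kindL kindU x y cs len , factors x y ,
      trans (factors y x) (*-congʳ (*-congˡ (core-comm kindL kindU y x cs len)))
      where
      len = hi ∸ lo

      lo+len≡hi : lo ℕ.+ len ≡ hi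
      lo+len≡hi = ℕ.m+[n∸m]≡n lo≤hi

      row-p : ∀ x t → row κ x p (lo ℕ.+ t) ≈ run x (b ↓ (κ ℕ.+ p)) d * run x cs t
      row-p x t = begin
        row κ x p (lo ℕ.+ t)
          ≈⟨ []·-yes (p ℕ.≤? lo ℕ.+ t) (ℕ.≤-trans (ℕ.m≤m+n p d) (ℕ.m≤m+n lo t)) ⟩
        run x (b ↓ (κ ℕ.+ p)) (lo ℕ.+ t ∸ p)
          ≡⟨ ≡.cong (run x (b ↓ (κ ℕ.+ p))) (≡.trans (≡.cong (_∸ p) (ℕ.+-assoc p d t)) (ℕ.m+n∸m≡n p (d ℕ.+ t))) ⟩
        run x (b ↓ (κ ℕ.+ p)) (d ℕ.+ t)
          ≈⟨ run-+ x _ d t ⟩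
        run x (b ↓ (κ ℕ.+ p)) d * run x (b ↓ (κ ℕ.+ p) ↓ d) t
          ≈⟨ *-congˡ (run-cong x t λ j → ≡.cong b (≡.trans (≡.sym (ℕ.+-assoc (κ ℕ.+ p) d j))
            (≡.cong (ℕ._+ j) (ℕ.+-assoc κ p d)))) ⟩
        run x (b ↓ (κ ℕ.+ p)) d * run x cs t ∎

      remaining : ∀ t → t ℕ.≤ len → s ∸ (lo ℕ.+ t) ≡ (len ∸ t) ℕ.+ e
      remaining t t≤len = ≡.trans (≡.cong (_∸ (lo ℕ.+ t)) (≡.trans s≡hi+e
        (≡.trans (≡.cong (ℕ._+ e) (≡.sym lo+len≡hi)) (ℕ.+-assoc lo len e))))
        (≡.trans (ℕ.[m+n]∸[m+o]≡n∸o lo (len ℕ.+ e) t) (ℕ.+-∸-comm e t≤len))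

      row-s : ∀ y t → t ℕ.≤ len → row (suc κ) y (lo ℕ.+ t) s ≈ run y (cs ↓ suc t) (len ∸ t) * run y
        (b ↓ (suc κ ℕ.+ hi)) e
      row-s y t t≤len = begin
        row (suc κ) y (lo ℕ.+ t) s
          ≈⟨ []·-yes (lo ℕ.+ t ℕ.≤? s) (ℕ.≤-trans (ℕ.+-monoʳ-≤ lo t≤len)
            (ℕ.≤-trans (ℕ.≤-reflexive lo+len≡hi) (ℕ.≤-trans (ℕ.m≤m+n hi e) (ℕ.≤-reflexive (≡.sym s≡hi+e))))) ⟩
        run y (b ↓ (suc κ ℕ.+ (lo ℕ.+ t))) (s ∸ (lo ℕ.+ t))
          ≡⟨ ≡.cong (run y _) (remaining t t≤len) ⟩
        run y (b ↓ (suc κ ℕ.+ (lo ℕ.+ t))) ((len ∸ t) ℕ.+ e)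
          ≈⟨ run-+ y _ (len ∸ t) e ⟩
        run y (b ↓ (suc κ ℕ.+ (lo ℕ.+ t))) (len ∸ t) * run y (b ↓ (suc κ ℕ.+ (lo ℕ.+ t)) ↓ (len ∸ t)) e
          ≈⟨ *-cong (run-cong y (len ∸ t) λ j → ≡.cong b (index₁ j)) (run-cong y e λ j → ≡.cong b (index₂ j)) ⟩
        run y (cs ↓ suc t) (len ∸ t) * run y (b ↓ (suc κ ℕ.+ hi)) e ∎
        where
        index₁ : ∀ j → suc κ ℕ.+ (lo ℕ.+ t) ℕ.+ j ≡ κ ℕ.+ lo ℕ.+ (suc t ℕ.+ j)
        index₁ j = ≡.trans (≡.cong (λ k → suc k ℕ.+ j) (≡.sym (ℕ.+-assoc κ lo t)))
          (≡.trans (≡.cong suc (ℕ.+-assoc (κ ℕ.+ lo) t j)) (≡.sym (ℕ.+-suc (κ ℕ.+ lo) (t ℕ.+ j))))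
        index₂ : ∀ j → suc κ ℕ.+ (lo ℕ.+ t) ℕ.+ ((len ∸ t) ℕ.+ j) ≡ suc κ ℕ.+ hi ℕ.+ j
        index₂ j = ≡.trans (≡.sym (ℕ.+-assoc (suc κ ℕ.+ (lo ℕ.+ t)) (len ∸ t) j)) (≡.cong (ℕ._+ j)
          (≡.trans (ℕ.+-assoc (suc κ) (lo ℕ.+ t) (len ∸ t)) (≡.cong (suc κ ℕ.+_)
            (≡.trans (ℕ.+-assoc lo t (len ∸ t)) (≡.trans (≡.cong (lo ℕ.+_) (ℕ.m+[n∸m]≡n t≤len)) lo+len≡hi)))))

      factors : ∀ x y → rowSum κ φ x y p s v ≈ A x y * core kindL kindU x y cs len * γ κ x y p v
      factors x y = begin
        rowSum κ φ x y p s v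
          ≈⟨ sumL-upTo N _ ⟩
        sumTo N (summand κ φ x y p s v)
          ≈⟨ sumTo-window lo len N (ℕ.≤-trans (ℕ.≤-reflexive lo+len≡hi) (ℕ.≤-trans (ℕ.m≤m+n hi e)
            (ℕ.≤-trans (ℕ.≤-reflexive (≡.sym s≡hi+e)) s≤N)))
               (summand-below x y) (λ q hi<q → summand-above x y q (≡.subst (ℕ._< q) lo+len≡hi hi<q)) ⟩
        sumTo len (λ t → summand κ φ x y p s v (lo ℕ.+ t))
          ≈⟨ sumTo-cong len (λ t t≤len → trans
               (*-cong (*-cong (*-cong (valueU x lo len t lo+len≡hi t≤len) (row-p x t)) (row-s y t t≤len))
                 (valueL y t))
               (solve 8 (λ f u r a b r′ g l → f :* u :* (r :* a) :* (b :* r′) :* (g :* l) := f :* r′ :*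
                 (r :* g) :* (a :* b :* l :* u)) refl _ _ _ _ _ _ _ _)) ⟩
        sumTo len (λ t → f x * run y (b ↓ (suc κ ℕ.+ hi)) e * (run x (b ↓ (κ ℕ.+ p)) d * g y) *
          (term x y cs len t * low kindL y cs t * up kindU x cs len t))
          ≈⟨ *-sumTo _ len _ ⟨
        f x * run y (b ↓ (suc κ ℕ.+ hi)) e * (run x (b ↓ (κ ℕ.+ p)) d * g y) * core kindL kindU x y cs len
          ≈⟨ *-congʳ (*-cong (totalU x y) (totalL x y)) ⟩
        A x y * γ κ x y p v * core kindL kindU x y cs len
          ≈⟨ solve 3 (λ a g c → a :* g :* c := a :* c :* g) refl _ _ _ ⟩
        A x y * core kindL kindU x y cs len * γ κ x y p v ∎

  families : ∀ h → List (Fin h → ℕ)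
  families h = allFamilies λ _ → upTo (suc N)

  sumF : ∀ h → ((Fin h → ℕ) → Carrier) → Carrier
  sumF h = sumL (families h)

  step : ℕ → Carrier → ∀ h → (Fin h → ℕ) → (Fin h → ℕ) → Carrier
  step r x zero    p q = 1#
  step r x (suc h) p q = row (h ℕ.+ r) x (p zero) (q zero) * gap (h ℕ.+ r) x (p zero) (next (q ∘ suc)) *
    step r x h (p ∘ suc) (q ∘ suc)

  -- `φ` stands for the gap of the row above, which depends on the middle length of the first row
  -- summed over. With it as a parameter the sum splits off its top row and keeps its form.
  twoSteps : (Carrier → ℕ → Carrier) → ℕ → ∀ h → Carrier → Carrier → (Fin h → ℕ) → (Fin h → ℕ) → Carrier
  twoSteps φ r h x y p s = sumF h λ q → φ x (next q) * step r x h p q * step (suc r) y h q s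

  twoSteps-suc : ∀ φ r h x y p s → twoSteps φ r (suc h) x y p s ≈
    rowSum (h ℕ.+ r) φ x y (p zero) (s zero) (next (s ∘ suc)) *
      twoSteps (λ x → gap (h ℕ.+ r) x (p zero)) r h x y (p ∘ suc) (s ∘ suc)
  twoSteps-suc φ r h x y p s = begin
    twoSteps φ r (suc h) x y p s
      ≈⟨ sumL-product _ (upTo (suc N)) (families h) (λ q → φ x (next q) * step r x (suc h) p q * step
        (suc r) y (suc h) q s) ⟩
    sumL (upTo (suc N)) (λ q₀ → sumF h λ q →
      φ x q₀ * (row κ x p₀ q₀ * gap κ x p₀ (next q) * step r x h (p ∘ suc) q) *
      (row (h ℕ.+ suc r) y q₀ (s zero) * gap (h ℕ.+ suc r) y q₀ v * step (suc r) y h q (s ∘ suc)))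
      ≈⟨ sumL-cong (upTo (suc N)) (λ q₀ → trans (sumL-cong (families h) (λ q →
           trans (reflexive (≡.cong (λ k → φ x q₀ * (row κ x p₀ q₀ * gap κ x p₀ (next q) * step r x h (p ∘ suc) q) *
              (row k y q₀ (s zero) * gap k y q₀ v * step (suc r) y h q (s ∘ suc))) (ℕ.+-suc h r)))
             (solve 7 (λ f a g b c d e → f :* (a :* g :* b) :* (c :* d :* e) := f :* a :* c :* d :*
               (g :* b :* e)) refl _ _ _ _ _ _ _)))
           (sym (*-sumL _ (families h) _))) ⟩
    sumL (upTo (suc N)) (λ q₀ → summand κ φ x y p₀ (s zero) v q₀ * twoSteps (λ x → gap κ x p₀) r h x y
      (p ∘ suc) (s ∘ suc))
      ≈⟨ sumL-* (upTo (suc N)) _ _ ⟨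
    rowSum κ φ x y p₀ (s zero) v * twoSteps (λ x → gap κ x p₀) r h x y (p ∘ suc) (s ∘ suc) ∎
    where
    κ = h ℕ.+ r
    p₀ = p zero
    v = next (s ∘ suc)

  -- The sum over the remaining rows is symmetric only together with the γ left over by the row
  -- above. In the induction that γ is absorbed by the α of the present row, whose own γ is passed
  -- on to the rows below.
  twoSteps-comm : ∀ h r x y u p s → (∀ i → s i ℕ.≤ N) →
    γ (h ℕ.+ r) x y u (next s) * twoSteps (λ x → gap (h ℕ.+ r) x u) r h x y p s ≈
    γ (h ℕ.+ r) y x u (next s) * twoSteps (λ x → gap (h ℕ.+ r) x u) r h y x p s
  twoSteps-comm zero r x y u p s s≤N = trans (only x y) (trans (γ-gap-comm r x y u 0) (sym (only y x)))
    where
    only : ∀ x y → γ r x y u 0 * (gap r x u 0 * 1# * 1# + 0#) ≈ γ r x y u 0 * gap r x u 0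
    only x y = solve 2 (λ a b → a :* (b :* con (+ 1) :* con (+ 1) :+ con (+ 0)) := a :* b) refl _ _
  twoSteps-comm (suc h) r x y u p s s≤N = begin
    γ (suc κ) x y u s₀ * twoSteps φ r (suc h) x y p s
      ≈⟨ expand x y (proj₁ (proj₂ factors)) ⟩
    α κ x y u s₀ * γ (suc κ) x y u s₀ * C * (γ κ x y p₀ v * rest x y)
      ≈⟨ *-cong (*-congʳ (αγ-comm κ x y u s₀)) (twoSteps-comm h r x y p₀ (p ∘ suc) (s ∘ suc) (s≤N ∘ suc)) ⟩
    α κ y x u s₀ * γ (suc κ) y x u s₀ * C * (γ κ y x p₀ v * rest y x)
      ≈⟨ expand y x (proj₂ (proj₂ factors)) ⟨
    γ (suc κ) y x u s₀ * twoSteps φ r (suc h) y x p s ∎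
    where
    κ = h ℕ.+ r
    p₀ = p zero
    s₀ = s zero
    v = next (s ∘ suc)
    φ = λ x → gap (suc κ) x u
    rest : Carrier → Carrier → Carrier
    rest x y = twoSteps (λ x → gap κ x p₀) r h x y (p ∘ suc) (s ∘ suc)
    factors = rowSum-factors κ φ (λ x y → α κ x y u s₀) p₀ s₀ v x y (s≤N zero) (lower κ p₀ v) (upper-gap κ u s₀)
    C = proj₁ factors

    expand : ∀ x y → rowSum κ φ x y p₀ s₀ v ≈ α κ x y u s₀ * C * γ κ x y p₀ v →
      γ (suc κ) x y u s₀ * twoSteps φ r (suc h) x y p s ≈ α κ x y u s₀ * γ (suc κ) x y u s₀ * C *
        (γ κ x y p₀ v * rest x y)
    expand x y eq = trans (*-congˡ (trans (twoSteps-suc φ r h x y p s) (*-congʳ eq)))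
      (solve 5 (λ g a c g′ r → g :* (a :* c :* g′ :* r) := a :* g :* c :* (g′ :* r)) refl _ _ _ _ _)

  twoSteps-top-comm : ∀ h r x y p s → (∀ i → s i ℕ.≤ N) →
    twoSteps (λ _ _ → 1#) r h x y p s ≈ twoSteps (λ _ _ → 1#) r h y x p s
  twoSteps-top-comm zero    r x y p s s≤N = refl
  twoSteps-top-comm (suc h) r x y p s s≤N = begin
    twoSteps φ r (suc h) x y p s                 ≈⟨ expand x y (proj₁ (proj₂ factors)) ⟩
    C * (γ κ x y p₀ v * rest x y)                ≈⟨ *-congˡ (twoSteps-comm h r x y p₀ (p ∘ suc) (s ∘ suc)
      (s≤N ∘ suc)) ⟩
    C * (γ κ y x p₀ v * rest y x)                ≈⟨ expand y x (proj₂ (proj₂ factors)) ⟨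
    twoSteps φ r (suc h) y x p s                 ∎
    where
    κ = h ℕ.+ r
    p₀ = p zero
    v = next (s ∘ suc)
    φ : Carrier → ℕ → Carrier
    φ = λ _ _ → 1#
    rest : Carrier → Carrier → Carrier
    rest x y = twoSteps (λ x → gap κ x p₀) r h x y (p ∘ suc) (s ∘ suc)
    factors = rowSum-factors κ φ (λ _ _ → 1#) p₀ (s zero) v x y (s≤N zero) (lower κ p₀ v) (upper-top κ (s zero))
    C = proj₁ factors

    expand : ∀ x y → rowSum κ φ x y p₀ (s zero) v ≈ 1# * C * γ κ x y p₀ v →
      twoSteps φ r (suc h) x y p s ≈ C * (γ κ x y p₀ v * rest x y)
    expand x y eq = trans (twoSteps-suc φ r h x y p s) (trans (*-congʳ eq)
      (solve 3 (λ c g r → con (+ 1) :* c :* g :* r := c :* (g :* r)) refl _ _ _))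

  module _ {h : ℕ} (E : (Fin h → ℕ) → Carrier) where
    chainSum : ℕ → List Carrier → (Fin h → ℕ) → Carrier
    chainSum r []       p = E p
    chainSum r (x ∷ xs) p = sumF h λ q → step r x h p q * chainSum (suc r) xs q

    chainSum-two : ∀ r x y xs p → chainSum r (x ∷ y ∷ xs) p ≈
      sumF h λ s → twoSteps (λ _ _ → 1#) r h x y p s * chainSum (suc (suc r)) xs s
    chainSum-two r x y xs p = begin
      sumF h (λ q → step r x h p q * sumF h (λ s → step (suc r) y h q s * chainSum (suc (suc r)) xs s))
        ≈⟨ sumL-cong (families h) (λ q → trans (*-sumL _ (families h) _) (sumL-cong (families h) λ s →
             solve 3 (λ a b c → a :* (b :* c) := con (+ 1) :* a :* b :* c) refl _ _ _)) ⟩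
      sumF h (λ q → sumF h (λ s → 1# * step r x h p q * step (suc r) y h q s * chainSum (suc (suc r)) xs s))
        ≈⟨ sumL-swap (families h) (families h) _ ⟩
      sumF h (λ s → sumF h (λ q → 1# * step r x h p q * step (suc r) y h q s * chainSum (suc (suc r)) xs s))
        ≈⟨ sumL-cong (families h) (λ s → sumL-* (families h) _ _) ⟨
      sumF h (λ s → twoSteps (λ _ _ → 1#) r h x y p s * chainSum (suc (suc r)) xs s) ∎

    -- An exchange of adjacent letters affects only the shape between their two steps.
    chainSum-↭ : ∀ {xs ys} → xs ↭ ys → ∀ r p → chainSum r xs p ≈ chainSum r ys p
    chainSum-↭ ↭.refl r p = refl
    chainSum-↭ (↭.prep x eq) r p = sumL-cong (families h) λ q → *-congˡ (chainSum-↭ eq (suc r) q)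
    chainSum-↭ (↭.swap {xs} {ys} x y eq) r p = begin
      chainSum r (x ∷ y ∷ xs) p
        ≈⟨ chainSum-two r x y xs p ⟩
      sumF h (λ s → twoSteps (λ _ _ → 1#) r h x y p s * chainSum (suc (suc r)) xs s)
        -- The bound `N` on the lengths of `s` ensures that the window of every row lies within the
        -- range of summation.
        ≈⟨ sumL-cong-All (allFamilies-all λ _ → upTo-≤ N)
             (λ s s≤N → *-cong (twoSteps-top-comm h r x y p s s≤N) (chainSum-↭ eq (suc (suc r)) s)) ⟩
      sumF h (λ s → twoSteps (λ _ _ → 1#) r h y x p s * chainSum (suc (suc r)) ys s)
        ≈⟨ chainSum-two r y x ys p ⟨
      chainSum r (y ∷ x ∷ ys) p ∎
    chainSum-↭ (↭.trans eq eq′) r p = trans (chainSum-↭ eq r p) (chainSum-↭ eq′ r p)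

-- Set-valued tableaux and marked Gelfand-Tsetlin patterns

prefix : ∀ {L} {Q : Fin L → Set} → (∀ j → Dec (Q j)) → ℕ
prefix {zero}  Q? = 0
prefix {suc L} Q? = if does (Q? zero) then suc (prefix (Q? ∘ suc)) else 0

prefix-≤ : ∀ {L} {Q : Fin L → Set} (Q? : ∀ j → Dec (Q j)) → prefix Q? ℕ.≤ L
prefix-≤ {zero}  Q? = z≤n
prefix-≤ {suc L} Q? with Q? zero
... | yes _ = s≤s (prefix-≤ (Q? ∘ suc))
... | no _  = z≤n

prefix-⇒ : ∀ {L} {Q : Fin L → Set} (Q? : ∀ j → Dec (Q j)) j → toℕ j ℕ.< prefix Q? → Q j
prefix-⇒ {suc L} Q? j j<p with Q? zero
prefix-⇒ {suc L} Q? zero    _         | yes q = q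
prefix-⇒ {suc L} Q? (suc j) (s≤s j<p) | yes _ = prefix-⇒ (Q? ∘ suc) j j<p

prefix-⇐ : ∀ {L} {Q : Fin L → Set} (Q? : ∀ j → Dec (Q j)) →
  (∀ j j′ → toℕ j′ ≡ suc (toℕ j) → Q j′ → Q j) → ∀ j → Q j → toℕ j ℕ.< prefix Q?
prefix-⇐ {suc L} Q? closed j q with Q? zero
... | no ¬q₀ = contradiction (first closed j q) ¬q₀
  where
  first : ∀ {L} {Q : Fin (suc L) → Set} → (∀ j j′ → toℕ j′ ≡ suc (toℕ j) → Q j′ → Q j) → ∀ j → Q j → Q zero
  first closed zero q = q
  first {suc L} closed (suc j) q = closed zero (suc zero) ≡.refl
    (first (λ i i′ eq → closed (suc i) (suc i′) (≡.cong suc eq)) j q)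
prefix-⇐ {suc L} Q? closed zero    q | yes _ = s≤s z≤n
prefix-⇐ {suc L} Q? closed (suc j) q | yes _ =
  s≤s (prefix-⇐ (Q? ∘ suc) (λ i i′ eq → closed (suc i) (suc i′) (≡.cong suc eq)) j q)

prefix-unique : ∀ {L} {Q : Fin L → Set} (Q? : ∀ j → Dec (Q j)) S → S ℕ.≤ L →
  (∀ j → toℕ j ℕ.< S → Q j) → (∀ j → Q j → toℕ j ℕ.< S) → prefix Q? ≡ S
prefix-unique {zero}  Q? zero _ to from = ≡.refl
prefix-unique {suc L} Q? S S≤L to from with Q? zero
prefix-unique {suc L} Q? zero    S≤L to from | yes q = contradiction (from zero q) λ ()
prefix-unique {suc L} Q? zero    S≤L to from | no _  = ≡.refl
prefix-unique {suc L} Q? (suc S) S≤L to from | no ¬q = contradiction (to zero (s≤s z≤n)) ¬q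
prefix-unique {suc L} Q? (suc S) (s≤s S≤L) to from | yes _ = ≡.cong suc
  (prefix-unique (Q? ∘ suc) S S≤L (λ j j<S → to (suc j) (s≤s j<S)) (λ j q → ℕ.≤-pred (from (suc j) q)))

-- The value in the following row and 0 after the last row, in the recursive form in which `step`
-- uses it.
after : ∀ {h} → (Fin h → ℕ) → Fin h → ℕ
after f zero    = next (f ∘ suc)
after f (suc i) = after (f ∘ suc) i

after-next : ∀ {h} (f : Fin h → ℕ) i i′ → toℕ i′ ≡ suc (toℕ i) → after f i ≡ f i′
after-next f zero    (suc zero) _  = ≡.refl
after-next f (suc i) (suc i′)   eq = after-next (f ∘ suc) i i′ (ℕ.suc-injective eq)

after-cases : ∀ {h} (i : Fin h) → (Σ[ i′ ∈ Fin h ] toℕ i′ ≡ suc (toℕ i)) ⊎ (∀ f → after f i ≡ 0)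
after-cases {suc zero}    zero    = inj₂ λ _ → ≡.refl
after-cases {suc (suc h)} zero    = inj₁ (suc zero , ≡.refl)
after-cases {suc h}       (suc i) with after-cases i
... | inj₁ (i′ , eq) = inj₁ (suc i′ , ≡.cong suc eq)
... | inj₂ last      = inj₂ λ f → last (f ∘ suc)

-- The states p = λ⁽⁰⁾, λ⁽¹⁾, …, continued by its last member.
states : ∀ {n h} → (Fin h → ℕ) → (Fin n → Fin h → ℕ) → ℕ → Fin h → ℕ
states p P zero = p
states {zero}  p P (suc k) = p
states {suc n} p P (suc k) = states (P zero) (P ∘ suc) k

states-suc : ∀ {n h} (p : Fin h → ℕ) P (r : Fin n) → states p P (suc (toℕ r)) ≡ P r
states-suc p P zero    = ≡.refl
states-suc p P (suc r) = states-suc (P zero) (P ∘ suc) r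

states-agree : ∀ {n h} {p : Fin h → ℕ} {P : Fin n → Fin h → ℕ} {f : ℕ → Fin h → ℕ} → (∀ i → p i ≡ f 0 i) →
  (∀ (r : Fin n) i → P r i ≡ f (suc (toℕ r)) i) → ∀ k i → k ℕ.≤ n → states p P k i ≡ f k i
states-agree eq₀ eqs zero    i _         = eq₀ i
states-agree {f = f} eq₀ eqs (suc k) i (s≤s k≤n) = states-agree {f = f ∘ suc} (eqs zero) (eqs ∘ suc) k i k≤n

states-step : ∀ {n h} (p : Fin h → ℕ) (P : Fin n → Fin h → ℕ) i →
  (∀ (r : Fin n) → states p P (toℕ r) i ℕ.≤ states p P (suc (toℕ r)) i) → ∀ k → states p P k i ℕ.≤ states p
    P (suc k) i
states-step {zero}  p P i le zero    = ℕ.≤-refl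
states-step {zero}  p P i le (suc k) = ℕ.≤-refl
states-step {suc n} p P i le zero    = le zero
states-step {suc n} p P i le (suc k) = states-step (P zero) (P ∘ suc) i (le ∘ suc) k

lookup-decreasing : ∀ {parts} → Linked ℕ._≥_ parts → ∀ i i′ → toℕ i′ ≡ suc (toℕ i) →
  List.lookup parts i′ ℕ.≤ List.lookup parts i
lookup-decreasing (x≥y ∷ _) zero    (suc zero) _  = x≥y
lookup-decreasing (_ ∷ l)   (suc i) (suc i′)   eq = lookup-decreasing l i i′ (ℕ.suc-injective eq)
lookup-decreasing [-]       zero    (suc ())   _

module TableauxAndPatterns (n : ℕ) (μ : Partition) where
  open Partition μ
  open SetValuedTableaux n μ

  -- A Gelfand–Tsetlin pattern P, in which P r i is the number of boxes in row i with an entry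
  -- at most r, and marks e r i, which say that r is an entry of the last box with a smaller entry.
  Pattern : Set
  Pattern = (Fin n → Fin numParts → ℕ) × (Fin n → Fin numParts → Bool)

  bit : Bool → ℕ
  bit e = if e then 1 else 0

  state : Pattern → ℕ → Fin numParts → ℕ
  state (P , e) = states (λ _ → 0) P

  -- `interlaced` expresses column-strictness. A box of row i + 1 with an entry at most r lies below
  -- a box with a smaller entry than r; the additional bit says that a box which receives r by a
  -- mark has no such box below it.
  record Valid (y : Pattern) : Set where
    field
      final      : ∀ i → state y n i ≡ rowLength i
      increasing : ∀ (r : Fin n) i → state y (toℕ r) i ℕ.≤ state y (suc (toℕ r)) i
      interlaced : ∀ (r : Fin n) i → after (state y (suc (toℕ r))) i ℕ.+ bit (proj₂ y r i) ℕ.≤ state y (toℕ r) i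

    state-step : ∀ i k → state y k i ℕ.≤ state y (suc k) i
    state-step i = states-step {n} (λ _ → 0) (proj₁ y) i (λ r → increasing r i)

    state-mono : ∀ i {k m} → k ℕ.≤ m → state y k i ℕ.≤ state y m i
    state-mono i {k} {m} k≤m with ℕ.m≤n⇒∃[o]m+o≡n k≤m
    ... | o , ≡.refl = go o
      where
      go : ∀ o → state y k i ℕ.≤ state y (k ℕ.+ o) i
      go zero    = ℕ.≤-reflexive (≡.cong (λ m → state y m i) (≡.sym (ℕ.+-identityʳ k)))
      go (suc o) = ℕ.≤-trans (go o) (ℕ.≤-trans (state-step i (k ℕ.+ o))
        (ℕ.≤-reflexive (≡.cong (λ m → state y m i) (≡.sym (ℕ.+-suc k o)))))

    state-≤ : ∀ i k → k ℕ.≤ n → state y k i ℕ.≤ rowLength i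
    state-≤ i k k≤n = ℕ.≤-trans (state-mono i k≤n) (ℕ.≤-reflexive (final i))

  valid? : ∀ y → Dec (Valid y)
  valid? y = map′ (λ (f , i , l) → record { final = f ; increasing = i ; interlaced = l })
    (λ v → Valid.final v , Valid.increasing v , Valid.interlaced v)
    (Fin.all? (λ i → _ ℕ.≟ _) ×-dec Fin.all? (λ r → Fin.all? λ i → _ ℕ.≤? _) ×-dec Fin.all? (λ r → Fin.all?
      λ i → _ ℕ.≤? _))

  In : Pattern → Fin numParts → ℕ → Fin n → Set
  In y i j r = (state y (toℕ r) i ℕ.≤ j × j ℕ.< state y (suc (toℕ r)) i) ⊎
               (proj₂ y r i ≡ true × suc j ≡ state y (toℕ r) i)

  in? : ∀ y i j r → Dec (In y i j r)
  in? y i j r = (_ ℕ.≤? _ ×-dec _ ℕ.<? _) ⊎-dec (proj₂ y r i Bool.≟ true ×-dec _ ℕ.≟ _)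

  -- A relation in place of a bijection, because fillings and patterns are functions and only
  -- determine each other pointwise. The weighted sums are later compared through the matching
  -- pairs.
  record Matches (T : Filling) (y : Pattern) : Set where
    field
      valid : Valid y
      to    : ∀ i j r → r ∈ₛ T i j → In y i (toℕ j) r
      from  : ∀ i j r → In y i (toℕ j) r → r ∈ₛ T i j

  decode : Pattern → Filling
  decode y i j = Vec.tabulate λ r → does (in? y i (toℕ j) r)

  decode-matches : ∀ {y} → Valid y → ∀ {T} → (∀ i j → T i j ≡ decode y i j) → Matches T y
  decode-matches {y} v {T} eq = record
    { valid = v
    ; to   = λ i j r r∈ → to (in? y i (toℕ j) r) (≡.trans (≡.sym (at i j r)) (Vec.[]=⇒lookup r∈))
    ; from = λ i j r inn → Vec.lookup⇒[]= r (T i j) (≡.trans (at i j r) (from (in? y i (toℕ j) r) inn))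
    }
    where
    at : ∀ i j r → Vec.lookup (T i j) r ≡ does (in? y i (toℕ j) r)
    at i j r = ≡.trans (≡.cong (λ S → Vec.lookup S r) (eq i j)) (Vec.lookup∘tabulate _ r)
    to : ∀ {P : Set} (d : Dec P) → does d ≡ true → P
    to (yes p) _ = p
    from : ∀ {P : Set} (d : Dec P) → P → does d ≡ true
    from (yes _) _ = ≡.refl
    from (no ¬p) p = contradiction p ¬p

  matches-decode : ∀ {T y} → Matches T y → ∀ i j → T i j ≡ decode y i j
  matches-decode {T} {y} m i j = ≡.trans (≡.sym (Vec.tabulate∘lookup (T i j))) (Vec.tabulate-cong λ r → at r
    (in? y i (toℕ j) r))
    where
    open Matches m
    at : ∀ r → (d : Dec (In y i (toℕ j) r)) → Vec.lookup (T i j) r ≡ does d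
    at r (yes inn) = Vec.[]=⇒lookup (from i j r inn)
    at r (no ¬in)  with Vec.lookup (T i j) r in eq
    ... | true  = contradiction (to i j r (Vec.lookup⇒[]= r (T i j) eq)) ¬in
    ... | false = ≡.refl

  module _ {T : Filling} {y : Pattern} (m : Matches T y) where
    open Matches m
    open Valid valid

    in-< : ∀ {i j r} → In y i j r → j ℕ.< state y (suc (toℕ r)) i
    in-< (inj₁ (_ , j<)) = j<
    in-< {i} {j} {r} (inj₂ (_ , eq)) = ℕ.≤-trans (ℕ.≤-reflexive eq) (increasing r i)

    in-≥ : ∀ {i j r} → In y i j r → state y (toℕ r) i ℕ.≤ suc j
    in-≥ (inj₁ (≤j , _)) = ℕ.m≤n⇒m≤1+n ≤j
    in-≥ (inj₂ (_ , eq)) = ℕ.≤-reflexive (≡.sym eq)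

    occupied : ∀ i j k → k ℕ.≤ n → j ℕ.< state y k i → Σ[ r ∈ Fin n ] toℕ r ℕ.< k × state y (toℕ r) i ℕ.≤ j
      × j ℕ.< state y (suc (toℕ r)) i
    occupied i j (suc k) k<n j< with j ℕ.<? state y k i
    ... | yes j<k = let (r , r<k , rest) = occupied i j k (ℕ.<⇒≤ k<n) j<k in r , ℕ.m<n⇒m<1+n r<k , rest
    ... | no j≮k  = Fin.fromℕ< k<n , s≤s (ℕ.≤-reflexive eq) ,
      ℕ.≤-trans (ℕ.≤-reflexive (≡.cong (λ k → state y k i) eq)) (ℕ.≮⇒≥ j≮k) ,
      ℕ.≤-trans j< (ℕ.≤-reflexive (≡.cong (λ k → state y (suc k) i) (≡.sym eq)))
      where eq = Fin.toℕ-fromℕ< k<n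

    matches⇒tableau : IsTableau T
    matches⇒tableau = nonempty , weak , strict
      where
      nonempty : ∀ i j → Nonempty (T i j)
      nonempty i j with occupied i (toℕ j) n ℕ.≤-refl (≡.subst (toℕ j ℕ.<_) (≡.sym (final i)) (Fin.toℕ<n j))
      ... | r , _ , ≤j , j< = r , from i j r (inj₁ (≤j , j<))

      weak : ∀ i j j′ → toℕ j′ ≡ suc (toℕ j) → T i j ≼ T i j′
      weak i j j′ eq r s r∈ s∈ = ℕ.≮⇒≥ λ s<r → ℕ.<-irrefl ≡.refl (begin-strict
        suc (toℕ j)                  ≡⟨ eq ⟨
        toℕ j′                       <⟨ in-< (to i j′ s s∈) ⟩
        state y (suc (toℕ s)) i      ≤⟨ state-mono i s<r ⟩
        state y (toℕ r) i            ≤⟨ in-≥ (to i j r r∈) ⟩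
        suc (toℕ j)                  ∎)
        where open ℕ.≤-Reasoning

      strict : ∀ i i′ j j′ → toℕ i′ ≡ suc (toℕ i) → toℕ j ≡ toℕ j′ → T i j ≺ T i′ j′
      strict i i′ j j′ eq j≡j′ r s r∈ s∈ = ℕ.≰⇒> λ s≤r → absurd (to i j r r∈) (j< s≤r)
        where
        -- If `s` were at most `r`, the box below would be filled by step `s`, and interlacing would
        -- put row `i` beyond box `j` before step `r`, by one box more if `r` is a mark. Neither way
        -- for `r` to be in box `j` allows this.
        j< : toℕ s ℕ.≤ toℕ r → toℕ j ℕ.+ bit (proj₂ y r i) ℕ.< state y (toℕ r) i
        j< s≤r = begin-strict
          toℕ j ℕ.+ bit (proj₂ y r i)                                ≡⟨ ≡.cong (ℕ._+ bit (proj₂ y r i)) j≡j′ ⟩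
          toℕ j′ ℕ.+ bit (proj₂ y r i)                               <⟨ ℕ.+-monoˡ-< (bit (proj₂ y r i))
            (in-< (to i′ j′ s s∈)) ⟩
          state y (suc (toℕ s)) i′ ℕ.+ bit (proj₂ y r i)             ≤⟨ ℕ.+-monoˡ-≤ (bit (proj₂ y r i))
            (state-mono i′ (s≤s s≤r)) ⟩
          state y (suc (toℕ r)) i′ ℕ.+ bit (proj₂ y r i)             ≡⟨ ≡.cong (ℕ._+ bit (proj₂ y r i))
            (after-next (state y (suc (toℕ r))) i i′ eq) ⟨
          after (state y (suc (toℕ r))) i ℕ.+ bit (proj₂ y r i)      ≤⟨ interlaced r i ⟩
          state y (toℕ r) i                                          ∎
          where open ℕ.≤-Reasoning
        absurd : In y i (toℕ j) r → ¬ (toℕ j ℕ.+ bit (proj₂ y r i) ℕ.< state y (toℕ r) i)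
        absurd (inj₁ (≤j , _)) lt = ℕ.<⇒≱ (ℕ.≤-<-trans (ℕ.m≤m+n _ _) lt) ≤j
        absurd (inj₂ (e , eq)) lt rewrite e = ℕ.<⇒≱ lt (ℕ.≤-reflexive (≡.trans (≡.sym eq) (ℕ.+-comm 1 (toℕ j))))

  Occupied : Filling → ℕ → ∀ i → Fin (rowLength i) → Set
  Occupied T k i j = ∃[ s ] s ∈ₛ T i j × toℕ s ℕ.< k

  occupied? : ∀ T k i j → Dec (Occupied T k i j)
  occupied? T k i j = Fin.any? λ s → (s ∈ₛ? T i j) ×-dec (toℕ s ℕ.<? k)

  -- Taking an initial segment makes this, and `encode`, meaningful for every filling. In a tableau
  -- the boxes with an entry below `k` form such a segment of the row, by weak increase, so all of
  -- them are counted.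
  occupancy : Filling → ℕ → Fin numParts → ℕ
  occupancy T k i = prefix (occupied? T k i)

  mark? : ∀ T r i → Dec (∃[ j ] suc (toℕ j) ≡ occupancy T (toℕ r) i × r ∈ₛ T i j)
  mark? T r i = Fin.any? λ j → (_ ℕ.≟ _) ×-dec (r ∈ₛ? T i j)

  encode : Filling → Pattern
  encode T = (λ r i → occupancy T (suc (toℕ r)) i) , λ r i → does (mark? T r i)

  infix 4 _≗_
  _≗_ : Pattern → Pattern → Set
  (P , e) ≗ (P′ , e′) = (∀ r i → P r i ≡ P′ r i) × (∀ r i → e r i ≡ e′ r i)

  private
    does≡true : ∀ {P : Set} (d : Dec P) → P → does d ≡ true
    does≡true (yes _) _ = ≡.refl
    does≡true (no ¬p) p = contradiction p ¬p

    true≡does : ∀ {P : Set} (d : Dec P) → does d ≡ true → P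
    true≡does (yes p) _ = p

    ≡-does : ∀ {P : Set} (d : Dec P) e → (e ≡ true → P) → (P → e ≡ true) → e ≡ does d
    ≡-does (yes p) e to from = from p
    ≡-does (no ¬p) true to from = contradiction (to ≡.refl) ¬p
    ≡-does (no ¬p) false to from = ≡.refl

  occupancy-0 : ∀ T i → occupancy T 0 i ≡ 0
  occupancy-0 T i = prefix-unique (occupied? T 0 i) 0 z≤n (λ _ ()) λ { j (s , _ , ()) }

  module _ {T : Filling} {y : Pattern} (m : Matches T y) where
    open Matches m
    open Valid valid

    occupancy≡state : ∀ k i → k ℕ.≤ n → occupancy T k i ≡ state y k i
    occupancy≡state k i k≤n = prefix-unique (occupied? T k i) (state y k i) (state-≤ i k k≤n)
      (λ j j< → let (r , r<k , ≤j , j<′) = occupied m i (toℕ j) k k≤n j< in r , from i j r (inj₁ (≤j , j<′)) , r<k)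
      (λ j (s , s∈ , s<k) → ℕ.<-≤-trans (in-< m (to i j s s∈)) (state-mono i s<k))

    matches⇒encode : y ≗ encode T
    matches⇒encode = (λ r i → ≡.sym (≡.trans (occupancy≡state (suc (toℕ r)) i (Fin.toℕ<n r))
        (≡.cong (λ f → f i) (states-suc (λ _ → 0) (proj₁ y) r)))) ,
      λ r i → ≡-does (mark? T r i) (proj₂ y r i) (to-mark r i) (from-mark r i)
      where
      r≤n : ∀ (r : Fin n) → toℕ r ℕ.≤ n
      r≤n r = ℕ.<⇒≤ (Fin.toℕ<n r)

      to-mark : ∀ r i → proj₂ y r i ≡ true → ∃[ j ] suc (toℕ j) ≡ occupancy T (toℕ r) i × r ∈ₛ T i j
      to-mark r i e with state y (toℕ r) i in eq | interlaced r i
      ... | zero  | le = contradiction (ℕ.≤-trans (ℕ.m≤n+m (bit (proj₂ y r i)) _) le) λ le₀ →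
                          absurd (≡.subst (λ e → bit e ℕ.≤ 0) e le₀)
        where
        absurd : ¬ (1 ℕ.≤ 0)
        absurd ()
      ... | suc s | _ = j , ≡.trans (≡.cong suc toℕ-j) (≡.sym (≡.trans (occupancy≡state (toℕ r) i (r≤n r)) eq)) ,
            from i j r (inj₂ (e , ≡.trans (≡.cong suc toℕ-j) (≡.sym eq)))
        where
        s<L : s ℕ.< rowLength i
        s<L = ℕ.≤-trans (ℕ.≤-reflexive (≡.sym eq)) (state-≤ i (toℕ r) (r≤n r))
        j = Fin.fromℕ< s<L
        toℕ-j = Fin.toℕ-fromℕ< s<L

      from-mark : ∀ r i → (∃[ j ] suc (toℕ j) ≡ occupancy T (toℕ r) i × r ∈ₛ T i j) → proj₂ y r i ≡ true
      from-mark r i (j , eq , r∈) with to i j r r∈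
      ... | inj₂ (e , _)  = e
      ... | inj₁ (≤j , _) = contradiction
        (ℕ.≤-trans (ℕ.≤-reflexive (≡.trans eq (occupancy≡state (toℕ r) i (r≤n r)))) ≤j) (ℕ.<-irrefl ≡.refl)

  module _ {T : Filling} {y : Pattern} (tableau : IsTableau T) (y≗ : y ≗ encode T) where
    private
      nonempty = proj₁ tableau
      weak     = proj₁ (proj₂ tableau)
      strict   = proj₂ (proj₂ tableau)

      state≡ : ∀ k i → k ℕ.≤ n → state y k i ≡ occupancy T k i
      state≡ k i = states-agree {f = occupancy T} (λ i → ≡.sym (occupancy-0 T i)) (proj₁ y≗) k i

      closed : ∀ k i j j′ → toℕ j′ ≡ suc (toℕ j) → Occupied T k i j′ → Occupied T k i j
      closed k i j j′ eq (s , s∈ , s<k) = let (r , r∈) = nonempty i j in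
        r , r∈ , ℕ.≤-<-trans (weak i j j′ eq r s r∈ s∈) s<k

      state⇒ : ∀ k i j → k ℕ.≤ n → toℕ j ℕ.< state y k i → Occupied T k i j
      state⇒ k i j k≤n j< = prefix-⇒ (occupied? T k i) j (≡.subst (toℕ j ℕ.<_) (state≡ k i k≤n) j<)

      state⇐ : ∀ k i j → k ℕ.≤ n → Occupied T k i j → toℕ j ℕ.< state y k i
      state⇐ k i j k≤n occ = ≡.subst (toℕ j ℕ.<_) (≡.sym (state≡ k i k≤n)) (prefix-⇐ (occupied? T k i)
        (closed k i) j occ)

      r≤n : ∀ (r : Fin n) → toℕ r ℕ.≤ n
      r≤n r = ℕ.<⇒≤ (Fin.toℕ<n r)

      state≤L : ∀ k i → k ℕ.≤ n → state y k i ℕ.≤ rowLength i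
      state≤L k i k≤n = ≡.subst (ℕ._≤ _) (≡.sym (state≡ k i k≤n)) (prefix-≤ (occupied? T k i))

      bounded : ∀ {L} m {B} → m ℕ.≤ L → (∀ (j : Fin L) → toℕ j ℕ.< m → toℕ j ℕ.< B) → m ℕ.≤ B
      bounded zero    _   _ = z≤n
      bounded (suc m) m<L f = ≡.subst (ℕ._< _) (Fin.toℕ-fromℕ< m<L)
        (f (Fin.fromℕ< m<L) (s≤s (ℕ.≤-reflexive (Fin.toℕ-fromℕ< m<L))))

      increasing : ∀ (r : Fin n) i → state y (toℕ r) i ℕ.≤ state y (suc (toℕ r)) i
      increasing r i = bounded _ (state≤L (toℕ r) i (r≤n r)) λ j j< →
        let (s , s∈ , s<r) = state⇒ (toℕ r) i j (r≤n r) j< in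
        state⇐ (suc (toℕ r)) i j (Fin.toℕ<n r) (s , s∈ , ℕ.m<n⇒m<1+n s<r)

      marked : ∀ r i → proj₂ y r i ≡ true → ∃[ j ] suc (toℕ j) ≡ state y (toℕ r) i × r ∈ₛ T i j
      marked r i e = let (j , eq , r∈) = true≡does (mark? T r i) (≡.trans (≡.sym (proj₂ y≗ r i)) e) in
        j , ≡.trans eq (≡.sym (state≡ (toℕ r) i (r≤n r))) , r∈

      interlaced : ∀ (r : Fin n) i → after (state y (suc (toℕ r))) i ℕ.+ bit (proj₂ y r i) ℕ.≤ state y (toℕ r) i
      interlaced r i with after-cases i | proj₂ y r i in e
      ... | inj₂ last | false rewrite last (state y (suc (toℕ r))) = z≤n
      ... | inj₂ last | true  rewrite last (state y (suc (toℕ r))) =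
        let (j , eq , _) = marked r i e in ℕ.≤-trans (s≤s z≤n) (ℕ.≤-reflexive eq)
      ... | inj₁ (i′ , eq) | b rewrite after-next (state y (suc (toℕ r))) i i′ eq = go b e
        where
        L′≤L : rowLength i′ ℕ.≤ rowLength i
        L′≤L = lookup-decreasing decreasing i i′ eq

        box-above : ∀ {m} (m≤ : m ℕ.≤ n) (j′ : Fin (rowLength i′)) → toℕ j′ ℕ.< state y m i′ →
          ∃[ j ] toℕ j ≡ toℕ j′ × (∀ r → r ∈ₛ T i j → suc (toℕ r) ℕ.< m)
        box-above {m} m≤ j′ j′< = j , eqj , λ r r∈ → let (s , s∈ , s<m) = state⇒ m i′ j′ m≤ j′< in
            ℕ.≤-trans (s≤s (strict i i′ j j′ eq eqj r s r∈ s∈)) s<m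
          where
          j   = Fin.inject≤ j′ L′≤L
          eqj = Fin.toℕ-inject≤ j′ L′≤L

        le : state y (suc (toℕ r)) i′ ℕ.≤ state y (toℕ r) i
        le = bounded _ (state≤L (suc (toℕ r)) i′ (Fin.toℕ<n r)) λ j′ j′< →
          let (j , eqj , all<) = box-above (Fin.toℕ<n r) j′ j′<
              (s , s∈) = nonempty i j
          in ≡.subst (ℕ._< _) eqj (state⇐ (toℕ r) i j (r≤n r) (s , s∈ , ℕ.≤-pred (all< s s∈)))

        go : ∀ b → proj₂ y r i ≡ b → state y (suc (toℕ r)) i′ ℕ.+ bit b ℕ.≤ state y (toℕ r) i
        go false _ = ≡.subst (ℕ._≤ _) (≡.sym (ℕ.+-identityʳ _)) le
        -- Equality would mean that the marked box, which contains `r`, has a box below it with an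
        -- entry at most `r`.
        go true  e = ≡.subst (ℕ._≤ state y (toℕ r) i) (ℕ.+-comm 1 (state y (suc (toℕ r)) i′)) (ℕ.≤∧≢⇒< le λ same →
          let (j , eqj , r∈) = marked r i e
              j<′ = ≡.subst (toℕ j ℕ.<_) (≡.sym same) (ℕ.≤-reflexive eqj)
              j<L′ = ℕ.<-≤-trans j<′ (state≤L (suc (toℕ r)) i′ (Fin.toℕ<n r))
              j′ = Fin.fromℕ< j<L′
              (j″ , eq″ , all<) = box-above (Fin.toℕ<n r) j′ (≡.subst (ℕ._< state y (suc (toℕ r)) i′)
                (≡.sym (Fin.toℕ-fromℕ< j<L′)) j<′)
              j″≡j = Fin.toℕ-injective (≡.trans eq″ (Fin.toℕ-fromℕ< j<L′))
          in ℕ.<-irrefl ≡.refl (ℕ.≤-pred (all< r (≡.subst (λ j → r ∈ₛ T i j) (≡.sym j″≡j) r∈))))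

      final : ∀ i → state y n i ≡ rowLength i
      final i = ≡.trans (state≡ n i ℕ.≤-refl) (prefix-unique (occupied? T n i) (rowLength i) ℕ.≤-refl
        (λ j _ → let (s , s∈) = nonempty i j in s , s∈ , Fin.toℕ<n s) (λ j _ → Fin.toℕ<n j))

      to : ∀ i j r → r ∈ₛ T i j → In y i (toℕ j) r
      to i j r r∈ with toℕ j ℕ.<? state y (toℕ r) i
      ... | no j≮  = inj₁ (ℕ.≮⇒≥ j≮ , state⇐ (suc (toℕ r)) i j (Fin.toℕ<n r) (r , r∈ , ℕ.≤-refl))
      ... | yes j< = inj₂ (≡.trans (proj₂ y≗ r i) (does≡true (mark? T r i) (j , ≡.trans last (state≡ (toℕ r)
        i (r≤n r)) , r∈)) , last)
        where
        -- Otherwise the box to the right of `j` has an entry less than `r`, although `r` is in box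
        -- `j`.
        last : suc (toℕ j) ≡ state y (toℕ r) i
        last = ℕ.≤-antisym j< (ℕ.≮⇒≥ λ sj< →
          let sj<L = ℕ.<-≤-trans sj< (state≤L (toℕ r) i (r≤n r))
              j′ = Fin.fromℕ< sj<L
              eq = Fin.toℕ-fromℕ< sj<L
              (s , s∈ , s<r) = state⇒ (toℕ r) i j′ (r≤n r) (≡.subst (ℕ._< state y (toℕ r) i) (≡.sym eq) sj<)
          in ℕ.<⇒≱ s<r (weak i j j′ eq r s r∈ s∈))

      from : ∀ i j r → In y i (toℕ j) r → r ∈ₛ T i j
      from i j r (inj₂ (e , eq)) = let (j′ , eq′ , r∈) = marked r i e in
        ≡.subst (λ j → r ∈ₛ T i j) (Fin.toℕ-injective (ℕ.suc-injective (≡.trans eq′ (≡.sym eq)))) r∈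
      from i j r (inj₁ (≤j , j<)) =
        let (s , s∈ , s≤r) = state⇒ (suc (toℕ r)) i j (Fin.toℕ<n r) j<
            r≤s = ℕ.≮⇒≥ λ s<r → ℕ.<⇒≱ (state⇐ (toℕ r) i j (r≤n r) (s , s∈ , s<r)) ≤j
        in ≡.subst (_∈ₛ T i j) (Fin.toℕ-injective (ℕ.≤-antisym (ℕ.≤-pred s≤r) r≤s)) s∈

    tableau⇒matches : Matches T y
    tableau⇒matches = record
      { valid = record { final = final ; increasing = increasing ; interlaced = interlaced }
      ; to = to ; from = from }

-- Sums over families, and products over the boxes of a tableau

module FamilySums {c ℓ} (R : CommutativeRing c ℓ) where
  open CommutativeRing R hiding (zero)
  open IntegerCoefficients R using (solve; _:=_; _:+_; _:*_; _:-_; :-_; con)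
  open ListSum R
  open RawSemiringDefinitions (RawRing.rawSemiring rawRing) using (product)
  open import Relation.Binary.Reasoning.Setoid setoid

  product-≡ : ∀ {k} {f g : Fin k → Carrier} → (∀ i → f i ≡ g i) → product f ≈ product g
  product-≡ {zero}  eq = refl
  product-≡ {suc k} eq = *-cong (reflexive (eq zero)) (product-≡ (eq ∘ suc))

  -- `cons` abstracts the local function of `allFamilies`, which is used through these two
  -- equations.
  sumL-cons : ∀ {k} {B : Fin (suc k) → Set} (cons : B zero → (∀ i → B (suc i)) → ∀ i → B i) →
    (∀ b f → cons b f zero ≡ b) → (∀ b f i → cons b f (suc i) ≡ f i) →
    ∀ L Ls (φ₀ : B zero → Carrier) (φs : ∀ i → B (suc i) → Carrier) →
    sumL (cartesianProductWith cons L Ls) (λ f → φ₀ (f zero) * product (λ i → φs i (f (suc i)))) ≈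
    sumL L φ₀ * sumL Ls (λ f → product λ i → φs i (f i))
  sumL-cons cons cons-zero cons-suc L Ls φ₀ φs = trans (sumL-product cons L Ls _) (trans
    (sumL-cong L λ b → trans (sumL-cong Ls λ f → *-cong (reflexive (≡.cong φ₀ (cons-zero b f)))
        (product-≡ λ i → ≡.cong (φs i) (cons-suc b f i))) (sym (*-sumL _ Ls _)))
    (sym (sumL-* L φ₀ _)))

  sumL-families : ∀ {k} {B : Fin k → Set} (L : ∀ i → List (B i)) (φ : ∀ i → B i → Carrier) →
    sumL (allFamilies L) (λ f → product λ i → φ i (f i)) ≈ product λ i → sumL (L i) (φ i)
  sumL-families {zero}  L φ = +-identityʳ _
  sumL-families {suc k} {B} L φ = trans
    (sumL-cons {B = B} _ (λ _ _ → ≡.refl) (λ _ _ _ → ≡.refl) (L zero) (allFamilies (L ∘ suc)) (φ zero)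
      (λ i → φ (suc i)))
    (*-congˡ (sumL-families (L ∘ suc) (λ i → φ (suc i))))

  -- x₀ occurs exactly once in xs up to _~_, as seen by sums over xs.
  record Samples {A : Set} (_~_ : A → A → Set) (xs : List A) (x₀ : A) : Set (c ⊔ ℓ) where
    constructor sampled
    field
      sample : ∀ (φ : A → Carrier) y → (∀ x → x ~ x₀ → φ x ≈ y) → (∀ x → ¬ (x ~ x₀) → φ x ≈ 0#) → sumL xs φ ≈ y
  open Samples public

  samples-cons : ∀ {k} {B : Fin (suc k) → Set} {cons : B zero → (∀ i → B (suc i)) → ∀ i → B i} →
    (∀ b f → cons b f zero ≡ b) → (∀ b f i → cons b f (suc i) ≡ f i) →
    ∀ {_~_ : ∀ {i} → B i → B i → Set} {L Ls f₀} →
    Samples _~_ L (f₀ zero) → Samples (λ f g → ∀ i → f i ~ g i) Ls (f₀ ∘ suc) →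
    Samples (λ f g → ∀ i → f i ~ g i) (cartesianProductWith cons L Ls) f₀
  samples-cons {cons = cons} cons-zero cons-suc {_~_} {L} {Ls} {f₀} head tails .sample φ y on off = trans
    (sumL-product cons L Ls φ)
    (sample head _ y (λ b b~ → sample tails _ y
        (λ f f~ → on (cons b f) λ
          { zero → ≡.subst (_~ f₀ zero) (≡.sym (cons-zero b f)) b~
          ; (suc i) → ≡.subst (_~ f₀ (suc i)) (≡.sym (cons-suc b f i)) (f~ i) })
        (λ f f≁ → off (cons b f) λ eq → f≁ λ i → ≡.subst (_~ f₀ (suc i)) (cons-suc b f i) (eq (suc i))))
      (λ b b≁ → sumL-0 Ls λ f → off (cons b f) λ eq → b≁ (≡.subst (_~ f₀ zero) (cons-zero b f) (eq zero))))

  samples-families : ∀ {k} {B : Fin k → Set} {_~_ : ∀ {i} → B i → B i → Set}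
    {L : ∀ i → List (B i)} {f₀} → (∀ i → Samples _~_ (L i) (f₀ i)) → Samples (λ f g → ∀ i → f i ~ g i)
      (allFamilies L) f₀
  samples-families {zero}  samples .sample φ y on off = trans (+-identityʳ _) (on _ λ ())
  samples-families {suc k} {_~_ = _~_} samples =
    samples-cons (λ _ _ → ≡.refl) (λ _ _ _ → ≡.refl) {_~_} (samples zero) (samples-families {_~_ = _~_}
      (samples ∘ suc))

  samples-upTo : ∀ N k → k ℕ.≤ N → Samples _≡_ (upTo (suc N)) k
  samples-upTo N k k≤N .sample φ y on off = begin
    sumL (upTo (suc N)) φ ≈⟨ sumL-upTo N φ ⟩
    sumTo N φ             ≈⟨ sumTo-window k 0 N (ℕ.≤-trans (ℕ.≤-reflexive (ℕ.+-identityʳ k)) k≤N)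
                               (λ q q<k → off q (ℕ.<⇒≢ q<k))
                               (λ q k<q → off q λ q≡k → ℕ.<⇒≢ k<q (≡.trans (ℕ.+-identityʳ k) (≡.sym q≡k))) ⟩
    φ (k ℕ.+ 0)           ≈⟨ on _ (ℕ.+-identityʳ k) ⟩
    y                     ∎
    where open TwoLetterSums R 0#

  bools : List Bool
  bools = false ∷ true ∷ []

  samples-bools : ∀ b → Samples _≡_ bools b
  samples-bools false .sample φ y on off = trans (+-cong (on false ≡.refl) (+-congʳ (off true λ ())))
    (solve 1 (λ y → y :+ (con (+ 0) :+ con (+ 0)) := y) refl y)
  samples-bools true  .sample φ y on off = trans (+-cong (off false λ ()) (+-congʳ (on true ≡.refl)))
    (solve 1 (λ y → con (+ 0) :+ (y :+ con (+ 0)) := y) refl y)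

  samples-subsets : ∀ n S → Samples _≡_ (allSubsets n) S
  samples-subsets zero    Vec.[] .sample φ y on off = trans (+-identityʳ _) (on Vec.[] ≡.refl)
  samples-subsets (suc n) (s Vec.∷ S) .sample φ y on off = trans (sumL-++ (List.map (inside Vec.∷_)
    (allSubsets n)) _ φ)
    (trans (+-cong (sumL-map (inside Vec.∷_) (allSubsets n) φ) (sumL-map (outside Vec.∷_) (allSubsets n) φ))
      (cases s on off))
    where
    cases : ∀ s → (∀ x → x ≡ s Vec.∷ S → φ x ≈ y) → (∀ x → ¬ (x ≡ s Vec.∷ S) → φ x ≈ 0#) →
      sumL (allSubsets n) (λ S → φ (inside Vec.∷ S)) + sumL (allSubsets n) (λ S → φ (outside Vec.∷ S)) ≈ y
    cases true on off = trans (+-cong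
      (sample (samples-subsets n S) _ y (λ { x ≡.refl → on (_ Vec.∷ S) ≡.refl }) (λ x x≢ → off (_ Vec.∷ x)
        λ { ≡.refl → x≢ ≡.refl }))
      (sumL-0 (allSubsets n) λ x → off (_ Vec.∷ x) λ ())) (+-identityʳ y)
    cases false on off = trans (+-cong (sumL-0 (allSubsets n) λ x → off (_ Vec.∷ x) λ ())
      (sample (samples-subsets n S) _ y (λ { x ≡.refl → on (_ Vec.∷ S) ≡.refl }) (λ x x≢ → off (_ Vec.∷ x)
        λ { ≡.refl → x≢ ≡.refl }))) (+-identityˡ y)

  samples-pairs : ∀ {A B : Set} {_~_ : A → A → Set} {_~′_ : B → B → Set} {xs ys x₀ y₀} →
    Samples _~_ xs x₀ → Samples _~′_ ys y₀ →
    Samples (λ (x , y) (x′ , y′) → x ~ x′ × y ~′ y′) (cartesianProductWith _,_ xs ys) (x₀ , y₀)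
  samples-pairs {xs = xs} {ys} s s′ .sample φ y on off = trans (sumL-product _,_ xs ys φ)
    (sample s _ y (λ a a~ → sample s′ _ y (λ b b~ → on _ (a~ , b~)) (λ b b≁ → off _ (b≁ ∘ proj₂)))
           (λ a a≁ → sumL-0 ys {f = λ b → φ (a , b)} λ b → off (a , b) λ ab~ → a≁ (proj₁ ab~)))

-- For a commutative monoid, as there are two uses: multiplication in the ring collects the weights
-- of the boxes, and addition of natural numbers counts their entries.
module BoxProducts {c ℓ} (M : CommutativeMonoid c ℓ) where
  open CommutativeMonoid M
  open CommutativeMonoidSum M
  open import Relation.Binary.Reasoning.Setoid setoid

  if-cong : ∀ {P Q : Set} (d : Dec P) (e : Dec Q) {x : Carrier} → (P → Q) → (Q → P) →
    (if does d then x else ε) ≈ (if does e then x else ε)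
  if-cong (yes _) (yes _) _ _ = refl
  if-cong (no _)  (no _)  _ _ = refl
  if-cong (yes p) (no ¬q) to _ = contradiction (to p) ¬q
  if-cong (no ¬p) (yes q) _ from = contradiction (from q) ¬p

  segment : (ℕ → Carrier) → ℕ → ℕ → Carrier
  segment f p zero    = ε
  segment f p (suc n) = f p ∙ segment f (suc p) n

  segment-suc : ∀ (f : ℕ → Carrier) p n → segment (f ∘ suc) p n ≡ segment f (suc p) n
  segment-suc f p zero    = ≡.refl
  segment-suc f p (suc n) = ≡.cong (f (suc p) ∙_) (segment-suc f (suc p) n)

  sum-cong : ∀ n {f g : Fin n → Carrier} → (∀ i → f i ≈ g i) → sum f ≈ sum g
  sum-cong zero    eq = refl
  sum-cong (suc n) eq = ∙-cong (eq zero) (sum-cong n (eq ∘ suc))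

  sum-ε : ∀ L {f : Fin L → Carrier} → (∀ j → f j ≈ ε) → sum f ≈ ε
  sum-ε zero    eq = refl
  sum-ε (suc L) eq = trans (∙-cong (eq zero) (sum-ε L (eq ∘ suc))) (identityˡ ε)

  interval? : ∀ p q j → Dec (p ℕ.≤ j × j ℕ.< q)
  interval? p q j = (p ℕ.≤? j) ×-dec (j ℕ.<? q)

  sum-interval : ∀ L p q (f : ℕ → Carrier) → p ℕ.≤ q → q ℕ.≤ L →
    sum {L} (λ j → if does (interval? p q (toℕ j)) then f (toℕ j) else ε) ≈ segment f p (q ∸ p)
  sum-interval zero zero zero f _ _ = refl
  sum-interval (suc L) zero zero f _ _ = sum-ε (suc L) λ j → if-no (interval? 0 0 (toℕ j)) (λ { (_ , ()) })
    {f (toℕ j)}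
    where
    if-no : ∀ {P : Set} (d : Dec P) → ¬ P → ∀ {x} → (if does d then x else ε) ≈ ε
    if-no (yes p) ¬p = contradiction p ¬p
    if-no (no _)  _  = refl
  sum-interval (suc L) zero (suc q) f _ (s≤s q≤L) = ∙-congˡ (trans
    (sum-cong L λ j → if-cong (interval? 0 (suc q) (suc (toℕ j))) (interval? 0 q (toℕ j))
      (λ { (_ , s≤s lt) → z≤n , lt }) (λ { (_ , lt) → z≤n , s≤s lt }))
    (trans (sum-interval L zero q (f ∘ suc) z≤n q≤L) (reflexive (segment-suc f 0 q))))
  sum-interval (suc L) (suc p) (suc q) f (s≤s p≤q) (s≤s q≤L) = trans (identityˡ _) (trans
    (sum-cong L λ j → if-cong (interval? (suc p) (suc q) (suc (toℕ j))) (interval? p q (toℕ j))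
      (λ { (s≤s le , s≤s lt) → le , lt }) (λ { (le , lt) → s≤s le , s≤s lt }))
    (trans (sum-interval L p q (f ∘ suc) p≤q q≤L) (reflexive (segment-suc f p (q ∸ p)))))

  last? : ∀ (e : Bool) p j → Dec (e ≡ true × suc j ≡ p)
  last? e p j = (e Bool.≟ true) ×-dec (suc j ℕ.≟ p)

  sum-last : ∀ L p (e : Bool) (f : ℕ → Carrier) → (if e then 1 else 0) ℕ.≤ p → p ℕ.≤ L →
    sum {L} (λ j → if does (last? e p (toℕ j)) then f (toℕ j) else ε) ≈ (if e then f (p ∸ 1) else ε)
  sum-last L       p false f _ _ = sum-ε L λ j → refl
  sum-last zero    zero true f () _
  sum-last (suc L) (suc zero)    true f _ _ = trans (∙-congˡ (sum-ε L λ j → refl)) (identityʳ _)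
  sum-last (suc L) (suc (suc p)) true f _ (s≤s p<L) = trans (identityˡ _) (trans
    (sum-cong L λ j → if-cong (last? true (suc (suc p)) (suc (toℕ j))) (last? true (suc p) (toℕ j))
      (λ (e , eq) → e , ℕ.suc-injective eq) (λ (e , eq) → e , ≡.cong suc eq))
    (sum-last L (suc p) true (f ∘ suc) (s≤s z≤n) p<L))

  sum-box : ∀ L p q (e : Bool) (f : ℕ → Carrier) → p ℕ.≤ q → q ℕ.≤ L → (if e then 1 else 0) ℕ.≤ p →
    {Q : ℕ → Set} (Q? : ∀ j → Dec (Q j)) → (∀ j → Q j → (p ℕ.≤ j × j ℕ.< q) ⊎ (e ≡ true × suc j ≡ p)) →
    (∀ j → (p ℕ.≤ j × j ℕ.< q) ⊎ (e ≡ true × suc j ≡ p) → Q j) →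
    sum {L} (λ j → if does (Q? (toℕ j)) then f (toℕ j) else ε) ≈ segment f p (q ∸ p) ∙ (if e then f (p ∸ 1) else ε)
  sum-box L p q e f p≤q q≤L e≤p Q? to from = begin
    sum {L} (λ j → if does (Q? (toℕ j)) then f (toℕ j) else ε)
      ≈⟨ sum-cong L (λ j → split (toℕ j) (Q? (toℕ j)) (interval? p q (toℕ j)) (last? e p (toℕ j))) ⟩
    sum {L} (λ j → (if does (interval? p q (toℕ j)) then f (toℕ j) else ε) ∙ (if does (last? e p (toℕ j))
      then f (toℕ j) else ε))
      ≈⟨ ∑-distrib-+ {L} _ _ ⟩
    sum {L} (λ j → if does (interval? p q (toℕ j)) then f (toℕ j) else ε) ∙ sum {L} (λ j → if does
      (last? e p (toℕ j)) then f (toℕ j) else ε)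
      ≈⟨ ∙-cong (sum-interval L p q f p≤q q≤L) (sum-last L p e f e≤p (ℕ.≤-trans p≤q q≤L)) ⟩
    segment f p (q ∸ p) ∙ (if e then f (p ∸ 1) else ε) ∎
    where
    split : ∀ j (d : Dec _) (d₁ : Dec (p ℕ.≤ j × j ℕ.< q)) (d₂ : Dec (e ≡ true × suc j ≡ p)) →
      (if does d then f j else ε) ≈ (if does d₁ then f j else ε) ∙ (if does d₂ then f j else ε)
    split j d (yes (p≤j , _)) (yes (_ , eq)) = contradiction (ℕ.≤-trans (ℕ.≤-reflexive eq) p≤j) (ℕ.<-irrefl ≡.refl)
    split j (yes _) (yes _) (no _)  = sym (identityʳ _)
    split j (yes _) (no _)  (yes _) = sym (identityˡ _)
    split j (no _)  (no _)  (no _)  = sym (identityˡ _)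
    split j (no ¬q) (yes i) _       = contradiction (from j (inj₁ i)) ¬q
    split j (no ¬q) _       (yes l) = contradiction (from j (inj₂ l)) ¬q
    split j (yes q) (no ¬i) (no ¬l) = contradiction (to j q) λ { (inj₁ i) → ¬i i ; (inj₂ l) → ¬l l }

  module _ {n : ℕ} {μ : Partition} {T : SetValuedTableaux.Filling n μ} {y : TableauxAndPatterns.Pattern n μ}
           (m : TableauxAndPatterns.Matches n μ T y) (θ : Fin n → Fin (Partition.numParts μ) → ℕ → Carrier) where
    open Partition μ
    open TableauxAndPatterns n μ
    open Matches m
    open Valid valid

    -- In each row the sums over boxes and letters are exchanged. The boxes of the row that contain
    -- a given letter are the interval added at its step, and the box before that interval if there
    -- is a mark.
    sum-tableau : sum (λ i → sum λ j → sum λ r → if does (r ∈ₛ? T i j) then θ r i (toℕ j) else ε) ≈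
      sum λ i → sum λ r → segment (θ r i) (state y (toℕ r) i) (state y (suc (toℕ r)) i ∸ state y (toℕ r) i) ∙
                          (if proj₂ y r i then θ r i (state y (toℕ r) i ∸ 1) else ε)
    sum-tableau = sum-cong numParts λ i → trans
      (sum-cong (rowLength i) λ j → sum-cong n λ r → if-cong (r ∈ₛ? T i j) (in? y i (toℕ j) r) (to i j r)
        (from i j r))
      (trans (∑-comm {rowLength i} {n} _) (sum-cong n λ r → sum-box (rowLength i) (state y (toℕ r) i)
        (state y (suc (toℕ r)) i) (proj₂ y r i) (θ r i)
        (increasing r i) (state-≤ i _ (Fin.toℕ<n r)) (ℕ.≤-trans (ℕ.m≤n+m _ (after (state y (suc (toℕ r)))
          i)) (interlaced r i))
        (λ j → in? y i j r) (λ j → id) (λ j → id)))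

-- Grothendieck polynomials as sums over chains

rowsBelow : ∀ {h} → Fin h → ℕ
rowsBelow {suc h} zero    = h
rowsBelow {suc h} (suc i) = rowsBelow i

rowsBelow+ : ∀ {h} (i : Fin h) → rowsBelow i ℕ.+ suc (toℕ i) ≡ h
rowsBelow+ {suc h} zero    = ℕ.+-comm h 1
rowsBelow+ {suc h} (suc i) = ≡.trans (ℕ.+-suc (rowsBelow i) _) (≡.cong suc (rowsBelow+ i))

subset-size : ∀ {n} (S : Subset n) →
  ∣ S ∣ ≡ RawMonoidDefinitions.sum ℕ.+-0-rawMonoid (λ r → if does (r ∈ₛ? S) then 1 else 0)
subset-size Vec.[]            = ≡.refl
subset-size (true  Vec.∷ S) = ≡.cong suc (subset-size S)
subset-size (false Vec.∷ S) = subset-size S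

sum-lookup : ∀ xs → ListAction.sum xs ≡ RawMonoidDefinitions.sum ℕ.+-0-rawMonoid (List.lookup xs)
sum-lookup []       = ≡.refl
sum-lookup (x ∷ xs) = ≡.cong (x ℕ.+_) (sum-lookup xs)

lookup≤sum : ∀ xs i → List.lookup xs i ℕ.≤ ListAction.sum xs
lookup≤sum (x ∷ xs) zero    = ℕ.m≤m+n x _
lookup≤sum (x ∷ xs) (suc i) = ℕ.≤-trans (lookup≤sum xs i) (ℕ.m≤n+m _ x)

module GrothendieckSums {c ℓ} (R : CommutativeRing c ℓ) (β : CommutativeRing.Carrier R) (n : ℕ)
    (x : Fin n → CommutativeRing.Carrier R) (a : ℕ → CommutativeRing.Carrier R) (μ : Partition) where
  open CommutativeRing R hiding (zero)
  open ListSum R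
  open TwoLetterSums R β using (_⊕_; run; _↓_; ⟨_⟩; run-cong)
  open RawSemiringDefinitions (RawRing.rawSemiring rawRing) using (product; _^_)
  open Partition μ
  open SetValuedTableaux n μ

  boxWeight : Fin n → Fin numParts → ℕ → Carrier
  boxWeight r i j = x r ⊕ a (toℕ r ℕ.+ j ∸ toℕ i)

  tableauWeight : Filling → Carrier
  tableauWeight T = β ^ (weight T ∸ size) *
    product λ i → product λ j → foldr (λ r p → boxWeight r i (toℕ j) * p) 1# (filter (_∈ₛ? T i j) (allFin n))

  grothendieck : Carrier
  grothendieck = sumL tableaux tableauWeight

  private
    -- The parameters, shifted so that the index h - 1 - i + r + j of `ChainSums` involves no
    -- truncation; for h = `numParts` the parameter there is that of index r + j - i, truncated as
    -- in `boxWeight`.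
    b : ℕ → Carrier
    b k = a (suc k ∸ numParts)

  open ChainSums R β b size
  open TableauxAndPatterns n μ
  open FamilySums R
  open import Relation.Binary.Reasoning.Setoid setoid
  private
    module P = BoxProducts *-commutativeMonoid
    module N = BoxProducts ℕ.+-0-commutativeMonoid
    module PS = CommutativeMonoidSum *-commutativeMonoid
    module NS = CommutativeMonoidSum ℕ.+-0-commutativeMonoid

  boxWeight≡ : ∀ r i j → boxWeight r i j ≡ x r ⊕ b (rowsBelow i ℕ.+ toℕ r ℕ.+ j)
  boxWeight≡ r i j = ≡.cong (λ k → x r ⊕ a k) (≡.sym (≡.trans
    (≡.cong₂ _∸_ (≡.cong suc (ℕ.+-assoc (rowsBelow i) (toℕ r) j)) (≡.trans (≡.sym (rowsBelow+ i))
      (ℕ.+-suc (rowsBelow i) (toℕ i))))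
    (ℕ.[m+n]∸[m+o]≡n∸o (rowsBelow i) (toℕ r ℕ.+ j) (toℕ i))))

  endpoint : Pattern → Carrier
  endpoint y = [ Fin.all? (λ i → state y n i ℕ.≟ rowLength i) ]· 1#

  -- In a step p → q with v the new length of the next row, the contribution of a
  -- row with mark e.
  markedStep : ℕ → Carrier → (p q v : ℕ) → Bool → Carrier
  markedStep κ x p q v e = [ p ℕ.≤? q ]· [ v ℕ.+ bit e ℕ.≤? p ]·
    (run x (b ↓ (κ ℕ.+ p)) (q ∸ p) * (if e then β * (x ⊕ b (κ ℕ.+ (p ∸ 1))) else 1#))

  patternWeight : Pattern → Carrier
  patternWeight y = product (λ r → product λ i → markedStep (rowsBelow i ℕ.+ toℕ r) (x r)
    (state y (toℕ r) i) (state y (suc (toℕ r)) i) (after (state y (suc (toℕ r))) i) (proj₂ y r i)) * endpoint y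

  product-zero : ∀ {k} (f : Fin k → Carrier) i → f i ≈ 0# → product f ≈ 0#
  product-zero f zero    eq = trans (*-congʳ eq) (zeroˡ _)
  product-zero f (suc i) eq = trans (*-congˡ (product-zero (f ∘ suc) i eq)) (zeroʳ _)

  product-filter : ∀ {k} {Q : Fin n → Set} (Q? : ∀ r → Dec (Q r)) (f : Fin n → Carrier) (g : Fin k → Fin n) →
    foldr (λ r p → f r * p) 1# (filter Q? (List.tabulate g)) ≈ product λ r → if does (Q? (g r)) then f (g r) else 1#
  product-filter {zero}  Q? f g = refl
  product-filter {suc k} Q? f g with does (Q? (g zero))
  ... | true  = *-congˡ (product-filter Q? f (g ∘ suc))
  ... | false = trans (product-filter Q? f (g ∘ suc)) (sym (*-identityˡ _))

  power-+ : ∀ m k → β ^ (m ℕ.+ k) ≈ β ^ m * β ^ k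
  power-+ = MonoidMult.×-homo-+ *-monoid β

  power-sum : ∀ {k} (f : Fin k → ℕ) → β ^ NS.sum f ≈ product λ i → β ^ f i
  power-sum {zero}  f = refl
  power-sum {suc k} f = trans (power-+ (f zero) _) (*-congˡ (power-sum (f ∘ suc)))

  run-segment : ∀ y (f : ℕ → Carrier) κ p m → (∀ j → f j ≡ y ⊕ b (κ ℕ.+ j)) → P.segment f p m ≈ run y
    (b ↓ (κ ℕ.+ p)) m
  run-segment y f κ p zero    eq = refl
  run-segment y f κ p (suc m) eq = *-cong (reflexive (≡.trans (eq p) (≡.cong (λ k → y ⊕ b k)
    (≡.sym (ℕ.+-identityʳ _)))))
    (trans (run-segment y f κ (suc p) m eq) (run-cong y m λ j → ≡.cong b
      (≡.trans (≡.cong (ℕ._+ j) (ℕ.+-suc κ p)) (≡.sym (ℕ.+-suc (κ ℕ.+ p) j)))))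

  segment-1 : ∀ p m → N.segment (λ _ → 1) p m ≡ m
  segment-1 p zero    = ≡.refl
  segment-1 p (suc m) = ≡.cong suc (segment-1 (suc p) m)

  telescope : ∀ k (g : ℕ → ℕ) → (∀ r → g r ℕ.≤ g (suc r)) → g 0 ℕ.+ NS.sum {k} (λ r → g (suc (toℕ r)) ∸ g
    (toℕ r)) ≡ g k
  telescope zero    g le = ℕ.+-identityʳ _
  telescope (suc k) g le = ≡.trans (≡.sym (ℕ.+-assoc (g 0) _ _))
    (≡.trans (≡.cong (ℕ._+ NS.sum {k} (λ r → g (suc (suc (toℕ r))) ∸ g (suc (toℕ r)))) (ℕ.m+[n∸m]≡n (le 0)))
      (telescope k (g ∘ suc) (le ∘ suc)))

  module _ {T : Filling} {y : Pattern} (m : Matches T y) where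
    open Matches m
    open Valid valid

    -- The intervals of a row add up, by telescoping, to its length, and each mark is one further
    -- entry. Hence the exponent of β is the number of marks.
    weight-matches : weight T ≡ size ℕ.+ NS.sum λ i → NS.sum λ r → bit (proj₂ y r i)
    weight-matches = ≡.trans (N.sum-cong numParts λ i → N.sum-cong (rowLength i) λ j → subset-size (T i j))
      (≡.trans (N.sum-tableau m (λ _ _ _ → 1))
      (≡.trans (N.sum-cong numParts λ i → ≡.trans (N.sum-cong n λ r → ≡.cong (ℕ._+ bit (proj₂ y r i))
        (segment-1 (state y (toℕ r) i) _)) (NS.∑-distrib-+ {n} _ _))
      (≡.trans (NS.∑-distrib-+ {numParts} _ _)
        (≡.cong (ℕ._+ NS.sum λ i → NS.sum λ r → bit (proj₂ y r i)) (≡.trans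
          (N.sum-cong numParts λ i → ≡.trans (telescope n (λ k → state y k i) (state-step i)) (final i))
          (≡.sym (sum-lookup parts)))))))

    patternWeight-matches : tableauWeight T ≈ patternWeight y
    patternWeight-matches = begin
      β ^ (weight T ∸ size) * (product λ i → product λ j → foldr (λ r p → boxWeight r i (toℕ j) * p) 1#
        (filter (_∈ₛ? T i j) (allFin n)))
        ≈⟨ *-cong power (P.sum-cong numParts λ i → P.sum-cong (rowLength i) λ j → product-filter
          (_∈ₛ? T i j) (λ r → boxWeight r i (toℕ j)) id) ⟩
      (product λ i → product λ r → if proj₂ y r i then β else 1#) *
      (product λ i → product λ j → product λ r → if does (r ∈ₛ? T i j) then boxWeight r i (toℕ j) else 1#)
        ≈⟨ *-congˡ (P.sum-tableau m boxWeight) ⟩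
      (product λ i → product λ r → if proj₂ y r i then β else 1#) * (product λ i → product λ r → boxes i r)
        ≈⟨ PS.∑-distrib-+ {numParts} _ _ ⟨
      (product λ i → (product λ r → if proj₂ y r i then β else 1#) * (product λ r → boxes i r))
        ≈⟨ P.sum-cong numParts (λ i → trans (sym (PS.∑-distrib-+ {n} _ _)) (P.sum-cong n λ r → step≈ r i)) ⟩
      (product λ i → product λ r → steps r i)
        ≈⟨ PS.∑-comm {numParts} {n} _ ⟩
      (product λ r → product λ i → steps r i)
        ≈⟨ *-identityʳ _ ⟨
      (product λ r → product λ i → steps r i) * 1#
        ≈⟨ *-congˡ ([]·-yes (Fin.all? λ i → state y n i ℕ.≟ rowLength i) final) ⟨
      patternWeight y ∎
      where
      boxes : Fin numParts → Fin n → Carrier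
      boxes i r = P.segment (boxWeight r i) (state y (toℕ r) i) (state y (suc (toℕ r)) i ∸ state y (toℕ r) i) *
                  (if proj₂ y r i then boxWeight r i (state y (toℕ r) i ∸ 1) else 1#)

      steps : Fin n → Fin numParts → Carrier
      steps r i = markedStep (rowsBelow i ℕ.+ toℕ r) (x r)
        (state y (toℕ r) i) (state y (suc (toℕ r)) i) (after (state y (suc (toℕ r))) i) (proj₂ y r i)

      power-bit : ∀ e → β ^ bit e ≈ (if e then β else 1#)
      power-bit true  = *-identityʳ β
      power-bit false = refl

      power : β ^ (weight T ∸ size) ≈ product λ i → product λ r → if proj₂ y r i then β else 1#
      power = begin
        β ^ (weight T ∸ size)
          ≡⟨ ≡.cong (β ^_) (≡.trans (≡.cong (_∸ size) weight-matches) (ℕ.m+n∸m≡n size _)) ⟩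
        β ^ (NS.sum λ i → NS.sum λ r → bit (proj₂ y r i))
          ≈⟨ power-sum {numParts} _ ⟩
        (product λ i → β ^ (NS.sum λ r → bit (proj₂ y r i)))
          ≈⟨ P.sum-cong numParts (λ i → trans (power-sum {n} _) (P.sum-cong n λ r → power-bit (proj₂ y r i))) ⟩
        (product λ i → product λ r → if proj₂ y r i then β else 1#) ∎

      marked : ∀ e w → (if e then β else 1#) * (if e then w else 1#) ≈ (if e then β * w else 1#)
      marked true  w = refl
      marked false w = *-identityˡ _

      step≈ : ∀ r i → (if proj₂ y r i then β else 1#) * boxes i r ≈ steps r i
      step≈ r i = begin
        (if e then β else 1#) * (P.segment (boxWeight r i) p (q ∸ p) * (if e then boxWeight r i (p ∸ 1) else 1#))
          ≈⟨ trans (sym (*-assoc _ _ _)) (trans (*-congʳ (*-comm _ _)) (*-assoc _ _ _)) ⟩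
        P.segment (boxWeight r i) p (q ∸ p) * ((if e then β else 1#) * (if e then boxWeight r i (p ∸ 1) else 1#))
          ≈⟨ *-cong (run-segment (x r) (boxWeight r i) κ p (q ∸ p) (boxWeight≡ r i)) (marked e _) ⟩
        run (x r) (b ↓ (κ ℕ.+ p)) (q ∸ p) * (if e then β * boxWeight r i (p ∸ 1) else 1#)
          ≡⟨ ≡.cong (λ w → run (x r) (b ↓ (κ ℕ.+ p)) (q ∸ p) * (if e then β * w else 1#)) (boxWeight≡ r i (p ∸ 1)) ⟩
        run (x r) (b ↓ (κ ℕ.+ p)) (q ∸ p) * (if e then β * (x r ⊕ b (κ ℕ.+ (p ∸ 1))) else 1#)
          ≈⟨ []·-yes (after (state y (suc (toℕ r))) i ℕ.+ bit e ℕ.≤? p) (interlaced r i) ⟨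
        [ after (state y (suc (toℕ r))) i ℕ.+ bit e ℕ.≤? p ]· (run (x r) (b ↓ (κ ℕ.+ p)) (q ∸ p) *
          (if e then β * (x r ⊕ b (κ ℕ.+ (p ∸ 1))) else 1#))
          ≈⟨ []·-yes (p ℕ.≤? q) (increasing r i) ⟨
        steps r i ∎
        where
        e = proj₂ y r i
        p = state y (toℕ r) i
        q = state y (suc (toℕ r)) i
        κ = rowsBelow i ℕ.+ toℕ r

  -- Every condition of `Valid` is a bracket in the weight. As the conditions are decidable, a
  -- violated one can be found, and it makes a factor zero. This allows sums over all patterns.
  patternWeight-invalid : ∀ y → ¬ Valid y → patternWeight y ≈ 0#
  patternWeight-invalid y ¬valid = cases final? (Fin.all? λ r → Fin.all? (good? r))
    where
    final? : Dec (∀ i → state y n i ≡ rowLength i)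
    final? = Fin.all? λ i → state y n i ℕ.≟ rowLength i

    Good : Fin n → Fin numParts → Set
    Good r i = state y (toℕ r) i ℕ.≤ state y (suc (toℕ r)) i ×
      after (state y (suc (toℕ r))) i ℕ.+ bit (proj₂ y r i) ℕ.≤ state y (toℕ r) i

    good? : ∀ r i → Dec (Good r i)
    good? r i = (_ ℕ.≤? _) ×-dec (_ ℕ.≤? _)

    []·-0 : ∀ {P : Set} (d : Dec P) → [ d ]· 0# ≈ 0#
    []·-0 (yes _) = refl
    []·-0 (no _)  = refl

    step-zero : ∀ κ x p q v e → ¬ (p ℕ.≤ q × v ℕ.+ bit e ℕ.≤ p) → markedStep κ x p q v e ≈ 0#
    step-zero κ x p q v e bad = cases (v ℕ.+ bit e ℕ.≤? p)
      where
      cases : Dec (v ℕ.+ bit e ℕ.≤ p) → markedStep κ x p q v e ≈ 0#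
      cases (yes v≤p) = []·-no (p ℕ.≤? q) λ p≤q → bad (p≤q , v≤p)
      cases (no v≰p)  = trans ([]·-cong (p ℕ.≤? q) (p ℕ.≤? q) id id λ _ → []·-no (v ℕ.+ bit e ℕ.≤? p) v≰p)
        ([]·-0 (p ℕ.≤? q))

    cases : Dec (∀ i → state y n i ≡ rowLength i) → Dec (∀ r i → Good r i) → patternWeight y ≈ 0#
    cases (no ¬final) _ = trans (*-congˡ ([]·-no final? ¬final)) (zeroʳ _)
    cases (yes final) (yes good) = contradiction
      (record { final = final ; increasing = λ r i → proj₁ (good r i) ; interlaced = λ r i → proj₂
        (good r i) }) ¬valid
    cases (yes _) (no ¬good) = trans (*-congʳ zero′) (zeroˡ _)
      where
      zero′ : product (λ r → product λ i → markedStep (rowsBelow i ℕ.+ toℕ r) (x r)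
        (state y (toℕ r) i) (state y (suc (toℕ r)) i) (after (state y (suc (toℕ r))) i) (proj₂ y r i)) ≈ 0#
      zero′ with Fin.¬∀⟶∃¬ n _ (λ r → Fin.all? (good? r)) ¬good
      ... | r , ¬good-r with Fin.¬∀⟶∃¬ numParts _ (good? r) ¬good-r
      ... | i , bad = product-zero {n} _ r (product-zero {numParts} _ i
        (step-zero (rowsBelow i ℕ.+ toℕ r) (x r) (state y (toℕ r) i) _ _ (proj₂ y r i) bad))

  chains : ∀ k → List (Fin k → Fin numParts → ℕ)
  chains k = allFamilies λ _ → families numParts

  marks : List (Fin numParts → Bool)
  marks = allFamilies λ _ → bools

  markings : ∀ k → List (Fin k → Fin numParts → Bool)
  markings k = allFamilies λ _ → marks

  patterns : List Pattern
  patterns = cartesianProductWith _,_ (chains n) (markings n)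

  matches? : ∀ T y → Dec (Matches T y)
  matches? T y = map′ (λ (v , eq) → decode-matches v eq) (λ m → Matches.valid m , matches-decode m)
    (valid? y ×-dec Fin.all? λ i → Fin.all? λ j → Vec.≡-dec Bool._≟_ (T i j) (decode y i j))

  allFillings : List Filling
  allFillings = allFamilies λ i → allFamilies λ j → allSubsets n

  -- Both sides are sums over the matching pairs of a tableau and a pattern.
  grothendieck-patterns : grothendieck ≈ sumL patterns patternWeight
  grothendieck-patterns = begin
    sumL tableaux tableauWeight
      ≈⟨ sumL-filter isTableau? allFillings tableauWeight ⟩
    sumL allFillings (λ T → [ isTableau? T ]· tableauWeight T)
      ≈⟨ sumL-cong allFillings by-pattern ⟨
    sumL allFillings (λ T → sumL patterns λ y → [ matches? T y ]· tableauWeight T)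
      ≈⟨ sumL-swap allFillings patterns _ ⟩
    sumL patterns (λ y → sumL allFillings λ T → [ matches? T y ]· tableauWeight T)
      ≈⟨ sumL-cong patterns by-filling ⟩
    sumL patterns patternWeight ∎
    where
    by-pattern : ∀ T → sumL patterns (λ y → [ matches? T y ]· tableauWeight T) ≈ [ isTableau? T ]· tableauWeight T
    by-pattern T = cases (isTableau? T)
      where
      cases : (d : Dec (IsTableau T)) → sumL patterns (λ y → [ matches? T y ]· tableauWeight T) ≈ [ d ]·
        tableauWeight T
      cases (no ¬tableau) = sumL-0 patterns λ y → []·-no (matches? T y) (¬tableau ∘ matches⇒tableau)
      -- Up to pointwise equality `encode T` is the one listed pattern that matches; it is listed
      -- because its lengths are at most `size`.
      cases (yes tableau) = sample
        (samples-pairs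
          (samples-families {_~_ = λ f g → ∀ i → f i ≡ g i} λ r → samples-families {_~_ = _≡_} λ i →
            samples-upTo size (occupancy T (suc (toℕ r)) i)
              (ℕ.≤-trans (prefix-≤ (occupied? T (suc (toℕ r)) i)) (lookup≤sum parts i)))
          (samples-families {_~_ = λ f g → ∀ i → f i ≡ g i} λ r → samples-families {_~_ = _≡_} λ i →
            samples-bools (does (mark? T r i))))
        (λ y → [ matches? T y ]· tableauWeight T) (tableauWeight T)
        (λ y y≗ → []·-yes (matches? T y) (tableau⇒matches tableau y≗))
        (λ y y≭ → []·-no (matches? T y) (y≭ ∘ matches⇒encode))

    by-filling : ∀ y → sumL allFillings (λ T → [ matches? T y ]· tableauWeight T) ≈ patternWeight y
    by-filling y = cases (valid? y)
      where
      cases : Dec (Valid y) → sumL allFillings (λ T → [ matches? T y ]· tableauWeight T) ≈ patternWeight y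
      cases (no ¬valid) = trans (sumL-0 allFillings λ T → []·-no (matches? T y) (¬valid ∘ Matches.valid))
        (sym (patternWeight-invalid y ¬valid))
      cases (yes valid) = sample
        (samples-families {_~_ = λ f g → ∀ j → f j ≡ g j} λ i → samples-families {_~_ = _≡_} λ j →
          samples-subsets n (decode y i j))
        (λ T → [ matches? T y ]· tableauWeight T) (patternWeight y)
        (λ T eq → let m = decode-matches valid eq in trans ([]·-yes (matches? T y) m) (patternWeight-matches m))
        (λ T ≢ → []·-no (matches? T y) (≢ ∘ matches-decode))

  full : (Fin numParts → ℕ) → Carrier
  full p = [ Fin.all? (λ i → p i ℕ.≟ rowLength i) ]· 1#

  -- If the row below is shorter than `p`, both marks are possible, and 1 + β (x ⊕ b) = ⟨ x ⟩ ⟨ b ⟩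
  -- is the value of `gap`. At equal length only the unmarked step remains, and otherwise none.
  markedStep-sum : ∀ κ x p q v → sumL bools (markedStep κ x p q v) ≈ row κ x p q * gap κ x p v
  markedStep-sum κ x p q v = cases (p ℕ.≤? q)
    where
    w = run x (b ↓ (κ ℕ.+ p)) (q ∸ p)
    z = x ⊕ b (κ ℕ.+ (p ∸ 1))

    open IntegerCoefficients R using (solve; _:=_; _:+_; _:*_; _:-_; :-_; con)

    cases : (d : Dec (p ℕ.≤ q)) → [ d ]· [ v ℕ.+ 0 ℕ.≤? p ]· (w * 1#) + ([ d ]· [ v ℕ.+ 1 ℕ.≤? p ]·
      (w * (β * z)) + 0#) ≈
      ([ d ]· w) * gap κ x p v
    cases (no _)  = solve 1 (λ g → con (+ 0) :+ (con (+ 0) :+ con (+ 0)) := con (+ 0) :* g) refl _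
    cases (yes _) = by-position (ℕ.<-cmp v p)
      where
      0≤ : ∀ {v} → v ℕ.+ 0 ≡ v
      0≤ = ℕ.+-identityʳ _
      by-position : Tri (v ℕ.< p) (v ≡ p) (p ℕ.< v) →
        [ v ℕ.+ 0 ℕ.≤? p ]· (w * 1#) + ([ v ℕ.+ 1 ℕ.≤? p ]· (w * (β * z)) + 0#) ≈ w * gap κ x p v
      by-position (tri< v<p _ _) = begin
        [ v ℕ.+ 0 ℕ.≤? p ]· (w * 1#) + ([ v ℕ.+ 1 ℕ.≤? p ]· (w * (β * z)) + 0#)
          ≈⟨ +-cong ([]·-yes (v ℕ.+ 0 ℕ.≤? p) (ℕ.≤-trans (ℕ.≤-reflexive 0≤) (ℕ.<⇒≤ v<p)))
               (+-congʳ ([]·-yes (v ℕ.+ 1 ℕ.≤? p) (ℕ.≤-trans (ℕ.≤-reflexive (ℕ.+-comm v 1)) v<p))) ⟩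
        w * 1# + (w * (β * z) + 0#)
          ≈⟨ solve 4 (λ w β x b → w :* con (+ 1) :+ (w :* (β :* (x :+ b :+ β :* x :* b)) :+ con (+ 0)) :=
               w :* ((con (+ 1) :+ β :* x) :* (con (+ 1) :+ β :* b))) refl w β x _ ⟩
        w * (⟨ x ⟩ * ⟨ b (κ ℕ.+ (p ∸ 1)) ⟩)
          ≈⟨ *-congˡ (gap-below κ x v<p) ⟨
        w * gap κ x p v ∎
      by-position (tri≈ _ v≡p _) = begin
        [ v ℕ.+ 0 ℕ.≤? p ]· (w * 1#) + ([ v ℕ.+ 1 ℕ.≤? p ]· (w * (β * z)) + 0#)
          ≈⟨ +-cong ([]·-yes (v ℕ.+ 0 ℕ.≤? p) (ℕ.≤-reflexive (≡.trans 0≤ v≡p)))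
               (+-congʳ ([]·-no (v ℕ.+ 1 ℕ.≤? p) λ le → ℕ.<-irrefl v≡p
                 (ℕ.≤-trans (ℕ.≤-reflexive (ℕ.+-comm 1 v)) le))) ⟩
        w * 1# + (0# + 0#)
          ≈⟨ trans (+-congˡ (+-identityˡ _)) (+-identityʳ _) ⟩
        w * 1#
          ≈⟨ *-congˡ (gap-at κ x v≡p) ⟨
        w * gap κ x p v ∎
      by-position (tri> _ _ p<v) = begin
        [ v ℕ.+ 0 ℕ.≤? p ]· (w * 1#) + ([ v ℕ.+ 1 ℕ.≤? p ]· (w * (β * z)) + 0#)
          ≈⟨ +-cong ([]·-no (v ℕ.+ 0 ℕ.≤? p) λ le → ℕ.<⇒≱ p<v (ℕ.≤-trans (ℕ.m≤m+n v 0) le))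
               (+-congʳ ([]·-no (v ℕ.+ 1 ℕ.≤? p) λ le → ℕ.<⇒≱ p<v (ℕ.≤-trans (ℕ.m≤m+n v 1) le))) ⟩
        0# + (0# + 0#)
          ≈⟨ trans (+-identityˡ _) (+-identityˡ _) ⟩
        0#
          ≈⟨ zeroʳ w ⟨
        w * 0#
          ≈⟨ *-congˡ (gap-above κ x p<v) ⟨
        w * gap κ x p v ∎

  step-product : ∀ h r x (p q : Fin h → ℕ) → step r x h p q ≈
    product λ i → row (rowsBelow i ℕ.+ r) x (p i) (q i) * gap (rowsBelow i ℕ.+ r) x (p i) (after q i)
  step-product zero    r x p q = refl
  step-product (suc h) r x p q = *-congˡ (step-product h r x (p ∘ suc) (q ∘ suc))

  chainWeight : ∀ {k} → (Fin k → ℕ) → (Fin k → Carrier) → (Fin numParts → ℕ) →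
    (Fin k → Fin numParts → ℕ) → (Fin k → Fin numParts → Bool) → Carrier
  chainWeight {k} ρ xs p P e = product (λ r → product λ i → markedStep (rowsBelow i ℕ.+ ρ r) (xs r)
    (states p P (toℕ r) i) (states p P (suc (toℕ r)) i) (after (states p P (suc (toℕ r))) i) (e r i)) * full
      (states p P k)

  -- Induction removes the first letter, so the position of a letter is generalized to `ρ`, counted
  -- from `r₀`. The marks of one step are summed row by row, which turns a product of marked steps
  -- into `step`.
  sum-chainWeight : ∀ k (ρ : Fin k → ℕ) xs p r₀ → (∀ r → ρ r ≡ r₀ ℕ.+ toℕ r) →
    sumL (chains k) (λ P → sumL (markings k) λ e → chainWeight ρ xs p P e) ≈
    chainSum full r₀ (List.tabulate xs) p
  sum-chainWeight zero ρ xs p r₀ eq = trans (+-identityʳ _) (trans (+-identityʳ _) (*-identityˡ _))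
  sum-chainWeight (suc k) ρ xs p r₀ eq = trans (sumL-product _ (families numParts) (chains k) _)
    (sumL-cong (families numParts) λ q → trans
      (sumL-cong (chains k) λ P → trans (sumL-product _ marks (markings k) _)
        (trans (sumL-cong marks λ e₀ → trans (sumL-cong (markings k) λ e → *-assoc _ _ _)
          (sym (*-sumL (first q e₀) (markings k) _)))
          (sym (sumL-* marks (first q) _))))
      (begin
        sumL (chains k) (λ P → sumL marks (first q) * sumL (markings k) λ e → chainWeight (ρ ∘ suc)
          (xs ∘ suc) q P e)
          ≈⟨ *-sumL (sumL marks (first q)) (chains k) _ ⟨
        sumL marks (first q) * sumL (chains k) (λ P → sumL (markings k) λ e → chainWeight (ρ ∘ suc)
          (xs ∘ suc) q P e)
          ≈⟨ *-cong (first≈ q) (sum-chainWeight k (ρ ∘ suc) (xs ∘ suc) q (suc r₀) (λ r → ≡.trans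
            (eq (suc r)) (ℕ.+-suc r₀ (toℕ r)))) ⟩
        step r₀ (xs zero) numParts p q * chainSum full (suc r₀) (List.tabulate (xs ∘ suc)) q ∎))
    where
    first : (Fin numParts → ℕ) → (Fin numParts → Bool) → Carrier
    first q e₀ = product λ i → markedStep (rowsBelow i ℕ.+ ρ zero) (xs zero) (p i) (q i) (after q i) (e₀ i)

    first≈ : ∀ q → sumL marks (first q) ≈ step r₀ (xs zero) numParts p q
    first≈ q = begin
      sumL marks (first q)
        ≈⟨ sumL-families (λ _ → bools) (λ i e → markedStep (rowsBelow i ℕ.+ ρ zero) (xs zero) (p i) (q i)
          (after q i) e) ⟩
      product (λ i → sumL bools (markedStep (rowsBelow i ℕ.+ ρ zero) (xs zero) (p i) (q i) (after q i)))
        ≈⟨ P.sum-cong numParts (λ i → trans (markedStep-sum _ (xs zero) (p i) (q i) (after q i))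
             (reflexive (≡.cong (λ κ → row κ (xs zero) (p i) (q i) * gap κ (xs zero) (p i) (after q i))
               (≡.cong (rowsBelow i ℕ.+_) (≡.trans (eq zero) (ℕ.+-identityʳ r₀)))))) ⟩
      product (λ i → row (rowsBelow i ℕ.+ r₀) (xs zero) (p i) (q i) * gap (rowsBelow i ℕ.+ r₀) (xs zero)
        (p i) (after q i))
        ≈⟨ step-product numParts r₀ (xs zero) p q ⟨
      step r₀ (xs zero) numParts p q ∎

  grothendieck-chains : grothendieck ≈ chainSum full 0 (List.tabulate x) (λ _ → 0)
  grothendieck-chains = trans grothendieck-patterns
    (trans (sumL-product _,_ (chains n) (markings n) patternWeight)
      (sum-chainWeight n toℕ x (λ _ → 0) 0 (λ _ → ≡.refl)))

module _ {c ℓ} (R : CommutativeRing c ℓ) (β : CommutativeRing.Carrier R) (n : ℕ)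
    (a : ℕ → CommutativeRing.Carrier R) (μ : Partition) where
  open CommutativeRing R
  open GrothendieckSums R β n

  grothendieck-symmetric : ∀ {x y : Fin n → Carrier} → List.tabulate x ↭ List.tabulate y →
    grothendieck x a μ ≈ grothendieck y a μ
  grothendieck-symmetric {x} {y} x↭y = trans (grothendieck-chains x a μ)
    (trans (ChainSums.chainSum-↭ R β _ _ (full x a μ) x↭y 0 (λ _ → 0)) (sym (grothendieck-chains y a μ)))

-- Change of rings, and the degree in one variable

predecessor : ∀ {h} (i : Fin h) → 0 ℕ.< toℕ i → Σ[ i₀ ∈ Fin h ] toℕ i ≡ suc (toℕ i₀)
predecessor (suc i) _ = Fin.inject₁ i , ≡.cong suc (≡.sym (Fin.toℕ-inject₁ i))

module _ {c₁ ℓ₁ c₂ ℓ₂} {R : CommutativeRing c₁ ℓ₁} {S : CommutativeRing c₂ ℓ₂} (h : Homomorphism R S) where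
  open Homomorphism h
  private
    module R = CommutativeRing R
    module S = CommutativeRing S
    module RΣ = ListSum R
    module SΣ = ListSum S
    module RP = RawSemiringDefinitions (RawRing.rawSemiring R.rawRing)
    module SP = RawSemiringDefinitions (RawRing.rawSemiring S.rawRing)

  sumL-homo : ∀ {a} {A : Set a} (xs : List A) {f : A → R.Carrier} {g : A → S.Carrier} → (∀ x → ⟦ f x ⟧ S.≈ g
    x) → ⟦ RΣ.sumL xs f ⟧ S.≈ SΣ.sumL xs g
  sumL-homo []       eq = 0-homo
  sumL-homo (x ∷ xs) eq = S.trans (+-homo _ _) (S.+-cong (eq x) (sumL-homo xs eq))

  product-homo : ∀ k {f : Fin k → R.Carrier} {g} → (∀ i → ⟦ f i ⟧ S.≈ g i) → ⟦ RP.product f ⟧ S.≈ SP.product g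
  product-homo zero    eq = 1-homo
  product-homo (suc k) eq = S.trans (*-homo _ _) (S.*-cong (eq zero) (product-homo k (eq ∘ suc)))

  power-homo : ∀ k {x y} → ⟦ x ⟧ S.≈ y → ⟦ x RP.^ k ⟧ S.≈ y SP.^ k
  power-homo zero    eq = 1-homo
  power-homo (suc k) eq = S.trans (*-homo _ _) (S.*-cong eq (power-homo k eq))

  foldr-homo : ∀ {a} {A : Set a} (xs : List A) {f : A → R.Carrier} {g : A → S.Carrier} → (∀ x → ⟦ f x ⟧ S.≈ g x) →
    ⟦ foldr (λ r p → f r R.* p) R.1# xs ⟧ S.≈ foldr (λ r p → g r S.* p) S.1# xs
  foldr-homo []       eq = 1-homo
  foldr-homo (x ∷ xs) eq = S.trans (*-homo _ _) (S.*-cong (eq x) (foldr-homo xs eq))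

  -- Applied to permutations of the variables, to the passage from polynomials in the parameters to
  -- fractions, and to the specialization at the origin.
  grothendieck-homo : ∀ {β β′ n x x′ a a′} → ⟦ β ⟧ S.≈ β′ → (∀ r → ⟦ x r ⟧ S.≈ x′ r) → (∀ k → ⟦ a k ⟧ S.≈ a′
    k) → ∀ μ →
    ⟦ GrothendieckSums.grothendieck R β n x a μ ⟧ S.≈ GrothendieckSums.grothendieck S β′ n x′ a′ μ
  grothendieck-homo {n = n} β≈ x≈ a≈ μ = sumL-homo (SetValuedTableaux.tableaux n μ) λ T →
    S.trans (*-homo _ _) (S.*-cong (power-homo (SetValuedTableaux.weight n μ T ∸ Partition.size μ) β≈)
      (product-homo _ λ i → product-homo _ λ j → foldr-homo (filter (_∈ₛ? T i j) (allFin n)) λ r →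
      S.trans (+-homo _ _) (S.+-cong (S.trans (+-homo _ _) (S.+-cong (x≈ r) (a≈ _)))
        (S.trans (*-homo _ _) (S.*-cong (S.trans (*-homo _ _) (S.*-cong β≈ (x≈ r))) (a≈ _))))))

module Degrees {c ℓ} (R : CommutativeRing c ℓ) (n : ℕ) (v : Fin n) where
  open PolynomialRing R (Fin._≟_ {n})
  open RawRing polyRing using (_+_; _*_; 1#)
  open RawSemiringDefinitions (RawRing.rawSemiring polyRing) using (product; _^_)
  private module R = CommutativeRing R
  open ListSum R using (sumL-0; []·-no)

  -- A bound for all listed terms, including those with vanishing or cancelling coefficients, so
  -- that it follows the list operations without any test for zero.
  Degree≤ : ℕ → Poly → Set _
  Degree≤ d p = ∀ {t} → t ∈ p → exponent v (proj₂ t) ℕ.≤ d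

  coefficient-zero : ∀ {d} p w → Degree≤ d p → d ℕ.< exponent v w → coefficient p w R.≈ R.0#
  coefficient-zero []            w deg d<w = R.refl
  coefficient-zero ((b , u) ∷ p) w deg d<w = R.trans (R.+-cong
      ([]·-no (w ≈ₘ? u) λ eq → ℕ.<⇒≱ d<w (ℕ.≤-trans (ℕ.≤-reflexive (exponents (≈ₘ⇒∼ w u eq) v))
        (deg (here ≡.refl))))
      (coefficient-zero p w (λ t∈ → deg (there t∈)) d<w)) (R.+-identityˡ _)

  degree-+ : ∀ {d p q} → Degree≤ d p → Degree≤ d q → Degree≤ d (p + q)
  degree-+ {p = p} deg deg′ t∈ with ∈.∈-++⁻ p t∈
  ... | inj₁ t∈p = deg t∈p
  ... | inj₂ t∈q = deg′ t∈q

  degree-* : ∀ {d d′ p q} → Degree≤ d p → Degree≤ d′ q → Degree≤ (d ℕ.+ d′) (p * q)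
  degree-* {p = p} {q} deg deg′ t∈ with ∈.∈-cartesianProductWith⁻ _ p q t∈
  ... | (_ , u) , (_ , w) , s∈ , s′∈ , ≡.refl = ℕ.≤-trans (ℕ.≤-reflexive (exponent-++ v u w))
    (ℕ.+-mono-≤ (deg s∈) (deg′ s′∈))

  degree-weaken : ∀ {d d′ p} → d ℕ.≤ d′ → Degree≤ d p → Degree≤ d′ p
  degree-weaken le deg t∈ = ℕ.≤-trans (deg t∈) le

  degree-constant : ∀ b → Degree≤ 0 (constant b)
  degree-constant b (here ≡.refl) = z≤n

  degree-var : ∀ r → Degree≤ (exponent v (r ∷ [])) (var r)
  degree-var r (here ≡.refl) = ℕ.≤-refl

  degree-power : ∀ k b → Degree≤ 0 (constant b ^ k)
  degree-power zero    b = degree-constant R.1#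
  degree-power (suc k) b = degree-* {p = constant b} (degree-constant b) (degree-power k b)

  degree-product : ∀ {k} (f : Fin k → Poly) (d : Fin k → ℕ) → (∀ i → Degree≤ (d i) (f i)) →
    Degree≤ (RawMonoidDefinitions.sum ℕ.+-0-rawMonoid d) (product f)
  degree-product {zero}  f d deg = degree-constant R.1#
  degree-product {suc k} f d deg = degree-* {p = f zero} (deg zero) (degree-product (f ∘ suc) (d ∘ suc) (deg ∘ suc))

  exponent-tabulate-< : ∀ {k} (g : Fin k → Fin n) → (∀ i j → g i ≡ g j → i ≡ j) → exponent v (List.tabulate g) ℕ.≤ 1
  exponent-tabulate-< {zero}  g inj = z≤n
  exponent-tabulate-< {suc k} g inj with v Fin.≟ g zero
  ... | no _   = exponent-tabulate-< (g ∘ suc) (λ i j eq → Fin.suc-injective (inj (suc i) (suc j) eq))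
  ... | yes v≡ = s≤s (ℕ.≤-reflexive (absent (g ∘ suc) λ i eq → Fin.0≢1+n (inj zero (suc i)
    (≡.trans (≡.sym v≡) eq))))
    where
    absent : ∀ {k} (g : Fin k → Fin n) → (∀ i → v ≢ g i) → exponent v (List.tabulate g) ≡ 0
    absent {zero}  g v≢ = ≡.refl
    absent {suc k} g v≢ = ≡.trans (exponent-there (List.tabulate (g ∘ suc)) (v≢ zero)) (absent (g ∘ suc) (v≢ ∘ suc))

  exponent-filter : ∀ {Q : Fin n → Set} (Q? : ∀ r → Dec (Q r)) w → exponent v (filter Q? w) ℕ.≤ exponent v w
  exponent-filter Q? []      = z≤n
  exponent-filter Q? (r ∷ w) with does (Q? r) | v Fin.≟ r in eq
  ... | true  | yes _ rewrite eq = s≤s (exponent-filter Q? w)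
  ... | true  | no _  rewrite eq = exponent-filter Q? w
  ... | false | yes _ = ℕ.m≤n⇒m≤1+n (exponent-filter Q? w)
  ... | false | no _  = exponent-filter Q? w

  exponent-filter-∉ : ∀ {Q : Fin n → Set} (Q? : ∀ r → Dec (Q r)) → ¬ Q v → ∀ w → exponent v (filter Q? w) ≡ 0
  exponent-filter-∉ Q? ¬Qv []      = ≡.refl
  exponent-filter-∉ Q? ¬Qv (r ∷ w) with Q? r
  ... | no _   = exponent-filter-∉ Q? ¬Qv w
  ... | yes Qr = ≡.trans (exponent-there {v} {r} (filter Q? w) λ { ≡.refl → ¬Qv Qr }) (exponent-filter-∉ Q? ¬Qv w)

  module _ (β : R.Carrier) (a : ℕ → R.Carrier) (μ : Partition) (v≡0 : toℕ v ≡ 0) where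
    open Partition μ
    open SetValuedTableaux n μ
    open GrothendieckSums polynomialRing (constant β) n var (λ k → constant (a k)) μ

    degree-box : ∀ r i j → Degree≤ (exponent v (r ∷ [])) (boxWeight r i j)
    degree-box r i j = degree-+ {p = var r + z} (degree-+ {p = var r} (degree-var r) (degree-weaken {p = z}
      z≤n (degree-constant _)))
      (degree-weaken {p = constant β * var r * z} (ℕ.≤-reflexive (ℕ.+-identityʳ _))
        (degree-* {p = constant β * var r} (degree-* {p = constant β} (degree-constant β) (degree-var r))
          (degree-constant _)))
      where z = constant (a (toℕ r ℕ.+ j ∸ toℕ i))

    degree-boxes : ∀ i j w → Degree≤ (exponent v w) (foldr (λ r p → boxWeight r i j * p) 1# w)
    degree-boxes i j []      = degree-constant R.1#
    degree-boxes i j (r ∷ w) = degree-weaken (ℕ.≤-reflexive (≡.sym (exponent-++ v (r ∷ []) w)))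
      (degree-* {p = boxWeight r i j} (degree-box r i j) (degree-boxes i j w))

    count : Filling → ℕ
    count T = RawMonoidDefinitions.sum ℕ.+-0-rawMonoid λ i → RawMonoidDefinitions.sum ℕ.+-0-rawMonoid λ j →
      exponent v (filter (_∈ₛ? T i j) (allFin n))

    degree-tableau : ∀ T → Degree≤ (count T) (tableauWeight T)
    degree-tableau T = degree-* {p = constant β ^ (weight T ∸ size)} (degree-power (weight T ∸ size) β)
      (degree-product _ _ λ i → degree-product _ _ λ j → degree-boxes i (toℕ j) (filter (_∈ₛ? T i j) (allFin n)))

    below-first : ∀ {T} → IsTableau T → ∀ i j → 0 ℕ.< toℕ i → ¬ (v ∈ₛ T i j)
    below-first {T} (nonempty , _ , strict) i j 0<i v∈ =
      ℕ.<⇒≱ (strict i₀ i j₀ j i≡ (Fin.toℕ-inject≤ j le) s v s∈ v∈) (≡.subst (ℕ._≤ toℕ s) (≡.sym v≡0) z≤n)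
      where
      i₀ = proj₁ (predecessor i 0<i)
      i≡ = proj₂ (predecessor i 0<i)
      le = lookup-decreasing decreasing i₀ i i≡
      j₀ = Fin.inject≤ j le
      s  = proj₁ (nonempty i₀ j₀)
      s∈ = proj₂ (nonempty i₀ j₀)

    count-≤ : ∀ {T} → IsTableau T → count T ℕ.≤ next rowLength
    count-≤ {T} tableau = sum-first _ first rest
      where
      sum = RawMonoidDefinitions.sum ℕ.+-0-rawMonoid
      sum-1 : ∀ {L} (f : Fin L → ℕ) → (∀ j → f j ℕ.≤ 1) → sum f ℕ.≤ L
      sum-1 {zero}  f le = z≤n
      sum-1 {suc L} f le = ℕ.+-mono-≤ (le zero) (sum-1 (f ∘ suc) (le ∘ suc))
      sum-0 : ∀ {L} (f : Fin L → ℕ) → (∀ j → f j ≡ 0) → sum f ≡ 0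
      sum-0 {zero}  f eq = ≡.refl
      sum-0 {suc L} f eq = ≡.cong₂ ℕ._+_ (eq zero) (sum-0 (f ∘ suc) (eq ∘ suc))
      sum-first : ∀ {h} {λs : Fin h → ℕ} (f : Fin h → ℕ) → (∀ i → toℕ i ≡ 0 → f i ℕ.≤ λs i) →
        (∀ i → 0 ℕ.< toℕ i → f i ≡ 0) → sum f ℕ.≤ next λs
      sum-first {zero}  f first rest = z≤n
      sum-first {suc h} f first rest = ℕ.≤-trans (ℕ.≤-reflexive (≡.trans (≡.cong (f zero ℕ.+_)
        (sum-0 (f ∘ suc) λ i → rest (suc i) (s≤s z≤n))) (ℕ.+-identityʳ _))) (first zero ≡.refl)
      first : ∀ i → toℕ i ≡ 0 → sum (λ j → exponent v (filter (_∈ₛ? T i j) (allFin n))) ℕ.≤ rowLength i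
      first i _ = sum-1 _ λ j → ℕ.≤-trans (exponent-filter (_∈ₛ? T i j) (allFin n)) (exponent-tabulate-< id
        λ _ _ → id)
      rest : ∀ i → 0 ℕ.< toℕ i → sum (λ j → exponent v (filter (_∈ₛ? T i j) (allFin n))) ≡ 0
      rest i 0<i = sum-0 _ λ j → exponent-filter-∉ (_∈ₛ? T i j) (below-first tableau i j 0<i) (allFin n)

    degree-grothendieck : ∀ w → next rowLength ℕ.< exponent v w → coefficient grothendieck w R.≈ R.0#
    degree-grothendieck w <w = coefficient-zero grothendieck w
      (degree-sum (λ T∈ → proj₂ (∈.∈-filter⁻ isTableau? {xs = allFillings} T∈))) <w
      where
      degree-sum : ∀ {Ts} → (∀ {T} → T ∈ Ts → IsTableau T) → Degree≤ (next rowLength)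
        (foldr (λ T p → tableauWeight T + p) [] Ts)
      degree-sum {[]}     tableaux ()
      degree-sum {T ∷ Ts} tableaux = degree-+ {p = tableauWeight T}
        (degree-weaken {p = tableauWeight T} (count-≤ (tableaux (here ≡.refl))) (degree-tableau T))
          (degree-sum (λ T∈ → tableaux (there T∈)))

-- Lowest terms and the leading tableau

entry : List ℕ → ℕ → ℕ
entry []       _       = 0
entry (x ∷ xs) zero    = x
entry (x ∷ xs) (suc k) = entry xs k

module ℕΣ = CommutativeMonoidSum ℕ.+-0-commutativeMonoid
module ℕP = BoxProducts ℕ.+-0-commutativeMonoid

sum-mono : ∀ {k} {f g : Fin k → ℕ} → (∀ i → f i ℕ.≤ g i) → ℕΣ.sum f ℕ.≤ ℕΣ.sum g
sum-mono {zero}  le = z≤n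
sum-mono {suc k} le = ℕ.+-mono-≤ (le zero) (sum-mono (le ∘ suc))

sum-tight : ∀ {k} {f g : Fin k → ℕ} → (∀ i → f i ℕ.≤ g i) → ℕΣ.sum g ℕ.≤ ℕΣ.sum f → ∀ i → f i ≡ g i
sum-tight {suc k} {f} {g} le ≥ i = pointwise i
  where
  head-≥ : g zero ℕ.≤ f zero
  head-≥ = ℕ.≮⇒≥ λ lt → ℕ.<⇒≱ (ℕ.+-mono-<-≤ lt (sum-mono (le ∘ suc))) ≥
  tail-≥ : ℕΣ.sum (g ∘ suc) ℕ.≤ ℕΣ.sum (f ∘ suc)
  tail-≥ = ℕ.≮⇒≥ λ lt → ℕ.<⇒≱ (ℕ.+-mono-≤-< (le zero) lt) ≥
  pointwise : ∀ i → f i ≡ g i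
  pointwise zero    = ℕ.≤-antisym (le zero) head-≥
  pointwise (suc i) = sum-tight (le ∘ suc) tail-≥ i

sum-1 : ∀ k → ℕΣ.sum {k} (λ _ → 1) ≡ k
sum-1 zero    = ≡.refl
sum-1 (suc k) = ≡.cong suc (sum-1 k)

sum-0 : ∀ k → ℕΣ.sum {k} (λ _ → 0) ≡ 0
sum-0 k = ℕP.sum-ε k λ _ → ≡.refl

sum-δ : ∀ {k} (r : Fin k) (f : Fin k → ℕ) → ℕΣ.sum (λ s → if does (s Fin.≟ r) then f s else 0) ≡ f r
sum-δ {suc k} zero    f = ≡.trans (≡.cong (f zero ℕ.+_) (sum-0 k)) (ℕ.+-identityʳ _)
sum-δ {suc k} (suc r) f = sum-δ r (f ∘ suc)

sum-entry : ∀ xs k → ℕΣ.sum (λ (i : Fin (length xs)) → ℕΣ.sum (λ (j : Fin (List.lookup xs i)) → if does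
  (k ℕ.≟ toℕ i) then 1 else 0)) ≡ entry xs k
sum-entry []       k    = ≡.refl
sum-entry (x ∷ xs) zero = ≡.trans (≡.cong₂ ℕ._+_ (sum-1 x) (ℕP.sum-ε _ λ i → sum-0 (List.lookup xs i)))
  (ℕ.+-identityʳ x)
sum-entry (x ∷ xs) (suc k) = ≡.trans (≡.cong (ℕ._+ ℕΣ.sum (λ (i : Fin (length xs)) → ℕΣ.sum
  (λ (j : Fin (List.lookup xs i)) → if does (k ℕ.≟ toℕ i) then 1 else 0))) (sum-0 x)) (sum-entry xs k)

nonempty-size : ∀ {n} {S : Subset n} → Nonempty S → 1 ℕ.≤ ∣ S ∣
nonempty-size {S = true Vec.∷ S}  _                      = s≤s z≤n
nonempty-size {S = false Vec.∷ S} (suc r , Vec.there r∈) = nonempty-size (r , r∈)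

module Words (n : ℕ) where
  open Monomials (Fin._≟_ {n})

  -- Exponents and the statistic of the triangularity are both values of this additive functional,
  -- for `indicator` and for `depth`. Recording it for all `f` treats them together.
  weigh : (Fin n → ℕ) → List (Fin n) → ℕ
  weigh f w = ListAction.sum (List.map f w)

  weigh-++ : ∀ f u w → weigh f (u ++ w) ≡ weigh f u ℕ.+ weigh f w
  weigh-++ f []      w = ≡.refl
  weigh-++ f (r ∷ u) w = ≡.trans (≡.cong (f r ℕ.+_) (weigh-++ f u w)) (≡.sym (ℕ.+-assoc (f r) _ _))

  indicator : Fin n → Fin n → ℕ
  indicator s r = if does (s Fin.≟ r) then 1 else 0

  exponent-∷ : ∀ s r w → exponent s (r ∷ w) ≡ indicator s r ℕ.+ exponent s w
  exponent-∷ s r w with s Fin.≟ r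
  ... | yes _ = ≡.refl
  ... | no _  = ≡.refl

  exponent-weigh : ∀ s w → exponent s w ≡ weigh (indicator s) w
  exponent-weigh s []      = ≡.refl
  exponent-weigh s (r ∷ w) = ≡.trans (exponent-∷ s r w) (≡.cong (indicator s r ℕ.+_) (exponent-weigh s w))

  weigh-exponents : ∀ f w → weigh f w ≡ ℕΣ.sum λ s → exponent s w ℕ.* f s
  weigh-exponents f []      = ≡.sym (sum-0 n)
  weigh-exponents f (r ∷ w) = ≡.sym (≡.trans (ℕP.sum-cong n each) (≡.trans (ℕΣ.∑-distrib-+ {n} _ _)
      (≡.cong₂ ℕ._+_ (sum-δ r f) (≡.sym (weigh-exponents f w)))))
    where
    times : ∀ {P : Set} (d : Dec P) y → (if does d then 1 else 0) ℕ.* y ≡ (if does d then y else 0)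
    times (yes _) y = ℕ.+-identityʳ y
    times (no _)  y = ≡.refl
    each : ∀ s → exponent s (r ∷ w) ℕ.* f s ≡ (if does (s Fin.≟ r) then f s else 0) ℕ.+ exponent s w ℕ.* f s
    each s = ≡.trans (≡.cong (ℕ._* f s) (exponent-∷ s r w)) (≡.trans (ℕ.*-distribʳ-+ (f s) (indicator s r) _)
      (≡.cong (ℕ._+ exponent s w ℕ.* f s) (times (s Fin.≟ r) (f s))))

  weigh-∼ : ∀ f {u w} → u ∼ w → weigh f u ≡ weigh f w
  weigh-∼ f {u} {w} u∼w = ≡.trans (weigh-exponents f u) (≡.trans
    (ℕP.sum-cong n λ s → ≡.cong (ℕ._* f s) (exponents u∼w s)) (≡.sym (weigh-exponents f w)))

  elements : Subset n → List (Fin n)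
  elements S = filter (_∈ₛ? S) (allFin n)

  private
    weigh-filter : ∀ {k} (f : Fin n → ℕ) {Q : Fin n → Set} (Q? : ∀ r → Dec (Q r)) (g : Fin k → Fin n) →
      weigh f (filter Q? (List.tabulate g)) ≡ ℕΣ.sum λ r → if does (Q? (g r)) then f (g r) else 0
    weigh-filter {zero}  f Q? g = ≡.refl
    weigh-filter {suc k} f Q? g with does (Q? (g zero))
    ... | true  = ≡.cong (f (g zero) ℕ.+_) (weigh-filter f Q? (g ∘ suc))
    ... | false = weigh-filter f Q? (g ∘ suc)

    empty : ∀ {m} (S : Subset m) → ∣ S ∣ ≡ 0 → (∀ r → ¬ (r ∈ₛ S)) × (∀ (f : Fin m → ℕ) → ℕΣ.sum
      (λ r → if does (r ∈ₛ? S) then f r else 0) ≡ 0)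
    empty Vec.[] _ = (λ ()) , λ f → ≡.refl
    empty (false Vec.∷ S) eq = (λ { (suc r) (Vec.there r∈) → proj₁ (empty S eq) r r∈ }) , λ f → proj₂
      (empty S eq) (f ∘ suc)

    single : ∀ {m} (S : Subset m) → ∣ S ∣ ≡ 1 → Σ[ r₀ ∈ Fin m ] r₀ ∈ₛ S × (∀ r → r ∈ₛ S → r ≡ r₀) ×
      (∀ (f : Fin m → ℕ) → ℕΣ.sum (λ r → if does (r ∈ₛ? S) then f r else 0) ≡ f r₀)
    single (true Vec.∷ S) eq with empty S (ℕ.suc-injective eq)
    ... | none , zero′ = zero , Vec.here , (λ { zero _ → ≡.refl ; (suc r) (Vec.there r∈) → contradiction r∈
      (none r) }) ,
      λ f → ≡.trans (≡.cong (f zero ℕ.+_) (zero′ (f ∘ suc))) (ℕ.+-identityʳ _)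
    single (false Vec.∷ S) eq with single S eq
    ... | r₀ , r₀∈ , unique , total = suc r₀ , Vec.there r₀∈ , (λ { (suc r) (Vec.there r∈) → ≡.cong suc
      (unique r r∈) }) , λ f → total (f ∘ suc)

  singleton : ∀ S → ∣ S ∣ ≡ 1 → Σ[ r ∈ Fin n ] r ∈ₛ S × S ≡ ⁅ r ⁆ × (∀ f → weigh f (elements S) ≡ f r)
  singleton S eq with single S eq
  ... | r , r∈ , unique , total = r , r∈ ,
    ⊆-antisym (λ {s} s∈ → ≡.subst (λ r → s ∈ₛ ⁅ r ⁆) (unique s s∈) (x∈⁅x⁆ s)) (λ s∈ → ≡.subst (_∈ₛ S)
      (≡.sym (x∈⁅y⁆⇒x≡y r s∈)) r∈) ,
    λ f → ≡.trans (weigh-filter f (_∈ₛ? S) id) (total f)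

-- At β = a = 0 only the tableaux with one entry in each box contribute, each a monomial.
module LowestTerms {c ℓ} (R : CommutativeRing c ℓ) (n : ℕ) (μ : Partition) (μ≤n : Partition.numParts μ ℕ.≤ n) where
  open PolynomialRing R (Fin._≟_ {n})
  open Words n
  open Partition μ
  open SetValuedTableaux n μ
  private
    module R = CommutativeRing R
    module P = CommutativeRing polynomialRing
    module PS = IntegerCoefficients polynomialRing
  open GrothendieckSums polynomialRing P.0# n var (λ _ → P.0#) μ
  open RawSemiringDefinitions (RawRing.rawSemiring polyRing) using (product; _^_)
  open ListSum R

  depth : Fin n → ℕ
  depth r = n ∸ toℕ r

  -- The value of `depth` on the monomial of the tableau with all entries of row i equal to i; by
  -- `content-≤` it is the largest value.
  rank : ℕ
  rank = ℕΣ.sum λ (i : Fin numParts) → ℕΣ.sum λ (j : Fin (rowLength i)) → n ∸ toℕ i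

  monomial : Monomial → Poly
  monomial u = (R.1# , u) ∷ []

  -- The function `E` records the word up to reordering without naming it: it is additive under
  -- products, and its values at the indicators are the exponents.
  record IsMonomial (p : Poly) (E : (Fin n → ℕ) → ℕ) : Set (c ⊔ ℓ) where
    field
      word    : Monomial
      ≈word   : p P.≈ monomial word
      weighed : ∀ f → weigh f word ≡ E f
  open IsMonomial

  exponent-word : ∀ {p E} (m : IsMonomial p E) s → exponent s (word m) ≡ E (indicator s)
  exponent-word m s = ≡.trans (exponent-weigh s (word m)) (weighed m (indicator s))

  monomial-* : ∀ u w → monomial u P.* monomial w P.≈ monomial (u ++ w)
  monomial-* u w v = R.+-congʳ ([]·-cong (v ≈ₘ? (u ++ w)) (v ≈ₘ? (u ++ w)) id id (λ _ → R.*-identityʳ _))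

  1-isMonomial : ∀ {p} → p P.≈ P.1# → IsMonomial p (λ _ → 0)
  1-isMonomial eq = record { word = [] ; ≈word = eq ; weighed = λ f → ≡.refl }

  *-isMonomial : ∀ {p q E E′} → IsMonomial p E → IsMonomial q E′ → IsMonomial (p P.* q) (λ f → E f ℕ.+ E′ f)
  *-isMonomial {p} {q} m m′ = record
    { word = word m ++ word m′
    ; ≈word = P.trans {p P.* q} {monomial (word m) P.* monomial (word m′)} {monomial (word m ++ word m′)}
        (P.*-cong {p} {monomial (word m)} {q} {monomial (word m′)} (≈word m) (≈word m′))
          (monomial-* (word m) (word m′))
    ; weighed = λ f → ≡.trans (weigh-++ f (word m) (word m′)) (≡.cong₂ ℕ._+_ (weighed m f) (weighed m′ f))
    }

  product-isMonomial : ∀ {k} {p : Fin k → Poly} {E : Fin k → (Fin n → ℕ) → ℕ} → (∀ i → IsMonomial (p i) (E i)) →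
    IsMonomial (product p) (λ f → ℕΣ.sum λ i → E i f)
  product-isMonomial {zero}  m = 1-isMonomial (λ _ → R.refl)
  product-isMonomial {suc k} {p} m = *-isMonomial {p zero} (m zero) (product-isMonomial (m ∘ suc))

  box≈var : ∀ r i j → boxWeight r i j P.≈ var r
  box≈var r i j = PS.solve 1 (λ x → x PS.:+ PS.con (+ 0) PS.:+ PS.con (+ 0) PS.:* x PS.:* PS.con (+ 0) PS.:=
    x) (λ _ → R.refl) (var r)

  boxes-isMonomial : ∀ i j w → IsMonomial (foldr (λ r p → boxWeight r i j P.* p) P.1# w) (λ f → weigh f w)
  boxes-isMonomial i j []      = 1-isMonomial (λ _ → R.refl)
  boxes-isMonomial i j (r ∷ w) = *-isMonomial {boxWeight r i j} {E = λ f → f r}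
    (record { word = r ∷ [] ; ≈word = box≈var r i j ; weighed = λ f → ℕ.+-identityʳ _ }) (boxes-isMonomial i j w)

  content : Filling → (Fin n → ℕ) → ℕ
  content T f = ℕΣ.sum λ i → ℕΣ.sum λ j → weigh f (elements (T i j))

  tableau-isMonomial : ∀ T → weight T ≡ size → IsMonomial (tableauWeight T) (content T)
  tableau-isMonomial T eq = *-isMonomial {P.0# ^ (weight T ∸ size)} {E = λ _ → 0}
    (1-isMonomial {P.0# ^ (weight T ∸ size)} power) (product-isMonomial λ i → product-isMonomial λ j →
      boxes-isMonomial i (toℕ j) (elements (T i j)))
    where
    power : P.0# ^ (weight T ∸ size) P.≈ P.1#
    power = P.reflexive (≡.cong (P.0# ^_) (≡.trans (≡.cong (_∸ size) eq) (ℕ.n∸n≡0 size)))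

  tableau-zero : ∀ T → size ℕ.< weight T → tableauWeight T P.≈ P.0#
  tableau-zero T lt = power-zero (weight T ∸ size) (ℕ.m<n⇒0<n∸m lt) (product λ i → product λ j → foldr
    (λ r p → boxWeight r i (toℕ j) P.* p) P.1# (elements (T i j)))
    where
    power-zero : ∀ k → 0 ℕ.< k → ∀ p → P.0# ^ k P.* p P.≈ P.0#
    power-zero (suc k) _ p = λ _ → R.refl

  weight-≥ : ∀ {T} → IsTableau T → size ℕ.≤ weight T
  weight-≥ {T} (nonempty , _) = ℕ.≤-trans (ℕ.≤-reflexive size≡) (sum-mono λ i → sum-mono λ j → nonempty-size
    (nonempty i j))
    where
    size≡ : size ≡ ℕΣ.sum λ (i : Fin numParts) → ℕΣ.sum λ (j : Fin (rowLength i)) → 1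
    size≡ = ≡.trans (sum-lookup parts) (ℕP.sum-cong numParts λ i → ≡.sym (sum-1 (rowLength i)))

  row≤entry : ∀ {T} → IsTableau T → ∀ k i j r → toℕ i ≡ k → r ∈ₛ T i j → k ℕ.≤ toℕ r
  row≤entry tableau zero i j r _ _ = z≤n
  row≤entry {T} tableau@(nonempty , _ , strict) (suc k) i j r i≡ r∈ =
    ℕ.≤-trans (s≤s (row≤entry tableau k i₀ j₀ s (ℕ.suc-injective (≡.trans (≡.sym i≡₀) i≡)) s∈))
      (strict i₀ i j₀ j i≡₀ (Fin.toℕ-inject≤ j le) s r s∈ r∈)
    where
    pred = predecessor i (ℕ.≤-trans (s≤s z≤n) (ℕ.≤-reflexive (≡.sym i≡)))
    i₀ = proj₁ pred
    i≡₀ = proj₂ pred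
    le = lookup-decreasing decreasing i₀ i i≡₀
    j₀ = Fin.inject≤ j le
    s = proj₁ (nonempty i₀ j₀)
    s∈ = proj₂ (nonempty i₀ j₀)

  letter : Fin numParts → Fin n
  letter i = Fin.inject≤ i μ≤n

  -- The tableau of highest weight. It is the only one that contributes to the diagonal entry of the
  -- matrix at the origin.
  superstandard : Filling
  superstandard i j = ⁅ letter i ⁆

  superstandard-isTableau : IsTableau superstandard
  superstandard-isTableau = (λ i j → letter i , x∈⁅x⁆ (letter i)) ,
    (λ i j j′ _ r s r∈ s∈ → ℕ.≤-reflexive (≡.cong toℕ (≡.trans (x∈⁅y⁆⇒x≡y (letter i) r∈)
      (≡.sym (x∈⁅y⁆⇒x≡y (letter i) s∈))))) ,
    (λ i i′ j j′ i′≡ _ r s r∈ s∈ → ℕ.≤-reflexive (≡.trans (≡.cong (suc ∘ toℕ) (x∈⁅y⁆⇒x≡y (letter i) r∈))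
      (≡.trans (≡.cong suc (Fin.toℕ-inject≤ i μ≤n)) (≡.trans (≡.sym i′≡)
        (≡.trans (≡.sym (Fin.toℕ-inject≤ i′ μ≤n)) (≡.cong toℕ (≡.sym (x∈⁅y⁆⇒x≡y (letter i′) s∈))))))))

  module _ {T : Filling} (T≡ : ∀ i j → T i j ≡ superstandard i j) where
    superstandard-weight : weight T ≡ size
    superstandard-weight = ≡.trans (ℕP.sum-cong numParts λ i → ≡.trans (ℕP.sum-cong (rowLength i) λ j →
      ≡.trans (≡.cong ∣_∣ (T≡ i j)) (∣⁅x⁆∣≡1 (letter i))) (sum-1 (rowLength i))) (≡.sym (sum-lookup parts))

    superstandard-tableau : IsTableau T
    superstandard-tableau = let (nonempty , weak , strict) = superstandard-isTableau in
      (λ i j → ≡.subst Nonempty (≡.sym (T≡ i j)) (nonempty i j)) ,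
      (λ i j j′ eq r s r∈ s∈ → weak i j j′ eq r s (≡.subst (r ∈ₛ_) (T≡ i j) r∈) (≡.subst (s ∈ₛ_) (T≡ i j′) s∈)) ,
      (λ i i′ j j′ eq eq′ r s r∈ s∈ → strict i i′ j j′ eq eq′ r s (≡.subst (r ∈ₛ_) (T≡ i j) r∈)
        (≡.subst (s ∈ₛ_) (T≡ i′ j′) s∈))

    superstandard-content : ∀ f → content T f ≡ ℕΣ.sum λ i → ℕΣ.sum λ (j : Fin (rowLength i)) → f (letter i)
    superstandard-content f = ℕP.sum-cong numParts λ i → ℕP.sum-cong (rowLength i) λ j →
      let (r , r∈ , S≡ , total) = singleton (T i j) (≡.trans (≡.cong ∣_∣ (T≡ i j)) (∣⁅x⁆∣≡1 (letter i))) in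
      ≡.trans (total f) (≡.cong f (x∈⁅y⁆⇒x≡y (letter i) (≡.subst (r ∈ₛ_) (T≡ i j) r∈)))

    superstandard-exponent : ∀ s → exponent s (word (tableau-isMonomial T superstandard-weight)) ≡ entry
      parts (toℕ s)
    superstandard-exponent s = ≡.trans (exponent-word m s)
      (≡.trans (superstandard-content (indicator s)) (≡.trans
        (ℕP.sum-cong numParts λ i → ℕP.sum-cong (rowLength i) λ j → ℕP.if-cong (s Fin.≟ letter i) (toℕ s ℕ.≟ toℕ i)
          (λ { ≡.refl → Fin.toℕ-inject≤ i μ≤n })
          (λ eq → Fin.toℕ-injective (≡.trans eq (≡.sym (Fin.toℕ-inject≤ i μ≤n)))))
        (sum-entry parts (toℕ s))))
      where m = tableau-isMonomial T superstandard-weight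

  -- As there are as many entries as boxes, each box has one entry. An entry of row i is at least i
  -- and so contributes at most the `depth` of i. If the total is maximal, all these inequalities
  -- are equalities.
  content-≤ : ∀ {T} → IsTableau T → weight T ≡ size →
    content T depth ℕ.< rank ⊎ (content T depth ≡ rank × ∀ i j → T i j ≡ superstandard i j)
  content-≤ {T} tableau eq with content T depth ℕ.<? rank
  ... | yes lt = inj₁ lt
  ... | no ≮   = inj₂ (ℕ.≤-antisym (sum-mono λ i → sum-mono λ j → cell≤ i j) (ℕ.≮⇒≥ ≮) , λ i j →
      let (r , r∈ , S≡ , total) = cell i j
          same = ≡.trans (≡.sym (total depth)) (sum-tight (cell≤ i) (ℕ.≤-reflexive
            (≡.sym (sum-tight (λ i → sum-mono (cell≤ i)) (ℕ.≮⇒≥ ≮) i))) j)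
      in ≡.trans S≡ (≡.cong ⁅_⁆ (Fin.toℕ-injective (≡.trans
          (ℕ.∸-cancelˡ-≡ (ℕ.<⇒≤ (Fin.toℕ<n r)) (ℕ.<⇒≤ (ℕ.<-≤-trans (Fin.toℕ<n i) μ≤n)) same)
            (≡.sym (Fin.toℕ-inject≤ i μ≤n))))))
    where
    one : ∀ i j → ∣ T i j ∣ ≡ 1
    one i j = ≡.sym (sum-tight (λ j → nonempty-size (proj₁ tableau i j)) (ℕ.≤-reflexive (≡.sym (rows i))) j)
      where
      rows : ∀ i → ℕΣ.sum {rowLength i} (λ _ → 1) ≡ ℕΣ.sum λ j → ∣ T i j ∣
      rows = sum-tight (λ i → sum-mono λ j → nonempty-size (proj₁ tableau i j)) (ℕ.≤-reflexive (≡.trans eq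
        (≡.trans (sum-lookup parts) (ℕP.sum-cong numParts λ i → ≡.sym (sum-1 (rowLength i))))))

    cell : ∀ i j → _
    cell i j = singleton (T i j) (one i j)

    cell≤ : ∀ i j → weigh depth (elements (T i j)) ℕ.≤ n ∸ toℕ i
    cell≤ i j = let (r , r∈ , S≡ , total) = cell i j in
      ℕ.≤-trans (ℕ.≤-reflexive (total depth)) (ℕ.∸-monoʳ-≤ n (row≤entry tableau (toℕ i) i j r ≡.refl r∈))

  coefficient-monomial : ∀ {p E} (m : IsMonomial p E) w → coefficient p w R.≈ [ w ∼? word m ]· R.1#
  coefficient-monomial m w = R.trans (≈word m w) (R.trans (coefficient-sum (monomial (word m)) w) (R.+-identityʳ _))

  Shaped : Monomial → Set
  Shaped w = ∀ s → exponent s w ≡ entry parts (toℕ s)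

  shaped-word : ∀ {w T} (T≡ : ∀ i j → T i j ≡ superstandard i j) → Shaped w → w ∼ word (tableau-isMonomial T
    (superstandard-weight T≡))
  shaped-word T≡ shaped .exponents s = ≡.trans (shaped s) (≡.sym (superstandard-exponent T≡ s))

  rank-shaped : ∀ w → Shaped w → weigh depth w ≡ rank
  rank-shaped w shaped = ≡.trans (weigh-∼ depth (shaped-word {w} {superstandard} (λ _ _ → ≡.refl) shaped))
    (≡.trans (weighed (tableau-isMonomial superstandard (superstandard-weight λ _ _ → ≡.refl)) depth)
    (≡.trans (superstandard-content {superstandard} (λ _ _ → ≡.refl) depth)
      (ℕP.sum-cong numParts λ i → ℕP.sum-cong (rowLength i) λ j → ≡.cong (n ∸_) (Fin.toℕ-inject≤ i μ≤n))))

  coefficient-grothendieck : ∀ w → coefficient grothendieck w R.≈ sumL allFillings (λ T → [ isTableau? T ]·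
    coefficient (tableauWeight T) w)
  coefficient-grothendieck w = R.trans (sums tableaux) (sumL-filter isTableau? allFillings _)
    where
    sums : ∀ Ts → coefficient (foldr (λ T p → tableauWeight T P.+ p) P.0# Ts) w R.≈ sumL Ts
      (λ T → coefficient (tableauWeight T) w)
    sums []       = R.refl
    sums (T ∷ Ts) = R.trans (coefficient-++ (tableauWeight T) _ w) (R.+-congˡ (sums Ts))

  -- Serves for the vanishing off the diagonal and for the diagonal entry, where the sum is sampled
  -- at the superstandard filling.
  coefficient-other : ∀ w T → ¬ (weigh depth w ℕ.< rank) → ¬ (Shaped w × ∀ i j → T i j ≡ superstandard i j) →
    [ isTableau? T ]· coefficient (tableauWeight T) w R.≈ R.0#
  coefficient-other w T ≮ ≢ = cases (isTableau? T) (weight T ℕ.≟ size)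
    where
    cases : (d : Dec (IsTableau T)) → Dec (weight T ≡ size) → [ d ]· coefficient (tableauWeight T) w R.≈ R.0#
    cases (no _) _ = R.refl
    cases (yes tableau) (no weight≢) = tableau-zero T (ℕ.≤∧≢⇒< (weight-≥ tableau) (weight≢ ∘ ≡.sym)) w
    cases (yes tableau) (yes weight≡) = R.trans (coefficient-monomial m w) ([]·-no (w ∼? word m) absurd)
      where
      m = tableau-isMonomial T weight≡
      absurd : ¬ (w ∼ word m)
      absurd w∼ with content-≤ tableau weight≡
      ... | inj₁ lt = ≮ (≡.subst (ℕ._< rank) (≡.sym (≡.trans (weigh-∼ depth w∼) (weighed m depth))) lt)
      ... | inj₂ (_ , T≡) = ≢ ((λ s → ≡.trans (exponents w∼ s) (≡.trans (exponent-word m s)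
              (≡.trans (≡.sym (exponent-word (tableau-isMonomial T (superstandard-weight T≡)) s))
                (superstandard-exponent T≡ s)))) , T≡)

  coefficient-vanishes : ∀ w → ¬ Shaped w → ¬ (weigh depth w ℕ.< rank) → coefficient grothendieck w R.≈ R.0#
  coefficient-vanishes w ¬shaped ≮ = R.trans (coefficient-grothendieck w)
    (sumL-0 allFillings λ T → coefficient-other w T ≮ (¬shaped ∘ proj₁))

  coefficient-shaped : ∀ w → Shaped w → coefficient grothendieck w R.≈ R.1#
  coefficient-shaped w shaped = R.trans (coefficient-grothendieck w) (sample
    (samples-families {_~_ = λ f g → ∀ j → f j ≡ g j} λ i → samples-families {_~_ = _≡_} λ j →
      samples-subsets n (superstandard i j))
    (λ T → [ isTableau? T ]· coefficient (tableauWeight T) w) R.1#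
    (λ T T≡ → R.trans ([]·-yes (isTableau? T) (superstandard-tableau T≡))
      (R.trans (coefficient-monomial (tableau-isMonomial T (superstandard-weight T≡)) w)
        ([]·-yes (w ∼? word (tableau-isMonomial T (superstandard-weight T≡))) (shaped-word {w} {T} T≡ shaped))))
    (λ T T≢ → coefficient-other w T (λ lt → ℕ.<-irrefl (rank-shaped w shaped) lt) (T≢ ∘ proj₂)))
    where open FamilySums R

-- Specialization at the origin and elimination

module _ {c ℓ} (R : CommutativeRing c ℓ) {V : Set} (_≟_ : DecidableEquality V) where
  open PolynomialRing R _≟_
  open ListSum R
  private
    module R = CommutativeRing R
    module P = CommutativeRing polynomialRing
  open import Relation.Binary.Reasoning.Setoid R.setoid

  -- Evaluation with all variables zero, applied below to β and a. It is multiplicative because a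
  -- product of monomials is trivial only if both factors are.
  constantTerm : Homomorphism polynomialRing R
  constantTerm = record
    { ⟦_⟧ = λ p → coefficient p []
    ; ⟦⟧-cong = λ eq → eq []
    ; +-homo = λ p q → coefficient-++ p q []
    ; *-homo = λ p q → begin
        coefficient (p P.* q) []                                     ≈⟨ coefficient≈linear (p P.* q) [] ⟩
        linear (δ []) (p P.* q)                                      ≈⟨ linear-* (δ []) p q ⟩
        linear (λ u → linear (λ v → δ [] (u ++ v)) q) p              ≈⟨ linear-cong-χ p (λ u → R.trans
          (linear-cong-χ q (δ-++ u)) (pull u q)) ⟩
        linear (λ u → δ [] u R.* linear (δ []) q) p                  ≈⟨ sumL-cong p (λ (a , u) → R.sym
          (R.*-assoc _ _ _)) ⟩
        sumL p (λ (a , u) → a R.* δ [] u R.* linear (δ []) q)        ≈⟨ sumL-* p _ _ ⟨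
        linear (δ []) p R.* linear (δ []) q                          ≈⟨ R.*-cong (coefficient≈linear p [])
          (coefficient≈linear q []) ⟨
        coefficient p [] R.* coefficient q []                        ∎
    ; 0-homo = R.refl
    ; 1-homo = R.trans (coefficient-sum P.1# []) (R.trans (R.+-identityʳ _) ([]·-yes ([] ∼? []) ∼-refl))
    }
    where
    pull : ∀ u q → linear (λ v → δ [] u R.* δ [] v) q R.≈ δ [] u R.* linear (δ []) q
    pull u q = R.trans (sumL-cong q λ (b , v) → R.trans (R.sym (R.*-assoc _ _ _))
      (R.trans (R.*-congʳ (R.*-comm _ _)) (R.*-assoc _ _ _)))
      (R.sym (*-sumL (δ [] u) q _))

    δ-++ : ∀ u v → δ [] (u ++ v) R.≈ δ [] u R.* δ [] v
    δ-++ u v = cases ([] ∼? u)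
      where
      cases : (d : Dec ([] ∼ u)) → δ [] (u ++ v) R.≈ ([ d ]· R.1#) R.* δ [] v
      cases (yes []∼u) = R.trans ([]·-cong ([] ∼? (u ++ v)) ([] ∼? v)
        (λ eq → ++-cancel [] (∼-trans eq (++-cong (∼-sym []∼u) ∼-refl))) (λ eq → ∼-trans eq
          (++-cong []∼u ∼-refl)) (λ _ → R.refl)) (R.sym (R.*-identityˡ _))
      cases (no []≁u) = R.trans ([]·-no ([] ∼? (u ++ v)) λ eq → []≁u (same-exponents λ x →
        ≡.sym (ℕ.m+n≡0⇒m≡0 (exponent x u) (≡.sym (≡.trans (exponents eq x) (exponent-++ x u v))))))
          (R.sym (R.zeroˡ _))

-- D plays the role of the polynomials in the parameters, ε that of the specialization at the origin:
-- a matrix over D whose specialization is unitriangular is invertible over K.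
module Elimination {c₁ ℓ₁ c₂ ℓ₂ c₃ ℓ₃} {D : CommutativeRing c₁ ℓ₁} {K : CommutativeRing c₂ ℓ₂}
  {F : CommutativeRing c₃ ℓ₃}
    (h : Homomorphism D K) (ε : Homomorphism D F)
    (unit : ∀ d → CommutativeRing._≈_ F (Homomorphism.⟦_⟧ ε d) (CommutativeRing.1# F) →
      ∃[ s ] CommutativeRing._≈_ K (CommutativeRing._*_ K s (Homomorphism.⟦_⟧ h d)) (CommutativeRing.1# K)) where
  private
    module D = CommutativeRing D
    module F = CommutativeRing F
    module ε = Homomorphism ε
    module FS = IntegerCoefficients F
  open Homomorphism h
  open CommutativeRing K hiding (zero)
  open IntegerCoefficients K using (solve; _:=_; _:+_; _:*_; _:-_; :-_; con)
  open CommutativeMonoidSum +-commutativeMonoid using (sum)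
  open BoxProducts +-commutativeMonoid using (sum-cong)
  open import Relation.Binary.Reasoning.Setoid setoid

  record Unitriangular {N} (A : Fin N → Fin N → D.Carrier) (rank : Fin N → ℕ) : Set (ℓ₃) where
    field
      diagonal     : ∀ j → ε.⟦ A j j ⟧ F.≈ F.1#
      off-diagonal : ∀ j k → j ≢ k → ¬ (rank k ℕ.< rank j) → ε.⟦ A j k ⟧ F.≈ F.0#
  open Unitriangular

  combine : ∀ {N} → (Fin N → Fin N → D.Carrier) → (Fin N → Carrier) → Fin N → Carrier
  combine A c k = sum λ j → c j * ⟦ A j k ⟧

  neg-homo : ∀ {c₁ ℓ₁ c₂ ℓ₂} {R : CommutativeRing c₁ ℓ₁} {S : CommutativeRing c₂ ℓ₂} (g : Homomorphism R S) →
    let open Homomorphism g renaming (⟦_⟧ to ⟦_⟧′) in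
    ∀ x → CommutativeRing._≈_ S ⟦ CommutativeRing.-_ R x ⟧′ (CommutativeRing.-_ S ⟦ x ⟧′)
  neg-homo {R = R} {S} g x = RingProperties.+-inverseˡ-unique S.ring ⟦ R.- x ⟧′ ⟦ x ⟧′
    (S.trans (S.sym (+-homo′ (R.- x) x)) (S.trans (⟦⟧-cong′ (R.-‿inverseˡ x)) 0-homo′))
    where
    module R = CommutativeRing R
    module S = CommutativeRing S
    open Homomorphism g renaming (⟦_⟧ to ⟦_⟧′; +-homo to +-homo′; ⟦⟧-cong to ⟦⟧-cong′; 0-homo to 0-homo′)

  module _ {N} (A : Fin (suc N) → Fin (suc N) → D.Carrier) where
    pivot : D.Carrier
    pivot = A zero zero

    -- The Schur complement multiplied by the pivot. Without division it stays over `D`, where `ε`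
    -- is defined, so that the next pivot can be controlled in the same way.
    schur : Fin N → Fin N → D.Carrier
    schur j k = pivot D.* A (suc j) (suc k) D.- A (suc j) zero D.* A zero (suc k)

    module _ {rank : Fin (suc N) → ℕ} (u : Unitriangular A rank) where
      private
        ε-schur : ∀ j k → ε.⟦ schur j k ⟧ F.≈ ε.⟦ A (suc j) (suc k) ⟧ F.- ε.⟦ A (suc j) zero ⟧ F.* ε.⟦ A
          zero (suc k) ⟧
        ε-schur j k = F.trans (ε.+-homo _ _) (F.+-cong
          (F.trans (ε.*-homo _ _) (F.trans (F.*-congʳ (diagonal u zero)) (F.*-identityˡ _)))
          (F.trans (neg-homo ε _) (F.-‿cong (ε.*-homo _ _))))

        -- If both factors were nonzero, the rank would drop strictly from `suc j` to `zero` and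
        -- again from `zero` to `suc k`. Hence any index may serve as pivot, and the indices need
        -- not be ordered by rank.
        product-zero : ∀ j k → ¬ (rank (suc k) ℕ.< rank (suc j)) → ε.⟦ A (suc j) zero ⟧ F.* ε.⟦ A zero
          (suc k) ⟧ F.≈ F.0#
        product-zero j k ≮ with rank zero ℕ.<? rank (suc j)
        ... | no 0≮j  = F.trans (F.*-congʳ (off-diagonal u (suc j) zero (λ ()) 0≮j)) (F.zeroˡ _)
        ... | yes 0<j = F.trans (F.*-congˡ (off-diagonal u zero (suc k) (λ ()) λ k<0 → ≮ (ℕ.<-trans k<0
          0<j))) (F.zeroʳ _)

        minus-zero : ∀ {x y z} → x F.≈ z → y F.≈ F.0# → x F.- y F.≈ z
        minus-zero x≈z y≈0 = F.trans (F.+-cong x≈z (F.-‿cong y≈0)) (FS.solve 1 (λ z → z FS.:- FS.con (+ 0)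
          FS.:= z) F.refl _)

      schur-unitriangular : Unitriangular schur (rank ∘ suc)
      schur-unitriangular .diagonal j = F.trans (ε-schur j j) (minus-zero (diagonal u (suc j))
        (product-zero j j (ℕ.<-irrefl ≡.refl)))
      schur-unitriangular .off-diagonal j k j≢k ≮ = F.trans (ε-schur j k)
        (minus-zero (off-diagonal u (suc j) (suc k) (j≢k ∘ Fin.suc-injective) ≮) (product-zero j k ≮))

    sum-schur : ∀ c k → combine schur c k ≈
      ⟦ pivot ⟧ * sum (λ j → c j * ⟦ A (suc j) (suc k) ⟧) - sum (λ j → c j * ⟦ A (suc j) zero ⟧) * ⟦ A zero
        (suc k) ⟧
    sum-schur c k = trans (sum-cong N λ j → *-congˡ (trans (+-homo _ _)
      (+-cong (*-homo (pivot) (A (suc j) (suc k))) (trans (neg-homo h _) (-‿cong (*-homo (A (suc j) zero)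
      (A zero (suc k))))))))
      (go (λ j → ⟦ A (suc j) (suc k) ⟧) (λ j → ⟦ A (suc j) zero ⟧) c)
      where
      go : ∀ {M} (a b c : Fin M → Carrier) →
        sum (λ j → c j * (⟦ pivot ⟧ * a j - b j * ⟦ A zero (suc k) ⟧)) ≈ ⟦ pivot ⟧ * sum (λ j → c j * a j) -
          sum (λ j → c j * b j) * ⟦ A zero (suc k) ⟧
      go {zero}  a b c = solve 2 (λ p q → con (+ 0) := p :* con (+ 0) :- con (+ 0) :* q) refl _ _
      go {suc M} a b c = trans (+-congˡ (go (a ∘ suc) (b ∘ suc) (c ∘ suc)))
        (solve 7 (λ p q a b c s t → c :* (p :* a :- b :* q) :+ (p :* s :- t :* q) := p :* (c :* a :+ s) :-
          (c :* b :+ t) :* q) refl _ _ _ _ _ _ _)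

  injective : ∀ {N} (A : Fin N → Fin N → D.Carrier) rank → Unitriangular A rank →
    ∀ (c : Fin N → Carrier) → (∀ k → combine A c k ≈ 0#) → ∀ j → c j ≈ 0#
  injective {suc N} A rank u c eq = λ { zero → c₀≈0 ; (suc j) → c≈0 j }
    where
    a = ⟦ pivot A ⟧
    s = proj₁ (unit (pivot A) (diagonal u zero))
    sa≈1 = proj₂ (unit (pivot A) (diagonal u zero))

    rest : Fin (suc N) → Carrier
    rest k = sum λ j → c (suc j) * ⟦ A (suc j) k ⟧

    c≈0 : ∀ j → c (suc j) ≈ 0#
    c≈0 = injective (schur A) (rank ∘ suc) (schur-unitriangular A u) (c ∘ suc) λ k → begin
      combine (schur A) (c ∘ suc) k
        ≈⟨ sum-schur A (c ∘ suc) k ⟩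
      a * rest (suc k) - rest zero * ⟦ A zero (suc k) ⟧
        -- The two inserted multiples of `c zero` cancel; they complete the sums to the equations
        -- for the columns `suc k` and `zero`.
        ≈⟨ solve 5 (λ a r r₀ c b → a :* r :- r₀ :* b := a :* (c :* b :+ r) :- (c :* a :+ r₀) :* b) refl _ _
          _ (c zero) _ ⟩
      a * (c zero * ⟦ A zero (suc k) ⟧ + rest (suc k)) - (c zero * a + rest zero) * ⟦ A zero (suc k) ⟧
        ≈⟨ +-cong (*-congˡ (eq (suc k))) (-‿cong (*-congʳ (eq zero))) ⟩
      a * 0# - 0# * ⟦ A zero (suc k) ⟧
        ≈⟨ solve 2 (λ a b → a :* con (+ 0) :- con (+ 0) :* b := con (+ 0)) refl _ _ ⟩
      0# ∎

    sum-zero : ∀ {M} (f g : Fin M → Carrier) → (∀ j → f j ≈ 0#) → sum (λ j → f j * g j) ≈ 0#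
    sum-zero {zero}  f g eq = refl
    sum-zero {suc M} f g eq = trans (+-cong (trans (*-congʳ (eq zero)) (zeroˡ _)) (sum-zero (f ∘ suc)
      (g ∘ suc) (eq ∘ suc))) (+-identityˡ _)

    c₀≈0 : c zero ≈ 0#
    c₀≈0 = begin
      c zero                              ≈⟨ *-identityˡ _ ⟨
      1# * c zero                         ≈⟨ *-congʳ sa≈1 ⟨
      s * a * c zero                      ≈⟨ solve 3 (λ s a c → s :* a :* c := s :* (c :* a :+ con (+ 0)))
        refl _ _ _ ⟩
      s * (c zero * a + 0#)               ≈⟨ *-congˡ (+-congˡ (sum-zero (c ∘ suc) (λ j → ⟦ A (suc j) zero ⟧) c≈0)) ⟨
      s * (c zero * a + rest zero)        ≈⟨ *-congˡ (eq zero) ⟩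
      s * 0#                              ≈⟨ zeroʳ s ⟩
      0#                                  ∎

  surjective : ∀ {N} (A : Fin N → Fin N → D.Carrier) rank → Unitriangular A rank →
    ∀ (y : Fin N → Carrier) → Σ[ c ∈ (Fin N → Carrier) ] (∀ k → combine A c k ≈ y k)
  surjective {zero}  A rank u y = (λ ()) , λ ()
  surjective {suc N} A rank u y = c , λ { zero → row-zero ; (suc k) → row-suc k }
    where
    a = ⟦ pivot A ⟧
    s = proj₁ (unit (pivot A) (diagonal u zero))
    sa≈1 = proj₂ (unit (pivot A) (diagonal u zero))
    -- The right-hand side undergoes the same elimination as the columns. Afterwards `c zero` is
    -- chosen to solve the equation of column `zero`.
    tail = surjective (schur A) (rank ∘ suc) (schur-unitriangular A u) λ k → a * y (suc k) - y zero * ⟦ A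
      zero (suc k) ⟧
    c′ = proj₁ tail

    rest : Fin (suc N) → Carrier
    rest k = sum λ j → c′ j * ⟦ A (suc j) k ⟧

    c : Fin (suc N) → Carrier
    c zero    = s * (y zero - rest zero)
    c (suc j) = c′ j

    row-zero : combine A c zero ≈ y zero
    row-zero = begin
      s * (y zero - rest zero) * a + rest zero          ≈⟨ solve 4 (λ s y r a → s :* (y :- r) :* a :+ r :=
        (s :* a) :* (y :- r) :+ r) refl _ _ _ _ ⟩
      s * a * (y zero - rest zero) + rest zero          ≈⟨ +-congʳ (*-congʳ sa≈1) ⟩
      1# * (y zero - rest zero) + rest zero             ≈⟨ solve 2 (λ y r → con (+ 1) :* (y :- r) :+ r := y)
        refl _ _ ⟩
      y zero                                            ∎

    row-suc : ∀ k → combine A c (suc k) ≈ y (suc k)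
    row-suc k = begin
      s * (y zero - rest zero) * b + rest (suc k)
        ≈⟨ +-congˡ (trans (sym (*-identityˡ _)) (*-congʳ (sym sa≈1))) ⟩
      s * (y zero - rest zero) * b + s * a * rest (suc k)
        ≈⟨ solve 6 (λ s y r₀ b a r → s :* (y :- r₀) :* b :+ s :* a :* r := s :*
          (y :* b :+ (a :* r :- r₀ :* b))) refl _ _ _ _ _ _ ⟩
      s * (y zero * b + (a * rest (suc k) - rest zero * b))
        ≈⟨ *-congˡ (+-congˡ (trans (sym (sum-schur A c′ k)) (proj₂ tail k))) ⟩
      s * (y zero * b + (a * y (suc k) - y zero * b))
        ≈⟨ solve 5 (λ s y b a z → s :* (y :* b :+ (a :* z :- y :* b)) := s :* a :* z) refl _ _ _ _ _ ⟩
      s * a * y (suc k)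
        ≈⟨ *-congʳ sa≈1 ⟩
      1# * y (suc k)
        ≈⟨ *-identityˡ _ ⟩
      y (suc k) ∎
      where b = ⟦ A zero (suc k) ⟧

-- Partitions, exponent vectors and symmetric polynomials

≥-decTotalOrder : DecTotalOrder _ _ _
≥-decTotalOrder = Flip.decTotalOrder ℕ.≤-decTotalOrder

open Sort ≥-decTotalOrder using (sort; sort-↭; sort-↗)

-- Symmetry of a polynomial is stated with permutations of the variables, whereas exponent vectors
-- are compared as lists up to reordering.
↭⇒permutation : ∀ {xs ys} → xs ↭ ys → ∀ {n} → length xs ≡ n →
  Σ[ σ ∈ Perm.Permutation′ n ] (∀ i → entry ys (toℕ i) ≡ entry xs (toℕ (σ Perm.⟨$⟩ʳ i)))
↭⇒permutation ↭.refl            _      = Perm.id , λ i → ≡.refl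
↭⇒permutation (↭.prep x eq)     ≡.refl = let (σ , σ≡) = ↭⇒permutation eq ≡.refl in
  Perm.lift₀ σ , λ { zero → ≡.refl ; (suc i) → σ≡ i }
↭⇒permutation (↭.swap x y eq)   ≡.refl = let (σ , σ≡) = ↭⇒permutation eq ≡.refl in
  Perm.swap σ , λ { zero → ≡.refl ; (suc zero) → ≡.refl ; (suc (suc i)) → σ≡ i }
↭⇒permutation (↭.trans eq eq′) {n} len = let (σ , σ≡) = ↭⇒permutation eq len
                                             (τ , τ≡) = ↭⇒permutation eq′ (≡.trans (≡.sym (↭.↭-length eq)) len) in
  τ Perm.∘ₚ σ , λ i → ≡.trans (τ≡ i) (σ≡ (τ Perm.⟨$⟩ʳ i))

-- It suffices to permute the list of all indices. Its image under σ is again free of repetitions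
-- and has the same members, and such lists are permutations of each other.
tabulate-permute : ∀ {a} {A : Set a} {n} (e : Fin n → A) (σ : Perm.Permutation′ n) →
  List.tabulate (e ∘ (σ Perm.⟨$⟩ʳ_)) ↭ List.tabulate e
tabulate-permute {n = n} e σ = ↭-trans (↭-reflexive (≡.sym (List.map-tabulate (σ Perm.⟨$⟩ʳ_) e)))
  (↭-trans (↭.map⁺ e (∼bag⇒↭ (unique∧set⇒bag (Unique.tabulate⁺ injective′) (Unique.allFin⁺ n) λ {i} → mk⇔
    (λ _ → ∈.∈-allFin i) (λ _ → ≡.subst (_∈ _) (Perm.inverseʳ σ) (∈.∈-tabulate⁺ (σ Perm.⟨$⟩ˡ i))))))
  (↭-reflexive (List.map-tabulate id e)))
  where
  injective′ : ∀ {i j} → σ Perm.⟨$⟩ʳ i ≡ σ Perm.⟨$⟩ʳ j → i ≡ j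
  injective′ eq = ≡.trans (≡.sym (Perm.inverseˡ σ)) (≡.trans (≡.cong (σ Perm.⟨$⟩ˡ_) eq) (Perm.inverseˡ σ))

entry-tabulate : ∀ {n} (e : Fin n → ℕ) i → entry (List.tabulate e) (toℕ i) ≡ e i
entry-tabulate e zero    = ≡.refl
entry-tabulate e (suc i) = entry-tabulate (e ∘ suc) i

tabulate-entry : ∀ xs → List.tabulate {n = length xs} (entry xs ∘ toℕ) ≡ xs
tabulate-entry []       = ≡.refl
tabulate-entry (x ∷ xs) = ≡.cong (x ∷_) (tabulate-entry xs)

entry-≤-sum : ∀ xs k → entry xs k ℕ.≤ ListAction.sum xs
entry-≤-sum []       k       = z≤n
entry-≤-sum (x ∷ xs) zero    = ℕ.m≤m+n x _
entry-≤-sum (x ∷ xs) (suc k) = ℕ.≤-trans (entry-≤-sum xs k) (ℕ.m≤n+m _ x)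

entry-decreasing : ∀ {xs} → Linked ℕ._≥_ xs → ∀ k → entry xs (suc k) ℕ.≤ entry xs k
entry-decreasing []        k       = z≤n
entry-decreasing [-]       k       = z≤n
entry-decreasing (x≥y ∷ l) zero    = x≥y
entry-decreasing (_ ∷ l)   (suc k) = entry-decreasing l k

entry-≤-first : ∀ {xs} → Linked ℕ._≥_ xs → ∀ k → entry xs k ℕ.≤ entry xs 0
entry-≤-first l zero    = ℕ.≤-refl
entry-≤-first l (suc k) = ℕ.≤-trans (entry-decreasing l k) (entry-≤-first l k)

positives : List ℕ → List ℕ
positives = filter (0 ℕ.<?_)

-- In a decreasing list the zeros are at the end, and reading beyond the end of a list gives 0 as
-- well.
entry-positives : ∀ {xs} → Linked ℕ._≥_ xs → ∀ k → entry (positives xs) k ≡ entry xs k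
entry-positives {[]}         _ k = ≡.refl
entry-positives {zero ∷ xs}  l k = ≡.trans (zeros xs (λ x∈ → ℕ.≤-antisym (bound l x∈) z≤n)) (≡.sym (zero-entry l k))
  where
  bound : ∀ {x xs} → Linked ℕ._≥_ (x ∷ xs) → ∀ {y} → y ∈ xs → y ℕ.≤ x
  bound (x≥y ∷ l) (here ≡.refl) = x≥y
  bound (x≥y ∷ l) (there y∈)    = ℕ.≤-trans (bound l y∈) x≥y
  zeros : ∀ xs → (∀ {x} → x ∈ xs → x ≡ 0) → entry (positives xs) k ≡ 0
  zeros []       eq = ≡.refl
  zeros (x ∷ xs) eq with eq (here ≡.refl)
  ... | ≡.refl = zeros xs (eq ∘ there)
  zero-entry : ∀ {xs} → Linked ℕ._≥_ (0 ∷ xs) → ∀ k → entry (0 ∷ xs) k ≡ 0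
  zero-entry l k = ℕ.n≤0⇒n≡0 (entry-≤-first l k)
entry-positives {suc x ∷ xs} l zero    = ≡.refl
entry-positives {suc x ∷ xs} l (suc k) = entry-positives (Linked.tail l) k

positives-tabulate : ∀ {xs} → All (0 ℕ.<_) xs → ∀ n → length xs ℕ.≤ n → positives (List.tabulate {n = n}
  (entry xs ∘ toℕ)) ≡ xs
positives-tabulate []            zero    _  = ≡.refl
positives-tabulate []            (suc n) _  = positives-tabulate [] n z≤n
positives-tabulate {suc x ∷ xs} (_ ∷ ps) (suc n) (s≤s le) = ≡.cong (suc x ∷_) (positives-tabulate ps n le)

linked-tabulate : ∀ n (f : ℕ → ℕ) → (∀ k → f (suc k) ℕ.≤ f k) → Linked ℕ._≥_ (List.tabulate {n = n} (f ∘ toℕ))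
linked-tabulate zero          f dec = []
linked-tabulate (suc zero)    f dec = [-]
linked-tabulate (suc (suc n)) f dec = dec 0 ∷ linked-tabulate (suc n) (f ∘ suc) (dec ∘ suc)

sort-cong : ∀ {xs ys} → xs ↭ ys → sort xs ≡ sort ys
sort-cong {xs} {ys} eq = Pointwise-≡⇒≡ (↗↭↗⇒≋ (DecTotalOrder.totalOrder ≥-decTotalOrder) (sort-↗ xs) (sort-↗ ys)
  (↭⇒↭ₛ (↭-trans (sort-↭ xs) (↭-trans eq (↭-sym (sort-↭ ys))))))

sort-sorted : ∀ {xs} → Linked ℕ._≥_ xs → sort xs ≡ xs
sort-sorted {xs} l = Pointwise-≡⇒≡ (↗↭↗⇒≋ (DecTotalOrder.totalOrder ≥-decTotalOrder) (sort-↗ xs) l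
  (↭⇒↭ₛ (sort-↭ xs)))

module Shapes (n : ℕ) where
  Shape : Set
  Shape = PartitionWithAtMost n Parts

  partsOf : Shape → List ℕ
  partsOf λ′ = Partition.parts (proj₁ λ′)

  partsOf-injective : ∀ {λ₁ λ₂ : Shape} → partsOf λ₁ ≡ partsOf λ₂ → λ₁ ≡ λ₂
  partsOf-injective {record { parts = _ ; decreasing = d ; positive = p } , le}
    {record { decreasing = d′ ; positive = p′ } , le′} ≡.refl
    with Linked.irrelevant ℕ.≤-irrelevant d d′ | All.irrelevant ℕ.≤-irrelevant p p′ | ℕ.≤-irrelevant le le′
  ... | ≡.refl | ≡.refl | ≡.refl = ≡.refl

  _≟ˢ_ : DecidableEquality Shape
  λ₁ ≟ˢ λ₂ = map′ partsOf-injective (≡.cong partsOf) (List.≡-dec ℕ._≟_ (partsOf λ₁) (partsOf λ₂))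

  vector : Shape → Fin n → ℕ
  vector λ′ i = entry (partsOf λ′) (toℕ i)

  -- Exponent vectors up to permutation of the variables correspond to partitions; `vector` selects
  -- the decreasing representative.
  shape : (Fin n → ℕ) → Shape
  shape e = record
    { parts = positives (sort (List.tabulate e))
    ; decreasing = Linked.filter⁺ (0 ℕ.<?_) (λ x≥y y≥z → ℕ.≤-trans y≥z x≥y) (sort-↗ (List.tabulate e))
    ; positive = All.all-filter (0 ℕ.<?_) (sort (List.tabulate e))
    } , ℕ.≤-trans (List.length-filter (0 ℕ.<?_) (sort (List.tabulate e)))
          (ℕ.≤-reflexive (≡.trans (↭.↭-length (sort-↭ (List.tabulate e))) (List.length-tabulate e)))

  shape-↭ : ∀ {e e′} → List.tabulate e ↭ List.tabulate e′ → shape e ≡ shape e′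
  shape-↭ eq = partsOf-injective (≡.cong positives (sort-cong eq))

  shape-cong : ∀ {e e′} → (∀ i → e i ≡ e′ i) → shape e ≡ shape e′
  shape-cong eq = shape-↭ (↭-reflexive (List.tabulate-cong eq))

  vector-shape : ∀ e → List.tabulate e ↭ List.tabulate (vector (shape e))
  vector-shape e = ↭-sym (↭-trans (↭-reflexive (≡.trans
      (List.tabulate-cong λ i → entry-positives (sort-↗ (List.tabulate e)) (toℕ i)) (tabulate-sort len)))
        (sort-↭ (List.tabulate e)))
    where
    len : length (sort (List.tabulate e)) ≡ n
    len = ≡.trans (↭.↭-length (sort-↭ (List.tabulate e))) (List.length-tabulate e)
    tabulate-sort : ∀ {xs} → length xs ≡ n → List.tabulate {n = n} (entry xs ∘ toℕ) ≡ xs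
    tabulate-sort {xs} ≡.refl = tabulate-entry xs

  shape-vector : ∀ λ′ → shape (vector λ′) ≡ λ′
  shape-vector λ′@(μ , le) = partsOf-injective (≡.trans
    (≡.cong positives (sort-sorted (linked-tabulate n (entry (partsOf λ′)) (entry-decreasing
      (Partition.decreasing μ)))))
    (positives-tabulate (Partition.positive μ) n le))

  ↭-bounded : ∀ {e e′ : Fin n → ℕ} {N} → List.tabulate e ↭ List.tabulate e′ → (∀ i → e′ i ℕ.≤ N) → ∀ i → e i ℕ.≤ N
  ↭-bounded {e} {e′} {N} eq le i = All.lookup {P = ℕ._≤ N} (↭.All-resp-↭ (↭-sym eq) (All.tabulate⁺ le))
    (∈.∈-tabulate⁺ i)

  box : ℕ → List Shape
  box N = List.deduplicate _≟ˢ_ (List.map shape (allFamilies λ _ → upTo (suc N)))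

  box-unique : ∀ N → Unique (box N)
  box-unique N = UniqueDec.deduplicate-! _≟ˢ_ (List.map shape (allFamilies λ _ → upTo (suc N)))

  box-bounded : ∀ {N λ′} → λ′ ∈ box N → ∀ i → vector λ′ i ℕ.≤ N
  box-bounded {N} λ∈ with ∈.∈-map⁻ shape (∈.∈-deduplicate⁻ _≟ˢ_ (List.map shape (allFamilies λ _ → upTo
    (suc N))) λ∈)
  ... | e , e∈ , ≡.refl = ↭-bounded (↭-sym (vector-shape e)) (All.lookup (allFamilies-all λ _ → upTo-≤ N) e∈)

  -- The list is shown to contain a pointwise equal copy of `e`, which is enough because `shape`
  -- respects pointwise equality.
  families-∈ : ∀ N (e : Fin n → ℕ) → (∀ i → e i ℕ.≤ N) → Σ[ e′ ∈ (Fin n → ℕ) ] e′ ∈ allFamilies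
    (λ _ → upTo (suc N)) × (∀ i → e′ i ≡ e i)
  families-∈ N e le = go e le
    where
    go : ∀ {m} (e : Fin m → ℕ) → (∀ i → e i ℕ.≤ N) → Σ[ e′ ∈ (Fin m → ℕ) ] e′ ∈ allFamilies
      (λ _ → upTo (suc N)) × (∀ i → e′ i ≡ e i)
    go {zero}  e le = _ , here ≡.refl , λ ()
    go {suc m} e le with go (e ∘ suc) (le ∘ suc)
    ... | e′ , e′∈ , eq = _ , ∈.∈-cartesianProductWith⁺ _ (∈.∈-upTo⁺ (s≤s (le zero))) e′∈ ,
      λ { zero → ≡.refl ; (suc i) → eq i }

  box-complete : ∀ N e → (∀ i → e i ℕ.≤ N) → shape e ∈ box N
  box-complete N e le = let (e′ , e′∈ , eq) = families-∈ N e le in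
    ≡.subst (_∈ box N) (shape-cong eq) (∈.∈-deduplicate⁺ _≟ˢ_ (∈.∈-map⁺ shape e′∈))

  open Words n
  open Monomials (Fin._≟_ {n})

  word : (Fin n → ℕ) → List (Fin n)
  word e = List.concat (List.tabulate λ i → List.replicate (e i) i)

  exponent-word : ∀ e s → exponent s (word e) ≡ e s
  exponent-word e s = ≡.trans (exponent-weigh s (word e)) (≡.trans (weigh-concat n id e)
    (≡.trans (ℕP.sum-cong n λ i → flip-δ (s Fin.≟ i) (i Fin.≟ s) ≡.sym ≡.sym) (sum-δ s e)))
    where
    weigh-replicate : ∀ k i → weigh (indicator s) (List.replicate k i) ≡ (if does (s Fin.≟ i) then k else 0)
    weigh-replicate zero i with does (s Fin.≟ i)
    ... | true  = ≡.refl
    ... | false = ≡.refl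
    weigh-replicate (suc k) i with does (s Fin.≟ i) | weigh-replicate k i
    ... | true  | eq = ≡.cong suc eq
    ... | false | eq = eq
    weigh-concat : ∀ m (g : Fin m → Fin n) (e : Fin m → ℕ) → weigh (indicator s)
      (List.concat (List.tabulate λ i → List.replicate (e i) (g i))) ≡
      ℕΣ.sum λ i → if does (s Fin.≟ g i) then e i else 0
    weigh-concat zero    g e = ≡.refl
    weigh-concat (suc m) g e = ≡.trans (weigh-++ (indicator s) (List.replicate (e zero) (g zero)) _)
      (≡.cong₂ ℕ._+_ (weigh-replicate (e zero) (g zero)) (weigh-concat m (g ∘ suc) (e ∘ suc)))
    flip-δ : ∀ {P Q : Set} (d : Dec P) (d′ : Dec Q) → (P → Q) → (Q → P) → ∀ {y : ℕ} → (if does d then y else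
      0) ≡ (if does d′ then y else 0)
    flip-δ d d′ to from {y} = ℕP.if-cong d d′ to from

  exps : List (Fin n) → Fin n → ℕ
  exps w s = exponent s w

  exps-map : ∀ (σ : Perm.Permutation′ n) w s → exps (List.map (σ Perm.⟨$⟩ˡ_) w) s ≡ exps w (σ Perm.⟨$⟩ʳ s)
  exps-map σ w s = exponent-map (λ v → Perm.inverseʳ σ) (λ v → Perm.inverseˡ σ) s w

  module SymmetricExpansion {c ℓ} (R : CommutativeRing c ℓ) where
    private module R = CommutativeRing R
    open PolynomialRing R (Fin._≟_ {n}) using (Poly; polyRing; rename; coefficient; coefficient-rename;
      coefficient-invariant)
    open ListSum R
    open RawRing polyRing using (_≈_)

    IsSymmetric : Poly → Set ℓ
    IsSymmetric p = ∀ (σ : Perm.Permutation′ n) → rename (σ Perm.⟨$⟩ʳ_) p ≈ p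

    symmetric-↭ : ∀ p → IsSymmetric p → ∀ {w w′} → List.tabulate (exps w) ↭ List.tabulate (exps w′) →
      coefficient p w R.≈ coefficient p w′
    symmetric-↭ p sym-p {w} {w′} eq = R.trans (R.sym (sym-p σ w))
      (R.trans (coefficient-rename (λ v → Perm.inverseˡ σ) (λ v → Perm.inverseʳ σ) p w)
        (coefficient-invariant p {List.map (σ Perm.⟨$⟩ˡ_) w} {w′} (same-exponents λ s → ≡.trans
          (exps-map σ w s) (≡.sym (σ≡ s)))))
      where
      perm = ↭⇒permutation eq (List.length-tabulate (exps w))
      σ = proj₁ perm
      σ≡ : ∀ s → exps w′ s ≡ exps w (σ Perm.⟨$⟩ʳ s)
      σ≡ s = ≡.trans (≡.sym (entry-tabulate (exps w′) s)) (≡.trans (proj₂ perm s) (entry-tabulate (exps w)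
        (σ Perm.⟨$⟩ʳ s)))

    symmetric-shape : ∀ p → IsSymmetric p → ∀ w → coefficient p w R.≈ coefficient p (word (vector (shape (exps w))))
    symmetric-shape p sym-p w = symmetric-↭ p sym-p {w} {word (vector (shape (exps w)))}
      (↭-trans (vector-shape (exps w))
      (↭-reflexive (List.tabulate-cong λ s → ≡.sym (exponent-word (vector (shape (exps w))) s))))

    sumL-unique : ∀ {xs : List Shape} {x₀} (φ : Shape → R.Carrier) → Unique xs → x₀ ∈ xs → sumL xs
      (λ x → [ x₀ ≟ˢ x ]· φ x) R.≈ φ x₀
    sumL-unique {x ∷ xs} φ (x≢ ∷ u) (here ≡.refl) = R.trans (R.+-cong ([]·-yes (x ≟ˢ x) ≡.refl) (off xs x≢))
      (R.+-identityʳ _)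
      where
      off : ∀ xs {x} → All (x ≢_) xs → sumL xs (λ y → [ x ≟ˢ y ]· φ y) R.≈ R.0#
      off []       []         = R.refl
      off (y ∷ ys) (x≢y ∷ ps) = R.trans (R.+-cong ([]·-no (_ ≟ˢ y) x≢y) (off ys ps)) (R.+-identityˡ _)
    sumL-unique {x ∷ xs} {x₀} φ (x≢ ∷ u) (there x∈) = R.trans (R.+-cong ([]·-no (x₀ ≟ˢ x) λ eq → All.lookup
      x≢ x∈ (≡.sym eq)) (sumL-unique φ u x∈)) (R.+-identityˡ _)

    Bounded : ℕ → Poly → Set ℓ
    Bounded N p = ∀ w s → N ℕ.< exponent s w → coefficient p w R.≈ R.0#

    -- The left side is the coefficient of `w` in the combination of the monomial symmetric
    -- polynomials of the box, since the one for ν has the coefficient [ shape = ν ]. At most one ν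
    -- contributes; if none does, some exponent exceeds `N`.
    expansion : ∀ N p → IsSymmetric p → Bounded N p → ∀ w →
      sumL (box N) (λ ν → [ shape (exps w) ≟ˢ ν ]· coefficient p (word (vector ν))) R.≈ coefficient p w
    expansion N p sym-p bounded w = cases (Fin.all? λ s → exps w s ℕ.≤? N)
      where
      cases : Dec (∀ s → exps w s ℕ.≤ N) → sumL (box N) (λ ν → [ shape (exps w) ≟ˢ ν ]· coefficient p
        (word (vector ν))) R.≈ coefficient p w
      cases (yes le) = R.trans (sumL-unique (λ ν → coefficient p (word (vector ν))) (box-unique N)
        (box-complete N (exps w) le)) (R.sym (symmetric-shape p sym-p w))
      cases (no ≰) with Fin.¬∀⟶∃¬ n _ (λ s → exps w s ℕ.≤? N) ≰
      ... | s , w≰N = R.trans (zeros (box N) (λ ν∈ eq → w≰N (↭-bounded (vector-shape (exps w))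
              (λ i → ≡.subst (λ ν → vector ν i ℕ.≤ N) (≡.sym eq) (box-bounded ν∈ i)) s)))
              (R.sym (bounded w s (ℕ.≰⇒> w≰N)))
        where
        zeros : ∀ xs → (∀ {ν} → ν ∈ xs → shape (exps w) ≢ ν) → sumL xs (λ ν → [ shape (exps w) ≟ˢ ν ]·
          coefficient p (word (vector ν))) R.≈ R.0#
        zeros []       ≢ = R.refl
        zeros (ν ∷ xs) ≢ = R.trans (R.+-cong ([]·-no (shape (exps w) ≟ˢ ν) (≢ (here ≡.refl)))
          (zeros xs (≢ ∘ there))) (R.+-identityˡ _)

-- The tensor product Λₙ ⊗ K and its normal form

module TensorProduct {c ℓ} (n : ℕ) (K : CommutativeRing c ℓ) where
  private
    module K = CommutativeRing K
    module ℤR = CommutativeRing ℤ.+-*-commutativeRing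
    module ℤΣ = ListSum ℤ.+-*-commutativeRing
    module ℤP = PolynomialRing ℤ.+-*-commutativeRing (Fin._≟_ {n})
    module KP = PolynomialRing K (Fin._≟_ {n})
  open SymmetricPolynomials n K.rawRing
  open Shapes n
  open Words n using (weigh)
  open Monomials (Fin._≟_ {n}) hiding (++-cong; ++-comm)
  private
    module ℤE = SymmetricExpansion ℤ.+-*-commutativeRing
    module KE = SymmetricExpansion K
  open IntegerCoefficients K using (fromℤ-+; fromℤ-*; fromℤ-neg; solve; _:=_; _:+_; _:*_; _:-_; :-_; con)
  open ListSum K
  open RawLeftModule Λ⊗K using (_*ₗ_)

  private
    Word = List (Fin n)

    ι : ℤ → K.Carrier
    ι = fromℤ K.rawRing

  fromℤ-hom : Homomorphism ℤ.+-*-commutativeRing K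
  fromℤ-hom = record
    { ⟦_⟧ = ι ; ⟦⟧-cong = K.reflexive ∘ ≡.cong ι ; +-homo = fromℤ-+ ; *-homo = fromℤ-*
    ; 0-homo = K.refl ; 1-homo = K.+-identityʳ _ }

  coefficientℤ : Λ → Word → ℤ
  coefficientℤ f = ℤP.coefficient (proj₁ f)

  -- The coefficient of the image in K[x], computed on the tensor itself, so that its invariance can
  -- be checked relation by relation.
  tensorCoefficient : Word → Tensor → K.Carrier
  tensorCoefficient w t = sumL t λ (f , a) → a K.* ι (coefficientℤ f w)

  tensorCoefficient-++ : ∀ w s t → tensorCoefficient w (s ++ t) K.≈ tensorCoefficient w s K.+ tensorCoefficient w t
  tensorCoefficient-++ w s t = sumL-++ s t _

  tensorCoefficient-cong : ∀ w {s t} → s ≈⊗ t → tensorCoefficient w s K.≈ tensorCoefficient w t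
  tensorCoefficient-cong w ≈⊗-refl = K.refl
  tensorCoefficient-cong w (≈⊗-sym eq) = K.sym (tensorCoefficient-cong w eq)
  tensorCoefficient-cong w (≈⊗-trans eq eq′) = K.trans (tensorCoefficient-cong w eq) (tensorCoefficient-cong w eq′)
  tensorCoefficient-cong w (++-cong {s} {s′} {t} {t′} eq eq′) = K.trans (tensorCoefficient-++ w s t)
    (K.trans (K.+-cong (tensorCoefficient-cong w eq) (tensorCoefficient-cong w eq′))
      (K.sym (tensorCoefficient-++ w s′ t′)))
  tensorCoefficient-cong w (++-comm s t) = K.trans (tensorCoefficient-++ w s t)
    (K.trans (K.+-comm _ _) (K.sym (tensorCoefficient-++ w t s)))
  tensorCoefficient-cong w (⊗-cong f≈g a≈b) = K.+-congʳ (K.*-cong a≈b (K.reflexive (≡.cong ι (f≈g w))))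
  tensorCoefficient-cong w (⊗-zeroˡ f≈0) = K.trans (K.+-identityʳ _)
    (K.trans (K.*-congˡ (K.reflexive (≡.cong ι (f≈0 w)))) (K.zeroʳ _))
  tensorCoefficient-cong w ⊗-zeroʳ = K.trans (K.+-identityʳ _) (K.zeroˡ _)
  tensorCoefficient-cong w (⊗-addˡ {f} {g} {h} {a} h≈) = begin
    a K.* ι (coefficientℤ h w) K.+ K.0#
      ≈⟨ K.+-congʳ (K.*-congˡ (K.trans (K.reflexive (≡.cong ι (≡.trans (h≈ w) (ℤP.coefficient-++ (proj₁ f)
        (proj₁ g) w)))) (fromℤ-+ (coefficientℤ f w) (coefficientℤ g w)))) ⟩
    a K.* (ι (coefficientℤ f w) K.+ ι (coefficientℤ g w)) K.+ K.0#
      ≈⟨ solve 3 (λ a f g → a :* (f :+ g) :+ con (+ 0) := a :* f :+ (a :* g :+ con (+ 0))) K.refl _ _ _ ⟩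
    a K.* ι (coefficientℤ f w) K.+ (a K.* ι (coefficientℤ g w) K.+ K.0#) ∎
    where open import Relation.Binary.Reasoning.Setoid K.setoid
  tensorCoefficient-cong w ⊗-addʳ = solve 3 (λ a b f → (a :+ b) :* f :+ con (+ 0) := a :* f :+
    (b :* f :+ con (+ 0))) K.refl _ _ _

  tensorCoefficient-* : ∀ w b t → tensorCoefficient w (b *ₗ t) K.≈ b K.* tensorCoefficient w t
  tensorCoefficient-* w b t = K.trans (sumL-map _ t _) (K.trans (sumL-cong t λ (f , a) → K.*-assoc b a _)
    (K.sym (*-sumL b t _)))

  coefficient-toPoly : ∀ t w → KP.coefficient (toPoly t) w K.≈ tensorCoefficient w t
  coefficient-toPoly []            w = K.refl
  coefficient-toPoly ((f , a) ∷ t) w = K.trans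
    (KP.coefficient-++ (CommutativeRing._*_ KP.polynomialRing (KP.constant a) (mapCoefficients (proj₁ f)))
      (toPoly t) w)
    (K.+-cong (K.trans (KP.coefficient-constant-* a (mapCoefficients (proj₁ f)) w)
      (K.*-congˡ (coefficient-map (proj₁ f) w))) (coefficient-toPoly t w))
    where open MapCoefficients fromℤ-hom (Fin._≟_ {n})

  0Λ : Λ
  0Λ = [] , λ σ w → ≡.refl

  infixl 6 _+Λ_
  _+Λ_ : Λ → Λ → Λ
  f@(p , p-sym) +Λ g@(q , q-sym) = p ++ q , λ σ w → ≡.trans
    (≡.cong (λ r → ℤP.coefficient r w) (List.map-++ _ p q))
    (≡.trans (ℤP.coefficient-++ (ℤP.rename (σ Perm.⟨$⟩ʳ_) p) _ w)
    (≡.trans (≡.cong₂ ℤ._+_ (p-sym σ w) (q-sym σ w)) (≡.sym (ℤP.coefficient-++ p q w))))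

  infixr 7 _*Λ_
  _*Λ_ : ℤ → Λ → Λ
  z *Λ (p , p-sym) = z*p , λ σ w → ≡.trans (renamed σ z*p w) (≡.trans (ℤP.coefficient-constant-* z p
    (List.map (σ Perm.⟨$⟩ˡ_) w))
      (≡.trans (≡.cong (z ℤ.*_) (≡.trans (≡.sym (renamed σ p w)) (p-sym σ w)))
        (≡.sym (ℤP.coefficient-constant-* z p w))))
    where
    z*p = CommutativeRing._*_ ℤP.polynomialRing (ℤP.constant z) p
    renamed : ∀ (σ : Perm.Permutation′ n) p w → ℤP.coefficient (ℤP.rename (σ Perm.⟨$⟩ʳ_) p) w ≡
      ℤP.coefficient p (List.map (σ Perm.⟨$⟩ˡ_) w)
    renamed σ = ℤP.coefficient-rename (λ v → Perm.inverseˡ σ) (λ v → Perm.inverseʳ σ)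

  coefficient-*Λ : ∀ z f w → coefficientℤ (z *Λ f) w ≡ z ℤ.* coefficientℤ f w
  coefficient-*Λ z f w = ℤP.coefficient-constant-* z (proj₁ f) w

  coefficient-+Λ : ∀ f g w → coefficientℤ (f +Λ g) w ≡ coefficientℤ f w ℤ.+ coefficientℤ g w
  coefficient-+Λ f g w = ℤP.coefficient-++ (proj₁ f) (proj₁ g) w

  -- The monomial symmetric polynomial m_ν. The rearrangements of ν are found among the vectors with
  -- entries at most |ν|, a crude bound for its parts.
  monomialPoly : Shape → ℤP.Poly
  monomialPoly ν = List.map (λ e → + 1 , word e)
    (filter (λ e → shape e ≟ˢ ν) (allFamilies λ (_ : Fin n) → upTo (suc (ListAction.sum (partsOf ν)))))

  coefficient-monomialPoly : ∀ ν w → ℤP.coefficient (monomialPoly ν) w ≡ ℤΣ.[ shape (exps w) ≟ˢ ν ]· + 1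
  coefficient-monomialPoly ν w = begin
    ℤP.coefficient (monomialPoly ν) w
      ≡⟨ ℤP.coefficient-sum (monomialPoly ν) w ⟩
    ℤΣ.sumL (monomialPoly ν) (λ (z , u) → ℤΣ.[ w ∼? u ]· z)
      ≡⟨ ℤΣ.sumL-map (λ e → + 1 , word e) (filter (λ e → shape e ≟ˢ ν) families′) (λ (z , u) → ℤΣ.[ w ∼? u ]· z) ⟩
    ℤΣ.sumL (filter (λ e → shape e ≟ˢ ν) families′) (λ e → ℤΣ.[ w ∼? word e ]· + 1)
      ≡⟨ ℤΣ.sumL-filter (λ e → shape e ≟ˢ ν) families′ (λ e → ℤΣ.[ w ∼? word e ]· + 1) ⟩
    ℤΣ.sumL families′ (λ e → ℤΣ.[ shape e ≟ˢ ν ]· ℤΣ.[ w ∼? word e ]· + 1)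
      ≡⟨ cases (shape (exps w) ≟ˢ ν) ⟩
    ℤΣ.[ shape (exps w) ≟ˢ ν ]· + 1 ∎
    where
    open ≡-Reasoning
    open FamilySums ℤ.+-*-commutativeRing
    families′ = allFamilies λ (_ : Fin n) → upTo (suc (ListAction.sum (partsOf ν)))

    same : ∀ {e} → w ∼ word e → ∀ i → e i ≡ exps w i
    same {e} eq i = ≡.trans (≡.sym (exponent-word e i)) (≡.sym (exponents eq i))

    []·-0 : ∀ {P : Set} (d : Dec P) → ℤΣ.[ d ]· + 0 ≡ + 0
    []·-0 (yes _) = ≡.refl
    []·-0 (no _)  = ≡.refl

    cases : (d : Dec (shape (exps w) ≡ ν)) → ℤΣ.sumL families′ (λ e → ℤΣ.[ shape e ≟ˢ ν ]· ℤΣ.[ w ∼? word e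
      ]· + 1) ≡ ℤΣ.[ d ]· + 1
    cases (yes shape≡) = sample (samples-families {_~_ = _≡_} λ i → samples-upTo _ (exps w i) (bound i))
      (λ e → ℤΣ.[ shape e ≟ˢ ν ]· ℤΣ.[ w ∼? word e ]· + 1) (+ 1)
      (λ e e≡ → ≡.trans (ℤΣ.[]·-yes (shape e ≟ˢ ν) (≡.trans (shape-cong e≡) shape≡))
        (ℤΣ.[]·-yes (w ∼? word e) (same-exponents λ s → ≡.sym (≡.trans (exponent-word e s) (e≡ s)))))
      (λ e e≢ → ≡.trans (ℤΣ.[]·-cong (shape e ≟ˢ ν) (shape e ≟ˢ ν) id id λ _ → ℤΣ.[]·-no (w ∼? word e) (e≢ ∘ same))
        ([]·-0 (shape e ≟ˢ ν)))
      where
      bound : ∀ i → exps w i ℕ.≤ ListAction.sum (partsOf ν)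
      bound = ↭-bounded (vector-shape (exps w)) λ i → ≡.subst (λ ν′ → vector ν′ i ℕ.≤ ListAction.sum
        (partsOf ν)) (≡.sym shape≡) (entry-≤-sum (partsOf ν) (toℕ i))
    cases (no shape≢) = ℤΣ.sumL-0 families′ λ e → off e (w ∼? word e)
      where
      off : ∀ e (d : Dec (w ∼ word e)) → ℤΣ.[ shape e ≟ˢ ν ]· ℤΣ.[ d ]· + 1 ≡ + 0
      off e (no _)  = []·-0 (shape e ≟ˢ ν)
      off e (yes eq) = ℤΣ.[]·-no (shape e ≟ˢ ν) λ e≡ → shape≢ (≡.trans (≡.sym (shape-cong (same eq))) e≡)

  monomialSymmetric : Shape → Λ
  monomialSymmetric ν = monomialPoly ν , λ σ w → ≡.trans
    (ℤP.coefficient-rename (λ v → Perm.inverseˡ σ) (λ v → Perm.inverseʳ σ) (monomialPoly ν) w)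
    (≡.trans (coefficient-monomialPoly ν (List.map (σ Perm.⟨$⟩ˡ_) w))
    (≡.trans (≡.cong (λ ν′ → ℤΣ.[ ν′ ≟ˢ ν ]· + 1)
      (shape-↭ (↭-trans (↭-reflexive (List.tabulate-cong (exps-map σ w))) (tabulate-permute (exps w) σ))))
      (≡.sym (coefficient-monomialPoly ν w))))

  ≈⊗-setoid : Setoid _ _
  ≈⊗-setoid = record { Carrier = Tensor ; _≈_ = _≈⊗_ ; isEquivalence = record { refl = ≈⊗-refl ; sym =
    ≈⊗-sym ; trans = ≈⊗-trans } }

  module ⊗R = SetoidReasoning ≈⊗-setoid

  [_⊗_] : Λ → K.Carrier → Tensor
  [ f ⊗ a ] = (f , a) ∷ []

  cancel : ∀ f {a b} → a K.+ b K.≈ K.0# → [ f ⊗ a ] ++ [ f ⊗ b ] ≈⊗ []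
  cancel f a+b≈0 = ≈⊗-trans (≈⊗-sym ⊗-addʳ) (≈⊗-trans (⊗-cong {f} {f} (λ _ → ≡.refl) a+b≈0) (⊗-zeroʳ {f}))

  -- The relations express additivity in each argument; moving a multiple from one side to the other
  -- is an induction from it. Taking any `g` with the right coefficients lets each step split off
  -- one copy of `f`.
  scale-ℕ : ∀ k f g {a} → (∀ w → coefficientℤ g w ≡ + k ℤ.* coefficientℤ f w) → [ g ⊗ a ] ≈⊗ [ f ⊗ a K.* ι (+ k) ]
  scale-ℕ zero    f g {a} eq = ≈⊗-trans (⊗-zeroˡ {g} eq)
    (≈⊗-sym (≈⊗-trans (⊗-cong {f} {f} (λ _ → ≡.refl) (K.zeroʳ _)) (⊗-zeroʳ {f})))
  scale-ℕ (suc k) f g {a} eq = ⊗R.begin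
    [ g ⊗ a ]                               ⊗R.≈⟨ ⊗-addˡ {f} {+ k *Λ f} {g} split ⟩
    [ f ⊗ a ] ++ [ + k *Λ f ⊗ a ]           ⊗R.≈⟨ ++-cong (≈⊗-refl {[ f ⊗ a ]}) (scale-ℕ k f (+ k *Λ f)
      (coefficient-*Λ (+ k) f)) ⟩
    [ f ⊗ a ] ++ [ f ⊗ a K.* ι (+ k) ]      ⊗R.≈⟨ ⊗-addʳ ⟨
    [ f ⊗ a K.+ a K.* ι (+ k) ]             ⊗R.≈⟨ ⊗-cong {f} {f} (λ _ → ≡.refl)
      (solve 2 (λ a k → a :+ a :* k := a :* (con (+ 1) :+ k)) K.refl _ _) ⟩
    [ f ⊗ a K.* ι (+ suc k) ]               ⊗R.∎
    where
    split : ∀ w → coefficientℤ g w ≡ ℤP.coefficient (proj₁ f ++ proj₁ (+ k *Λ f)) w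
    split w = ≡.trans (eq w) (≡.trans (ℤ.suc-* (+ k) (coefficientℤ f w))
      (≡.sym (≡.trans (ℤP.coefficient-++ (proj₁ f) _ w) (≡.cong (λ z → coefficientℤ f w ℤ.+ z)
        (coefficient-*Λ (+ k) f w)))))

  scale : ∀ z f {a} → [ z *Λ f ⊗ a ] ≈⊗ [ f ⊗ a K.* ι z ]
  scale (+ k) f = scale-ℕ k f (+ k *Λ f) (coefficient-*Λ (+ k) f)
  -- Opposite multiples are inserted in the right argument. One of them is moved to the left, where
  -- it cancels the negative multiple of `f`.
  scale z@(-[1+ k ]) f {a} = ⊗R.begin
    [ g ⊗ a ]                                                          ⊗R.≈⟨ ++-cong (≈⊗-refl {[ g ⊗ a ]})
      (cancel f (solve 2 (λ a k → a :* k :+ a :* (:- k) := con (+ 0)) K.refl _ _)) ⟨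
    [ g ⊗ a ] ++ ([ f ⊗ a K.* ι (+ suc k) ] ++ [ f ⊗ a K.* ι z ])      ⊗R.≈⟨ ++-cong (≈⊗-refl {[ g ⊗ a ]})
      (++-cong (scale-ℕ (suc k) f h (coefficient-*Λ (+ suc k) f)) (≈⊗-refl {[ f ⊗ a K.* ι z ]})) ⟨
    ([ g ⊗ a ] ++ [ h ⊗ a ]) ++ [ f ⊗ a K.* ι z ]                      ⊗R.≈⟨ ++-cong
      (≈⊗-trans (≈⊗-sym (⊗-addˡ {g} {h} {0Λ} inverse)) (⊗-zeroˡ {0Λ} λ _ → ≡.refl)) (≈⊗-refl {[ f ⊗ a K.* ι z ]}) ⟩
    [ f ⊗ a K.* ι z ]                                                  ⊗R.∎
    where
    g = z *Λ f
    h = + suc k *Λ f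
    inverse : ∀ w → + 0 ≡ ℤP.coefficient (proj₁ g ++ proj₁ h) w
    inverse w = ≡.sym (≡.trans (ℤP.coefficient-++ (proj₁ g) _ w) (≡.trans
      (≡.cong₂ ℤ._+_ (coefficient-*Λ z f w) (coefficient-*Λ (+ suc k) f w))
      (≡.trans (≡.sym (ℤ.*-distribʳ-+ (coefficientℤ f w) z (+ suc k))) (≡.cong (ℤ._* coefficientℤ f w)
        (ℤ.+-inverseˡ (+ suc k))))))

  normal : List Shape → (Shape → K.Carrier) → Tensor
  normal νs φ = List.map (λ ν → monomialSymmetric ν , φ ν) νs

  normal-cong : ∀ νs {φ ψ} → (∀ ν → φ ν K.≈ ψ ν) → normal νs φ ≈⊗ normal νs ψ
  normal-cong []       eq = ≈⊗-refl
  normal-cong (ν ∷ νs) eq = ++-cong (⊗-cong {monomialSymmetric ν} {monomialSymmetric ν} (λ _ → ≡.refl)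
    (eq ν)) (normal-cong νs eq)

  normal-0 : ∀ νs → normal νs (λ _ → K.0#) ≈⊗ []
  normal-0 []       = ≈⊗-refl
  normal-0 (ν ∷ νs) = ++-cong (⊗-zeroʳ {monomialSymmetric ν}) (normal-0 νs)

  normal-+ : ∀ νs φ ψ → normal νs φ ++ normal νs ψ ≈⊗ normal νs (λ ν → φ ν K.+ ψ ν)
  normal-+ []       φ ψ = ≈⊗-refl
  normal-+ (ν ∷ νs) φ ψ = ⊗R.begin
    [ m ⊗ φ ν ] ++ (normal νs φ ++ ([ m ⊗ ψ ν ] ++ normal νs ψ))     ⊗R.≈⟨ ++-cong (≈⊗-refl {[ m ⊗ φ ν ]})
      exchange ⟩
    [ m ⊗ φ ν ] ++ ([ m ⊗ ψ ν ] ++ (normal νs φ ++ normal νs ψ))     ⊗R.≈⟨ ++-cong (≈⊗-sym (⊗-addʳ {m}))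
      (normal-+ νs φ ψ) ⟩
    [ m ⊗ φ ν K.+ ψ ν ] ++ normal νs (λ ν → φ ν K.+ ψ ν)             ⊗R.∎
    where
    m = monomialSymmetric ν
    exchange : normal νs φ ++ ([ m ⊗ ψ ν ] ++ normal νs ψ) ≈⊗ [ m ⊗ ψ ν ] ++ (normal νs φ ++ normal νs ψ)
    exchange = ≡.subst (_≈⊗ [ m ⊗ ψ ν ] ++ (normal νs φ ++ normal νs ψ)) (List.++-assoc (normal νs φ) [ m ⊗
      ψ ν ] (normal νs ψ))
      (++-cong (++-comm (normal νs φ) [ m ⊗ ψ ν ]) (≈⊗-refl {normal νs ψ}))

  combineΛ : List Shape → (Shape → ℤ) → Λ
  combineΛ []       z = 0Λ
  combineΛ (ν ∷ νs) z = z ν *Λ monomialSymmetric ν +Λ combineΛ νs z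

  coefficient-combineΛ : ∀ νs z w → coefficientℤ (combineΛ νs z) w ≡ ℤΣ.sumL νs (λ ν → ℤΣ.[ shape (exps w)
    ≟ˢ ν ]· z ν)
  coefficient-combineΛ []       z w = ≡.refl
  coefficient-combineΛ (ν ∷ νs) z w = ≡.trans (coefficient-+Λ (z ν *Λ monomialSymmetric ν) (combineΛ νs z) w)
    (≡.cong₂ ℤ._+_ (≡.trans (coefficient-*Λ (z ν) (monomialSymmetric ν) w)
      (≡.trans (≡.cong (z ν ℤ.*_) (coefficient-monomialPoly ν w)) (times (shape (exps w) ≟ˢ ν))))
      (coefficient-combineΛ νs z w))
    where
    times : ∀ {P : Set} (d : Dec P) → z ν ℤ.* (ℤΣ.[ d ]· + 1) ≡ ℤΣ.[ d ]· z ν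
    times (yes _) = ℤ.*-identityʳ (z ν)
    times (no _)  = ℤ.*-zeroʳ (z ν)

  combineΛ-normal : ∀ νs z {a} → [ combineΛ νs z ⊗ a ] ≈⊗ normal νs (λ ν → a K.* ι (z ν))
  combineΛ-normal []       z = ⊗-zeroˡ {0Λ} λ _ → ≡.refl
  combineΛ-normal (ν ∷ νs) z = ≈⊗-trans (⊗-addˡ {z ν *Λ monomialSymmetric ν} {combineΛ νs z}
    {combineΛ (ν ∷ νs) z} λ _ → ≡.refl)
    (++-cong (scale (z ν) (monomialSymmetric ν)) (combineΛ-normal νs z))

  leadingWord : Shape → Word
  leadingWord ν = word (vector ν)

  BoundedTensor : ℕ → Tensor → Set _
  BoundedTensor N = All (λ (f , _) → ℤE.Bounded N (proj₁ f))

  -- The integral expansion of each `f` in monomial symmetric polynomials is split by additivity,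
  -- and its integer coefficients are moved into `K`.
  normalForm : ∀ N t → BoundedTensor N t → t ≈⊗ normal (box N) (λ ν → tensorCoefficient (leadingWord ν) t)
  normalForm N []            _            = ≈⊗-sym (normal-0 (box N))
  normalForm N ((f , a) ∷ t) (f≤N ∷ t≤N) = ⊗R.begin
    [ f ⊗ a ] ++ t
      ⊗R.≈⟨ ++-cong (⊗-cong {f} {combineΛ (box N) z} expand K.refl) (normalForm N t t≤N) ⟩
    [ combineΛ (box N) z ⊗ a ] ++ normal (box N) (λ ν → tensorCoefficient (leadingWord ν) t)
      ⊗R.≈⟨ ++-cong (combineΛ-normal (box N) z) ≈⊗-refl ⟩
    normal (box N) (λ ν → a K.* ι (z ν)) ++ normal (box N) (λ ν → tensorCoefficient (leadingWord ν) t)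
      ⊗R.≈⟨ normal-+ (box N) _ _ ⟩
    normal (box N) (λ ν → tensorCoefficient (leadingWord ν) ((f , a) ∷ t)) ⊗R.∎
    where
    z : Shape → ℤ
    z ν = coefficientℤ f (leadingWord ν)

    expand : ∀ w → coefficientℤ f w ≡ coefficientℤ (combineΛ (box N) z) w
    expand w = ≡.sym (≡.trans (coefficient-combineΛ (box N) z w) (ℤE.expansion N (proj₁ f) (proj₂ f) f≤N w))

  -- The sum of the lengths of all listed words, a crude bound for every exponent that occurs.
  degreeBound : ℤP.Poly → ℕ
  degreeBound p = ListAction.sum (List.map (length ∘ proj₂) p)

  tensorBound : Tensor → ℕ
  tensorBound t = ListAction.sum (List.map (λ (f , _) → degreeBound (proj₁ f)) t)

  member≤sum : ∀ {a} {A : Set a} (f : A → ℕ) {x xs} → x ∈ xs → f x ℕ.≤ ListAction.sum (List.map f xs)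
  member≤sum f (here ≡.refl) = ℕ.m≤m+n _ _
  member≤sum f {xs = y ∷ ys} (there x∈) = ℕ.≤-trans (member≤sum f x∈) (ℕ.m≤n+m _ (f y))

  bounded : ∀ p {N} → degreeBound p ℕ.≤ N → ℤE.Bounded N p
  bounded p p≤N w s N< = Degrees.coefficient-zero ℤ.+-*-commutativeRing n s p w
    (λ {t} t∈ → ℕ.≤-trans (List.length-filter (s Fin.≟_) (proj₂ t)) (ℕ.≤-trans (member≤sum (length ∘ proj₂)
      t∈) p≤N)) N<

  boundedTensor : ∀ t {N} → tensorBound t ℕ.≤ N → BoundedTensor N t
  boundedTensor t t≤N = All.tabulate λ {(f , _)} f∈ → bounded (proj₁ f)
    (ℕ.≤-trans (member≤sum (λ (f , _) → degreeBound (proj₁ f)) f∈) t≤N)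

  -- The map from Λₙ ⊗ K to K[x] is injective: in a box that contains both tensors, their normal
  -- forms are determined by the coefficients.
  ≈⊗-extensional : ∀ s t → (∀ w → tensorCoefficient w s K.≈ tensorCoefficient w t) → s ≈⊗ t
  ≈⊗-extensional s t eq = ⊗R.begin
    s                                                               ⊗R.≈⟨ normalForm N s (boundedTensor s
      (ℕ.m≤m+n _ _)) ⟩
    normal (box N) (λ ν → tensorCoefficient (leadingWord ν) s)      ⊗R.≈⟨ normal-cong (box N)
      (λ ν → eq (leadingWord ν)) ⟩
    normal (box N) (λ ν → tensorCoefficient (leadingWord ν) t)      ⊗R.≈⟨ normalForm N t (boundedTensor t
      (ℕ.m≤n+m _ (tensorBound s))) ⟨
    t                                                               ⊗R.∎
    where N = tensorBound s ℕ.+ tensorBound t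

  tensorCoefficient-shape : ∀ t w → tensorCoefficient w t K.≈ tensorCoefficient (leadingWord (shape (exps w))) t
  tensorCoefficient-shape t w = sumL-cong t λ (f , a) → K.*-congˡ (K.reflexive (≡.cong ι (ℤE.symmetric-shape
    (proj₁ f) (proj₂ f) w)))

  tensorCoefficient-bounded : ∀ {N} t → BoundedTensor N t → ∀ w s → N ℕ.< exponent s w → tensorCoefficient w
    t K.≈ K.0#
  tensorCoefficient-bounded []            _           w s N< = K.refl
  tensorCoefficient-bounded ((f , a) ∷ t) (f≤ ∷ t≤) w s N< = K.trans (K.+-cong
    (K.trans (K.*-congˡ (K.reflexive (≡.cong ι (f≤ w s N<)))) (K.zeroʳ a)) (tensorCoefficient-bounded t t≤ w
      s N<)) (K.+-identityˡ _)

  -- The preimage in Λₙ ⊗ K of a symmetric polynomial with exponents at most `N`.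
  symmetricTensor : ℕ → KP.Poly → Tensor
  symmetricTensor N p = normal (box N) (λ ν → KP.coefficient p (leadingWord ν))

  coefficient-symmetricTensor : ∀ N p → KE.IsSymmetric p → KE.Bounded N p → ∀ w →
    tensorCoefficient w (symmetricTensor N p) K.≈ KP.coefficient p w
  coefficient-symmetricTensor N p p-sym p≤N w = K.trans (sumL-map _ (box N) _)
    (K.trans (sumL-cong (box N) λ ν → K.trans (K.*-congˡ (K.reflexive (≡.cong ι (coefficient-monomialPoly ν
      w)))) (times ν (shape (exps w) ≟ˢ ν)))
      (KE.expansion N p p-sym p≤N w))
    where
    times : ∀ ν {P : Set} (d : Dec P) → KP.coefficient p (leadingWord ν) K.* ι (ℤΣ.[ d ]· + 1) K.≈ [ d ]·
      KP.coefficient p (leadingWord ν)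
    times ν (yes _) = solve 1 (λ x → x :* (con (+ 1) :+ con (+ 0)) := x) K.refl _
    times ν (no _)  = K.zeroʳ _

-- The transition matrix and the basis

next-lookup : ∀ xs → next (List.lookup xs) ≡ entry xs 0
next-lookup []       = ≡.refl
next-lookup (x ∷ xs) = ≡.refl

lookup-injective : ∀ {a} {A : Set a} {xs : List A} → Unique xs → ∀ i j → List.lookup xs i ≡ List.lookup xs j → i ≡ j
lookup-injective (x≢ ∷ u) zero    zero    eq = ≡.refl
lookup-injective (x≢ ∷ u) zero    (suc j) eq = contradiction eq (All.lookup x≢ (∈.∈-lookup j))
lookup-injective (x≢ ∷ u) (suc i) zero    eq = contradiction (≡.sym eq) (All.lookup x≢ (∈.∈-lookup i))
lookup-injective (x≢ ∷ u) (suc i) (suc j) eq = ≡.cong suc (lookup-injective u i j eq)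

module GrothendieckBasis {c₁ ℓ₁ c₂ ℓ₂ c₃ ℓ₃}
    {D : CommutativeRing c₁ ℓ₁} {K : CommutativeRing c₂ ℓ₂} {F : CommutativeRing c₃ ℓ₃}
    (h : Homomorphism D K) (ε : Homomorphism D F)
    (unit : ∀ d → CommutativeRing._≈_ F (Homomorphism.⟦_⟧ ε d) (CommutativeRing.1# F) →
      ∃[ s ] CommutativeRing._≈_ K (CommutativeRing._*_ K s (Homomorphism.⟦_⟧ h d)) (CommutativeRing.1# K))
    (β : CommutativeRing.Carrier D) (a : ℕ → CommutativeRing.Carrier D)
    (ε-β : CommutativeRing._≈_ F (Homomorphism.⟦_⟧ ε β) (CommutativeRing.0# F))
    (ε-a : ∀ k → CommutativeRing._≈_ F (Homomorphism.⟦_⟧ ε (a k)) (CommutativeRing.0# F))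
    (n : ℕ) (v : Fin n) (v≡0 : toℕ v ≡ 0) where
  private
    module K = CommutativeRing K
    module F = CommutativeRing F
    module h = Homomorphism h
    module ε = Homomorphism ε
    module DP = PolynomialRing D (Fin._≟_ {n})
    module KP = PolynomialRing K (Fin._≟_ {n})
    module FP = PolynomialRing F (Fin._≟_ {n})
    module KX = CommutativeRing KP.polynomialRing
    module FX = CommutativeRing FP.polynomialRing
    module Mh = MapCoefficients h (Fin._≟_ {n})
    module Mε = MapCoefficients ε (Fin._≟_ {n})
  open SymmetricPolynomials n K.rawRing using (Tensor; Λ⊗K; toPoly; _≈⊗_)
  open RawLeftModule Λ⊗K using (_*ₗ_)
  open Shapes n
  open SymmetricExpansion K
  open TensorProduct n K
  open Elimination h ε unit
  open Monomials (Fin._≟_ {n}) using (exponent)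
  open CommutativeMonoidSum K.+-commutativeMonoid using (sum)
  open BoxProducts K.+-commutativeMonoid using (sum-cong)

  β̂ : KP.Poly
  β̂ = KP.constant h.⟦ β ⟧

  â : ℕ → KP.Poly
  â k = KP.constant h.⟦ a k ⟧

  G : Partition → KP.Poly
  G = GrothendieckSums.grothendieck KP.polynomialRing β̂ n KP.var â

  G-symmetric : ∀ μ → IsSymmetric (G μ)
  G-symmetric μ σ = KX.trans {KP.rename (σ Perm.⟨$⟩ʳ_) (G μ)} {Gσ} {G μ}
    (grothendieck-homo (KP.rename-hom (λ _ → Perm.inverseˡ σ) (λ _ → Perm.inverseʳ σ))
      {β = β̂} {β̂} {n} {KP.var} {λ r → KP.var (σ Perm.⟨$⟩ʳ r)} {â} {â} (KX.refl {β̂}) (λ r → KX.refl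
        {KP.var (σ Perm.⟨$⟩ʳ r)}) (λ k → KX.refl {â k}) μ)
    (grothendieck-symmetric KP.polynomialRing β̂ n â μ (tabulate-permute KP.var σ))
    where
    Gσ = GrothendieckSums.grothendieck KP.polynomialRing β̂ n (λ r → KP.var (σ Perm.⟨$⟩ʳ r)) â μ

  width : Partition → ℕ
  width μ = next (Partition.rowLength μ)

  -- By symmetry the exponents of `w` may be sorted, which moves the largest one to the first
  -- variable `v`; there the degree bound applies.
  G-bounded : ∀ μ → Bounded (width μ) (G μ)
  G-bounded μ w s width< = K.trans (symmetric-shape (G μ) (G-symmetric μ) w)
    (Degrees.degree-grothendieck K n v h.⟦ β ⟧ (λ k → h.⟦ a k ⟧) μ v≡0 (leadingWord ν) (ℕ.<-≤-trans width<
      (ℕ.≤-trans w≤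
      (ℕ.≤-reflexive (≡.sym (≡.trans (exponent-word (vector ν) v) (≡.cong (entry (partsOf ν)) v≡0)))))))
    where
    ν = shape (exps w)
    w≤ : exponent s w ℕ.≤ entry (partsOf ν) 0
    w≤ = ↭-bounded (vector-shape (exps w)) (λ i → entry-≤-first (Partition.decreasing (proj₁ ν)) (toℕ i)) s

  g : Shape → Tensor
  g λ′ = symmetricTensor (width (proj₁ λ′)) (G (proj₁ λ′))

  coefficient-g : ∀ λ′ w → tensorCoefficient w (g λ′) K.≈ KP.coefficient (G (proj₁ λ′)) w
  coefficient-g (μ , _) = coefficient-symmetricTensor (width μ) (G μ) (G-symmetric μ) (G-bounded μ)

  toPoly-g : ∀ λ′ → toPoly (g λ′) KX.≈ G (proj₁ λ′)
  toPoly-g λ′ w = K.trans (coefficient-toPoly (g λ′) w) (coefficient-g λ′ w)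

  -- G_λ with coefficients polynomial in the parameters, of which both the polynomial over `K` and
  -- the specialization at the origin are images.
  G-lifted : Partition → DP.Poly
  G-lifted = GrothendieckSums.grothendieck DP.polynomialRing (DP.constant β) n DP.var (λ k → DP.constant (a k))

  G-specialized : Partition → FP.Poly
  G-specialized = GrothendieckSums.grothendieck FP.polynomialRing FX.0# n FP.var (λ _ → FX.0#)

  module _ {k} (index : Fin k → Shape) where
    -- For a symmetric polynomial the coefficient at `leadingWord ν` is that of m_ν, so these are
    -- entries of the transition matrix. Rows and columns are indexed by the same family of shapes.
    matrix : Fin k → Fin k → CommutativeRing.Carrier D
    matrix j l = DP.coefficient (G-lifted (proj₁ (index j))) (leadingWord (index l))

    matrix-h : ∀ j l → h.⟦ matrix j l ⟧ K.≈ KP.coefficient (G (proj₁ (index j))) (leadingWord (index l))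
    matrix-h j l = K.trans (K.sym (Mh.coefficient-map (G-lifted (proj₁ (index j))) (leadingWord (index l))))
      (grothendieck-homo Mh.map-hom {DP.constant β} {β̂} {n} {DP.var} {KP.var} {λ k → DP.constant (a k)} {â}
        (KX.refl {β̂}) var-homo (λ k → KX.refl {â k}) (proj₁ (index j)) (leadingWord (index l)))
      where
      var-homo : ∀ r → Mh.mapCoefficients (DP.var r) KX.≈ KP.var r
      var-homo r w = K.+-congʳ (ListSum.[]·-cong K (w KP.≈ₘ? (r ∷ [])) (w KP.≈ₘ? (r ∷ [])) id id (λ _ → h.1-homo))

    matrix-ε : ∀ j l → ε.⟦ matrix j l ⟧ F.≈ FP.coefficient (G-specialized (proj₁ (index j))) (leadingWord (index l))
    matrix-ε j l = F.trans (F.sym (Mε.coefficient-map (G-lifted (proj₁ (index j))) (leadingWord (index l))))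
      (grothendieck-homo Mε.map-hom {DP.constant β} {FX.0#} {n} {DP.var} {FP.var} {λ k → DP.constant (a k)}
        {λ _ → FX.0#} (constant-zero ε-β) var-homo (λ k → constant-zero (ε-a k)) (proj₁ (index j))
        (leadingWord (index l)))
      where
      constant-zero : ∀ {x} → x F.≈ F.0# → FP.constant x FX.≈ FX.0#
      constant-zero {x} eq = FX.trans {FP.constant x} {FP.constant F.0#} {FX.0#} (Homomorphism.⟦⟧-cong
        FP.constant-hom eq) (Homomorphism.0-homo FP.constant-hom)
      var-homo : ∀ r → Mε.mapCoefficients (DP.var r) FX.≈ FP.var r
      var-homo r w = F.+-congʳ (ListSum.[]·-cong F (w FP.≈ₘ? (r ∷ [])) (w FP.≈ₘ? (r ∷ [])) id id (λ _ → ε.1-homo))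

    rank : Fin k → ℕ
    rank j = LowestTerms.rank F n (proj₁ (index j)) (proj₂ (index j))

    matrix-unitriangular : (∀ i j → index i ≡ index j → i ≡ j) → Unitriangular matrix rank
    matrix-unitriangular inj .Unitriangular.diagonal j = F.trans (matrix-ε j j)
      (LowestTerms.coefficient-shaped F n (proj₁ (index j)) (proj₂ (index j)) (leadingWord (index j))
        (exponent-word (vector (index j))))
    matrix-unitriangular inj .Unitriangular.off-diagonal j l j≢l ≮ = F.trans (matrix-ε j l)
      (LowestTerms.coefficient-vanishes F n (proj₁ (index j)) (proj₂ (index j)) (leadingWord (index l))
        (λ shaped → j≢l (inj j l (≡.trans (≡.sym (shape-vector (index j)))
          (≡.trans (shape-cong λ s → ≡.trans (≡.sym (shaped s)) (exponent-word (vector (index l)) s))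
            (shape-vector (index l))))))
        (λ lt → ≮ (≡.subst (ℕ._< rank j)
          (LowestTerms.rank-shaped F n (proj₁ (index l)) (proj₂ (index l)) (leadingWord (index l))
            (exponent-word (vector (index l)))) lt)))

  tensorCoefficient-combination : ∀ {k} (coeffs : Fin k → K.Carrier) (index : Fin k → Shape) w →
    tensorCoefficient w (combination K.rawRing Λ⊗K g coeffs index) K.≈ sum λ j → coeffs j K.* KP.coefficient
      (G (proj₁ (index j))) w
  tensorCoefficient-combination {zero}  coeffs index w = K.refl
  tensorCoefficient-combination {suc k} coeffs index w = K.trans
    (tensorCoefficient-++ w (coeffs zero *ₗ g (index zero)) (combination K.rawRing Λ⊗K g (coeffs ∘ suc)
      (index ∘ suc)))
    (K.+-cong (K.trans (tensorCoefficient-* w (coeffs zero) (g (index zero)))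
      (K.*-congˡ (coefficient-g (index zero) w)))
      (tensorCoefficient-combination (coeffs ∘ suc) (index ∘ suc) w))

  combine-matrix : ∀ {k} (coeffs : Fin k → K.Carrier) (index : Fin k → Shape) l →
    combine (matrix index) coeffs l K.≈ tensorCoefficient (leadingWord (index l)) (combination K.rawRing Λ⊗K
      g coeffs index)
  combine-matrix {k} coeffs index l = K.trans (sum-cong k λ j → K.*-congˡ (matrix-h index j l))
    (K.sym (tensorCoefficient-combination coeffs index (leadingWord (index l))))

  -- For any finite family of distinct shapes, the coefficients at their own leading words form an
  -- invertible square matrix; the family need not fill a box.
  independent : LinearlyIndependent K.rawRing Λ⊗K g
  independent index inj coeffs eq = injective (matrix index) (rank index) (matrix-unitriangular index λ i j
    → inj) coeffs
    λ l → K.trans (combine-matrix coeffs index l) (tensorCoefficient-cong (leadingWord (index l)) eq)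

  -- With `N` a bound for the exponents of `u`, the system is solved for the partitions of the box.
  -- Coefficients in the box then agree by the choice of `coeffs`; outside it both sides vanish,
  -- because each G_λ used has width at most `N`.
  spanning : Spanning K.rawRing Λ⊗K g
  spanning u = length (box N) , coeffs , shapes , ≈⊗-extensional u total λ w → same w (Fin.all? λ s → exps w
    s ℕ.≤? N)
    where
    N = tensorBound u

    shapes : Fin (length (box N)) → Shape
    shapes = List.lookup (box N)

    solution = surjective (matrix shapes) (rank shapes) (matrix-unitriangular shapes (lookup-injective
      (box-unique N)))
      λ l → tensorCoefficient (leadingWord (shapes l)) u
    coeffs = proj₁ solution

    total : Tensor
    total = combination K.rawRing Λ⊗K g coeffs shapes

    width≤N : ∀ j → width (proj₁ (shapes j)) ℕ.≤ N
    width≤N j = ℕ.≤-trans (ℕ.≤-reflexive (≡.trans (next-lookup (partsOf (shapes j)))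
      (≡.cong (entry (partsOf (shapes j))) (≡.sym v≡0))))
      (box-bounded (∈.∈-lookup j) v)

    sum-zero : ∀ {k} (f : Fin k → K.Carrier) → (∀ j → f j K.≈ K.0#) → sum f K.≈ K.0#
    sum-zero {k} f eq = BoxProducts.sum-ε K.+-commutativeMonoid k eq

    same : ∀ w → Dec (∀ s → exps w s ℕ.≤ N) → tensorCoefficient w u K.≈ tensorCoefficient w total
    same w (no ≰) = let (s , w≰N) = Fin.¬∀⟶∃¬ n (λ s → exps w s ℕ.≤ N) (λ s → exps w s ℕ.≤? N) ≰ in
      K.trans (tensorCoefficient-bounded {N} u (boundedTensor u {N} ℕ.≤-refl) w s (ℕ.≰⇒> w≰N))
      (K.sym (K.trans (tensorCoefficient-combination coeffs shapes w) (sum-zero (λ j → coeffs j K.*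
        KP.coefficient (G (proj₁ (shapes j))) w) λ j →
        K.trans (K.*-congˡ (G-bounded (proj₁ (shapes j)) w s (ℕ.≤-<-trans (width≤N j) (ℕ.≰⇒> w≰N)))) (K.zeroʳ _))))
    same w (yes w≤N) = begin
      tensorCoefficient w u                                       ≈⟨ tensorCoefficient-shape u w ⟩
      tensorCoefficient (leadingWord (shape (exps w))) u          ≡⟨ ≡.cong (λ ν → tensorCoefficient
        (leadingWord ν) u) found ⟩
      tensorCoefficient (leadingWord (shapes l)) u                ≈⟨ proj₂ solution l ⟨
      combine (matrix shapes) coeffs l                            ≈⟨ combine-matrix coeffs shapes l ⟩
      tensorCoefficient (leadingWord (shapes l)) total            ≡⟨ ≡.cong (λ ν → tensorCoefficient
        (leadingWord ν) total) found ⟨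
      tensorCoefficient (leadingWord (shape (exps w))) total      ≈⟨ tensorCoefficient-shape total w ⟨
      tensorCoefficient w total                                   ∎
      where
      open import Relation.Binary.Reasoning.Setoid K.setoid
      shape∈ = box-complete N (exps w) w≤N
      l = Any.index shape∈
      found : shape (exps w) ≡ shapes l
      found = Any.lookup-index shape∈

module _ {c ℓ₁ ℓ₂} (F : HeytingField c ℓ₁ ℓ₂) where
  private
    module FD = HeytingFieldPolynomials F _≟ᴾ_
    module D = PolynomialRing FD.fieldRing _≟ᴾ_
    module Fr = FractionFieldRing D.polynomialRing FD.*-cancelˡ
    module F = CommutativeRing FD.fieldRing
    ε = constantTerm FD.fieldRing _≟ᴾ_

    -- A polynomial with constant term 1 is nonzero, since 1 and 0 differ in 𝔽; hence it is
    -- invertible among the fractions.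
    unit : ∀ d → D.coefficient d [] F.≈ F.1# → _
    unit d d≈1 = Fr.embed-invertible d λ d≈0 → FD.1≉0 (F.trans (F.sym d≈1) (d≈0 []))

    parameter-zero : ∀ p → D.coefficient (D.var p) [] F.≈ F.0#
    parameter-zero p = F.trans (D.coefficient-sum (D.var p) []) (F.trans (F.+-identityʳ _) (ListSum.[]·-no
      FD.fieldRing ([] D.∼? (p ∷ [])) λ eq →
      ℕ.0≢1+n (≡.trans (D.exponents eq p) (D.exponent-here p []))))

  module FactorialGrothendieckBasis (n : ℕ) = GrothendieckBasis {D = D.polynomialRing} {Fr.fractionRing}
    {FD.fieldRing}
    Fr.embed-hom ε unit (D.var β′) (λ k → D.var (a′ k)) (parameter-zero β′) (λ k → parameter-zero (a′ k))
      (suc n) zero ≡.refl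

theorem4p6 : ∀ {c ℓ₁ ℓ₂} (F : HeytingField c ℓ₁ ℓ₂) (n : ℕ) .{{_ : NonZero n}} →
    let open RationalFunctions F
        open SymmetricPolynomials n 𝔽⟨β,a⟩
        open RawRing K[x].polyRing using (_≈_)
        open Grothendieck F n
    in Σ[ g ∈ (PartitionWithAtMost n Parts → RawLeftModule.Carrierᴹ Λ⊗K) ]
         (∀ μ → toPoly (g μ) ≈ G (proj₁ μ)) × IsBasis 𝔽⟨β,a⟩ Λ⊗K g
theorem4p6 F (suc n) = g , toPoly-g , independent , spanning
  where open FactorialGrothendieckBasis F n
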